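{- Let $p$ be a prime, $d\ge1$ an integer, and let $(X_n)_{n\ge0}$ be a $\mathbb{Z}_p^d$-tower of strongly connected digraphs. For all $n\ge1$, $$\delta(X_n)\ge\delta(X_{n-1}).$$
   Context: **Digraphs and towers.** A digraph $X$ consists of finite sets $V(X)$ (vertices) and $\mathbb{E}(X)$ (directed edges) with an incidence map $e\mapsto(o(e),t(e))\in V(X)\times V(X)$. It is strongly connected if for all $(v,v')$ there is a directed path from $v$ to $v'$. A morphism of digraphs is a pair of maps on vertices and edges commuting with incidence. A covering $Y\to X$ is a surjective morphism $f$ which for each $v\in V(Y)$ induces bijections from the incoming (resp. outgoing) edges at $v$ to those at $f(v)$. It is $m$-sheeted if each vertex of $X$ has $m$ preimages, and Galois if it is $m$-sheeted with $|\mathrm{Deck}(Y/X)|=m$ for some $m$, where $\mathrm{Deck}(Y/X)$ (the Galois group) is the group of automorphisms of $Y$ over $X$. A $\mathbb{Z}_p^d$-tower over $X$ is a sequence of coverings $X=X_0\leftarrow X_1\leftarrow X_2\leftarrow\cdots$ such that each $X_n/X$ is Galois with group isomorphic to $(\mathbb{Z}/p^n\mathbb{Z})^d$; it is a tower of strongly connected digraphs if all $X_n$ are strongly connected. **Defect.** For a digraph $X$ with vertices $v_1,\dots,v_r$, let $A_X$ be the matrix whose $(i,j)$-entry is the number of edges from $v_j$ to $v_i$. The zeta function is $Z_X(u)=\prod_{[C]}(1-u^{|[C]|})^{ -1}$, where $[C]$ runs over primes of $X$, i.e. equivalence classes (under cyclic permutation) of directed cycles (closed directed paths) that are not an $m$-fold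 multiple of another cycle for any $m\ge2$, and $|[C]|$ is the number of edges; it equals the rational function $\det(\mathrm{Id}-uA_X)^{ -1}$. The Bowen–Franks group is $\mathcal{BF}(X)=\mathbb{Z}^r/(\mathrm{Id}-A_X)\mathbb{Z}^r$. The algebraic Bowen–Franks rank is $b(X)=\mathrm{rank}_{\mathbb{Z}}\mathcal{BF}(X)$; the analytic Bowen–Franks rank is $a(X)=-\mathrm{ord}_{u=1}Z_X(u)$; the defect is $\delta(X)=a(X)-b(X)$. -}

module Defs where

open import Algebra.Bundles using (AbelianGroup; Group)
open import Algebra.Morphism.Structures using (IsGroupHomomorphism; IsGroupIsomorphism)
import Algebra.Construct.Pointwise as Pointwise
import Algebra.Properties.AbelianGroup as AbelianGroupProperties
import Algebra.Properties.CommutativeMonoid.Sum as CommutativeMonoidSum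
import Algebra.Properties.CommutativeSemigroup as CommutativeSemigroupProperties
import Algebra.Properties.Monoid.Mult as MonoidMult
import Algebra.Properties.Semiring.Sum as SemiringSum
open import Data.Empty using (⊥)
open import Data.Fin.Base using (Fin; toℕ; fromℕ<)
open import Data.Fin.Properties using (_≟_; any?; toℕ-fromℕ<)
open import Data.Integer.Base using (ℤ; +_; -[1+_]; -_; _-_; _+_; _*_)
import Data.Integer.Properties as ℤ
open import Data.List.Base as List using (List; []; _∷_; [_]; _++_)
import Data.List.Properties as List
open import Data.List.Relation.Unary.Linked using (Linked; linked?)
open import Data.Nat.Base as ℕ using (ℕ; zero; suc)
open import Data.Nat.Divisibility using (_∣?_)
import Data.Nat.Properties as ℕ
open import Data.Product.Base using (Σ-syntax; ∃; ∃-syntax; ∃₂; _×_; _,_; proj₁; proj₂)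
open import Data.Vec.Base as Vec using ()
open import Function.Base using (_∘_; id)
open import Function.Bundles using (Bijection)
open import Function.Definitions using (Bijective; StrictlySurjective)
open import Level using (0ℓ)
open import Relation.Binary.Bundles using (Setoid)
open import Relation.Binary.Construct.Closure.ReflexiveTransitive using (Star)
open import Relation.Binary.Definitions using (Decidable)
open import Relation.Binary.PropositionalEquality as ≡ using (_≡_; _≢_; _≗_; refl; cong; cong₂; sym; trans; subst)
open import Relation.Nullary using (¬_; Dec; yes; no; does)
open import Relation.Nullary.Decidable using (map′; _×-dec_; ¬?)
open import Relation.Unary as U using (Pred)
open import Data.Bool.Base using (if_then_else_)

open SemiringSum ℤ.+-*-semiring using (sum; ∑-distrib-+; sum-cong-≗; sum-syntax)

------------------------------------------------------------------------
-- Digraphs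

record Digraph : Set where
  field
    #V #E : ℕ
    o t   : Fin #E → Fin #V

  V E : Set
  V = Fin #V
  E = Fin #E

open Digraph public using (V; E)

Edge : (X : Digraph) → V X → V X → Set
Edge X v w = ∃[ e ] (o e ≡ v × t e ≡ w)
  where open Digraph X

-- The path of length zero from v to v is allowed.
StronglyConnected : Digraph → Set
StronglyConnected X = ∀ v w → Star (Edge X) v w

record Morphism (Y X : Digraph) : Set where
  private
    module Y = Digraph Y
    module X = Digraph X
  field
    onV : V Y → V X
    onE : E Y → E X
    o-commute : ∀ e → X.o (onE e) ≡ onV (Y.o e)
    t-commute : ∀ e → X.t (onE e) ≡ onV (Y.t e)

idᴹ : ∀ {X} → Morphism X X
idᴹ = record { onV = id ; onE = id ; o-commute = λ _ → refl ; t-commute = λ _ → refl }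

infixr 9 _∘ᴹ_

_∘ᴹ_ : ∀ {X Y Z} → Morphism Y X → Morphism Z Y → Morphism Z X
g ∘ᴹ f = record
  { onV = G.onV ∘ F.onV
  ; onE = G.onE ∘ F.onE
  ; o-commute = λ e → trans (G.o-commute (F.onE e)) (cong G.onV (F.o-commute e))
  ; t-commute = λ e → trans (G.t-commute (F.onE e)) (cong G.onV (F.t-commute e))
  }
  where
  module G = Morphism g
  module F = Morphism f

infix 4 _≈ᴹ_

_≈ᴹ_ : ∀ {X Y} (f g : Morphism Y X) → Set
f ≈ᴹ g = (F.onV ≗ G.onV) × (F.onE ≗ G.onE)
  where
  module F = Morphism f
  module G = Morphism g

------------------------------------------------------------------------
-- Coverings

Incoming Outgoing : (X : Digraph) → V X → Set
Incoming X v = Σ[ e ∈ E X ] Digraph.t X e ≡ v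
Outgoing X v = Σ[ e ∈ E X ] Digraph.o X e ≡ v

infix 4 _≡ᴱ_

_≡ᴱ_ : {A : Set} {P : A → Set} (x y : Σ[ a ∈ A ] P a) → Set
x ≡ᴱ y = proj₁ x ≡ proj₁ y

module _ {X Y : Digraph} (f : Morphism Y X) where
  open Morphism f

  mapIncoming : ∀ v → Incoming Y v → Incoming X (onV v)
  mapIncoming v (e , te≡v) = onE e , trans (t-commute e) (cong onV te≡v)

  mapOutgoing : ∀ v → Outgoing Y v → Outgoing X (onV v)
  mapOutgoing v (e , oe≡v) = onE e , trans (o-commute e) (cong onV oe≡v)

record IsCovering {X Y : Digraph} (f : Morphism Y X) : Set where
  open Morphism f
  field
    surjective-V : StrictlySurjective _≡_ onV
    surjective-E : StrictlySurjective _≡_ onE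
    incoming     : ∀ v → Bijective _≡ᴱ_ _≡ᴱ_ (mapIncoming f v)
    outgoing     : ∀ v → Bijective _≡ᴱ_ _≡ᴱ_ (mapOutgoing f v)

record Covering (Y X : Digraph) : Set where
  field
    morphism   : Morphism Y X
    isCovering : IsCovering morphism

idᶜ : ∀ {X} → Covering X X
idᶜ = record
  { morphism   = idᴹ
  ; isCovering = record
    { surjective-V = λ v → v , refl
    ; surjective-E = λ e → e , refl
    ; incoming     = λ v → id , λ e → e , id
    ; outgoing     = λ v → id , λ e → e , id
    }
  }

infixr 9 _∘ᶜ_

_∘ᶜ_ : ∀ {X Y Z} → Covering Y X → Covering Z Y → Covering Z X
_∘ᶜ_ {X} {Y} {Z} g f = record
  { morphism   = G.morphism ∘ᴹ F.morphism
  ; isCovering = record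
    { surjective-V = λ x →
        let y , gy≡x = surjective-V G.isCovering x
            z , fz≡y = surjective-V F.isCovering y
        in z , trans (cong (onV G.morphism) fz≡y) gy≡x
    ; surjective-E = λ x →
        let y , gy≡x = surjective-E G.isCovering x
            z , fz≡y = surjective-E F.isCovering y
        in z , trans (cong (onE G.morphism) fz≡y) gy≡x
    ; incoming     = λ v →
        let i₁ , s₁ = incoming F.isCovering v
            i₂ , s₂ = incoming G.isCovering (onV F.morphism v)
        in (λ {x} {y} eq → i₁ {x} {y} (i₂ {mapIncoming F.morphism v x} {mapIncoming F.morphism v y} eq)) ,
           λ y → proj₁ (s₁ (proj₁ (s₂ y))) ,
             λ {z} eq → proj₂ (s₂ y) {mapIncoming F.morphism v z} (proj₂ (s₁ (proj₁ (s₂ y))) {z} eq)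
    ; outgoing     = λ v →
        let i₁ , s₁ = outgoing F.isCovering v
            i₂ , s₂ = outgoing G.isCovering (onV F.morphism v)
        in (λ {x} {y} eq → i₁ {x} {y} (i₂ {mapOutgoing F.morphism v x} {mapOutgoing F.morphism v y} eq)) ,
           λ y → proj₁ (s₁ (proj₁ (s₂ y))) ,
             λ {z} eq → proj₂ (s₂ y) {mapOutgoing F.morphism v z} (proj₂ (s₁ (proj₁ (s₂ y))) {z} eq)
    }
  }
  where
  open Morphism
  open IsCovering
  module G = Covering g
  module F = Covering f

module _ {X Y : Digraph} (π : Morphism Y X) where
  open Morphism

  record DeckTransformation : Set where
    field
      to from  : Morphism Y Y
      inverseˡ : to ∘ᴹ from ≈ᴹ idᴹ
      inverseʳ : from ∘ᴹ to ≈ᴹ idᴹ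
      over     : π ∘ᴹ to ≈ᴹ π

  open DeckTransformation

  private
    infixl 7 _∙_

    _∙_ : DeckTransformation → DeckTransformation → DeckTransformation
    σ ∙ τ = record
      { to       = to σ ∘ᴹ to τ
      ; from     = from τ ∘ᴹ from σ
      ; inverseˡ = (λ v → trans (cong (onV (to σ)) (proj₁ (inverseˡ τ) _)) (proj₁ (inverseˡ σ) v))
                 , (λ e → trans (cong (onE (to σ)) (proj₂ (inverseˡ τ) _)) (proj₂ (inverseˡ σ) e))
      ; inverseʳ = (λ v → trans (cong (onV (from τ)) (proj₁ (inverseʳ σ) _)) (proj₁ (inverseʳ τ) v))
                 , (λ e → trans (cong (onE (from τ)) (proj₂ (inverseʳ σ) _)) (proj₂ (inverseʳ τ) e))
      ; over     = (λ v → trans (proj₁ (over σ) _) (proj₁ (over τ) v))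
                 , (λ e → trans (proj₂ (over σ) _) (proj₂ (over τ) e))
      }

    ε : DeckTransformation
    ε = record
      { to = idᴹ ; from = idᴹ
      ; inverseˡ = (λ _ → refl) , (λ _ → refl)
      ; inverseʳ = (λ _ → refl) , (λ _ → refl)
      ; over     = (λ _ → refl) , (λ _ → refl)
      }

    infix 8 _⁻¹

    _⁻¹ : DeckTransformation → DeckTransformation
    σ ⁻¹ = record
      { to = from σ ; from = to σ
      ; inverseˡ = inverseʳ σ
      ; inverseʳ = inverseˡ σ
      ; over     = (λ v → trans (sym (proj₁ (over σ) _)) (cong (onV π) (proj₁ (inverseˡ σ) v)))
                 , (λ e → trans (sym (proj₂ (over σ) _)) (cong (onE π) (proj₂ (inverseˡ σ) e)))
      }

  Deck : Group 0ℓ 0ℓ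
  Deck = record
    { Carrier = DeckTransformation
    ; _≈_ = λ σ τ → to σ ≈ᴹ to τ
    ; _∙_ = _∙_
    ; ε   = ε
    ; _⁻¹ = _⁻¹
    ; isGroup = record
      { isMonoid = record
        { isSemigroup = record
          { isMagma = record
            { isEquivalence = record
              { refl  = (λ _ → refl) , (λ _ → refl)
              ; sym   = λ (p , q) → (λ v → sym (p v)) , (λ e → sym (q e))
              ; trans = λ (p , q) (p′ , q′) → (λ v → trans (p v) (p′ v)) , (λ e → trans (q e) (q′ e))
              }
            ; ∙-cong = λ {σ} {σ′} (p , q) (p′ , q′) →
                (λ v → trans (p _) (cong (onV (to σ′)) (p′ v))) ,
                (λ e → trans (q _) (cong (onE (to σ′)) (q′ e)))
            }
          ; assoc = λ _ _ _ → (λ _ → refl) , (λ _ → refl)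
          }
        ; identity = (λ _ → (λ _ → refl) , (λ _ → refl)) , (λ _ → (λ _ → refl) , (λ _ → refl))
        }
      ; inverse = inverseʳ , inverseˡ
      ; ⁻¹-cong = λ {σ} {τ} (p , q) →
          (λ v → trans (cong (onV (from σ)) (trans (sym (proj₁ (inverseˡ τ) v)) (sym (p _)))) (proj₁ (inverseʳ σ) _)) ,
          (λ e → trans (cong (onE (from σ)) (trans (sym (proj₂ (inverseˡ τ) e)) (sym (q _)))) (proj₂ (inverseʳ σ) _))
      }
    }

HasCardinality : Setoid 0ℓ 0ℓ → ℕ → Set
HasCardinality S m = Bijection S (≡.setoid (Fin m))

module _ {X Y : Digraph} (π : Covering Y X) where
  open Covering π
  open Morphism morphism

  IsSheeted : ℕ → Set
  IsSheeted m = ∀ x → Vec.count (λ y → onV y ≟ x) (Vec.allFin _) ≡ m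

  IsGalois : Set
  IsGalois = ∃[ m ] (IsSheeted m × HasCardinality (Group.setoid (Deck morphism)) m)

------------------------------------------------------------------------
-- Cokernels and ranks of abelian groups

module _ (A B : AbelianGroup 0ℓ 0ℓ) where
  private
    module A = AbelianGroup A
    module B = AbelianGroup B

  module _ {φ : A.Carrier → B.Carrier}
           (isHom : IsGroupHomomorphism A.rawGroup B.rawGroup φ) where
    open IsGroupHomomorphism isHom
    open CommutativeSemigroupProperties B.commutativeSemigroup using (interchange)
    open AbelianGroupProperties B using (⁻¹-∙-comm)
    open import Relation.Binary.Reasoning.Setoid B.setoid

    infix 4 _~_

    private
      _~_ : B.Carrier → B.Carrier → Set
      x ~ y = ∃[ a ] (x B.≈ y B.∙ φ a)

      ≈⇒~ : ∀ {x y} → x B.≈ y → x ~ y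
      ≈⇒~ {x} {y} x≈y = A.ε , (begin
        x               ≈⟨ x≈y ⟩
        y               ≈⟨ B.identityʳ y ⟨
        y B.∙ B.ε       ≈⟨ B.∙-congˡ ε-homo ⟨
        y B.∙ φ A.ε     ∎)

      ~-sym : ∀ {x y} → x ~ y → y ~ x
      ~-sym {x} {y} (a , eq) = a A.⁻¹ , (begin
        y                               ≈⟨ B.identityʳ y ⟨
        y B.∙ B.ε                       ≈⟨ B.∙-congˡ (B.inverseʳ (φ a)) ⟨
        y B.∙ (φ a B.∙ φ a B.⁻¹)        ≈⟨ B.assoc y (φ a) (φ a B.⁻¹) ⟨
        (y B.∙ φ a) B.∙ φ a B.⁻¹        ≈⟨ B.∙-cong eq (⁻¹-homo a) ⟨
        x B.∙ φ (a A.⁻¹)                ∎)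

      ~-trans : ∀ {x y z} → x ~ y → y ~ z → x ~ z
      ~-trans {x} {y} {z} (a , eq) (b , eq′) = b A.∙ a , (begin
        x                       ≈⟨ eq ⟩
        y B.∙ φ a               ≈⟨ B.∙-congʳ eq′ ⟩
        (z B.∙ φ b) B.∙ φ a     ≈⟨ B.assoc z (φ b) (φ a) ⟩
        z B.∙ (φ b B.∙ φ a)     ≈⟨ B.∙-congˡ (homo b a) ⟨
        z B.∙ φ (b A.∙ a)       ∎)

      ~-∙-cong : ∀ {x x′ y y′} → x ~ x′ → y ~ y′ → x B.∙ y ~ x′ B.∙ y′
      ~-∙-cong {x} {x′} {y} {y′} (a , eq) (b , eq′) = a A.∙ b , (begin
        x B.∙ y                             ≈⟨ B.∙-cong eq eq′ ⟩
        (x′ B.∙ φ a) B.∙ (y′ B.∙ φ b)       ≈⟨ interchange x′ (φ a) y′ (φ b) ⟩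
        (x′ B.∙ y′) B.∙ (φ a B.∙ φ b)       ≈⟨ B.∙-congˡ (homo a b) ⟨
        (x′ B.∙ y′) B.∙ φ (a A.∙ b)         ∎)

      ~-⁻¹-cong : ∀ {x y} → x ~ y → x B.⁻¹ ~ y B.⁻¹
      ~-⁻¹-cong {x} {y} (a , eq) = a A.⁻¹ , (begin
        x B.⁻¹                      ≈⟨ B.⁻¹-cong eq ⟩
        (y B.∙ φ a) B.⁻¹            ≈⟨ ⁻¹-∙-comm y (φ a) ⟨
        y B.⁻¹ B.∙ φ a B.⁻¹         ≈⟨ B.∙-congˡ (⁻¹-homo a) ⟨
        y B.⁻¹ B.∙ φ (a A.⁻¹)       ∎)

    Cokernel : AbelianGroup 0ℓ 0ℓ
    Cokernel = record
      { Carrier = B.Carrier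
      ; _≈_ = _~_
      ; _∙_ = B._∙_
      ; ε   = B.ε
      ; _⁻¹ = B._⁻¹
      ; isAbelianGroup = record
        { isGroup = record
          { isMonoid = record
            { isSemigroup = record
              { isMagma = record
                { isEquivalence = record { refl = ≈⇒~ B.refl ; sym = ~-sym ; trans = ~-trans }
                ; ∙-cong = ~-∙-cong
                }
              ; assoc = λ x y z → ≈⇒~ (B.assoc x y z)
              }
            ; identity = (λ x → ≈⇒~ (B.identityˡ x)) , (λ x → ≈⇒~ (B.identityʳ x))
            }
          ; inverse = (λ x → ≈⇒~ (B.inverseˡ x)) , (λ x → ≈⇒~ (B.inverseʳ x))
          ; ⁻¹-cong = ~-⁻¹-cong
          }
        ; comm = λ x y → ≈⇒~ (B.comm x y)
        }
      }

module _ (G : AbelianGroup 0ℓ 0ℓ) where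
  open AbelianGroup G
  open MonoidMult monoid using () renaming (_×_ to _×ᴳ_)
  open CommutativeMonoidSum commutativeMonoid using () renaming (sum to sumᴳ)

  infixr 8 _·_

  _·_ : ℤ → Carrier → Carrier
  (+ n)    · x = n ×ᴳ x
  -[1+ n ] · x = (suc n ×ᴳ x) ⁻¹

  LinearlyIndependent : ∀ {k} → (Fin k → Carrier) → Set
  LinearlyIndependent {k} x = ∀ (c : Fin k → ℤ) → sumᴳ (λ i → c i · x i) ≈ ε → ∀ i → c i ≡ + 0

  HasRank : ℕ → Set
  HasRank k = (∃[ x ] LinearlyIndependent {k} x)
            × (∀ x → ¬ LinearlyIndependent {suc k} x)

Pow : AbelianGroup 0ℓ 0ℓ → ℕ → AbelianGroup 0ℓ 0ℓ
Pow G n = Pointwise.abelianGroup (Fin n) G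

ℤ/_ : ℕ → AbelianGroup 0ℓ 0ℓ
ℤ/ n = Cokernel ℤ.+-0-abelianGroup ℤ.+-0-abelianGroup {φ = λ x → + n * x} record
  { isMonoidHomomorphism = record
    { isMagmaHomomorphism = record
      { isRelHomomorphism = record { cong = cong (+ n *_) }
      ; homo = ℤ.*-distribˡ-+ (+ n)
      }
    ; ε-homo = ℤ.*-zeroʳ (+ n)
    }
  ; ⁻¹-homo = λ x → sym (ℤ.neg-distribʳ-* (+ n) x)
  }

------------------------------------------------------------------------
-- Towers

toBase : ∀ {X : ℕ → Digraph} → (∀ n → Covering (X (suc n)) (X n)) → ∀ n → Covering (X n) (X 0)
toBase π zero    = idᶜ
toBase π (suc n) = toBase π n ∘ᶜ π n

record Tower (p d : ℕ) : Set where
  field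
    X : ℕ → Digraph
    π : ∀ n → Covering (X (suc n)) (X n)

  Gal : ℕ → Group 0ℓ 0ℓ
  Gal n = Deck (Covering.morphism (toBase π n))

  field
    isGalois : ∀ n → IsGalois (toBase π n)
    gal≅     : ∀ n → ∃ (IsGroupIsomorphism (Group.rawGroup (Gal n))
                          (AbelianGroup.rawGroup (Pow (ℤ/ (p ℕ.^ n)) d)))

------------------------------------------------------------------------
-- Bowen–Franks group

Matrix : ℕ → Set
Matrix r = Fin r → Fin r → ℤ

Id : ∀ {r} → Matrix r
Id i j = if does (i ≟ j) then + 1 else + 0

adjacency : (X : Digraph) → Matrix (Digraph.#V X)
adjacency X i j = + Vec.count (λ e → (o e ≟ j) ×-dec (t e ≟ i)) (Vec.allFin #E)
  where open Digraph X

infixr 7 _*ᵥ_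

_*ᵥ_ : ∀ {r} → Matrix r → (Fin r → ℤ) → (Fin r → ℤ)
(M *ᵥ z) i = sum (λ j → M i j * z j)

ℤ^_ : ℕ → AbelianGroup 0ℓ 0ℓ
ℤ^_ = Pow ℤ.+-0-abelianGroup

*ᵥ-isGroupHomomorphism : ∀ {r} (M : Matrix r) →
  IsGroupHomomorphism (AbelianGroup.rawGroup (ℤ^ r)) (AbelianGroup.rawGroup (ℤ^ r)) (M *ᵥ_)
*ᵥ-isGroupHomomorphism {r} M = record
  { isMonoidHomomorphism = record
    { isMagmaHomomorphism = record
      { isRelHomomorphism = record { cong = *ᵥ-cong }
      ; homo = *ᵥ-homo
      }
    ; ε-homo = *ᵥ-zero
    }
  ; ⁻¹-homo = λ x → inverseʳ-unique (M *ᵥ x) (M *ᵥ (-_ ∘ x)) λ i →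
      trans (sym (*ᵥ-homo x (-_ ∘ x) i))
        (trans (*ᵥ-cong (λ j → ℤ.+-inverseʳ (x j)) i) (*ᵥ-zero i))
  }
  where
  open AbelianGroupProperties (ℤ^ r) using (inverseʳ-unique; identityʳ-unique)

  *ᵥ-cong : ∀ {x y} → x ≗ y → M *ᵥ x ≗ M *ᵥ y
  *ᵥ-cong x≗y i = sum-cong-≗ (λ j → cong (M i j *_) (x≗y j))

  *ᵥ-homo : ∀ x y → M *ᵥ (λ j → x j + y j) ≗ (λ i → (M *ᵥ x) i + (M *ᵥ y) i)
  *ᵥ-homo x y i = trans (sum-cong-≗ (λ j → ℤ.*-distribˡ-+ (M i j) (x j) (y j)))
                        (∑-distrib-+ (λ j → M i j * x j) (λ j → M i j * y j))

  *ᵥ-zero : M *ᵥ (λ _ → + 0) ≗ (λ _ → + 0)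
  *ᵥ-zero = identityʳ-unique (M *ᵥ (λ _ → + 0)) (M *ᵥ (λ _ → + 0))
              (λ i → sym (*ᵥ-homo (λ _ → + 0) (λ _ → + 0) i))

BowenFranks : Digraph → AbelianGroup 0ℓ 0ℓ
BowenFranks X = Cokernel (ℤ^ #V) (ℤ^ #V) (*ᵥ-isGroupHomomorphism (λ i j → Id i j - adjacency X i j))
  where open Digraph X

------------------------------------------------------------------------
-- Orders at u = 1 of rational functions given by power series

PowerSeries : Set
PowerSeries = ℕ → ℤ

infixl 7 _*ₛ_
infixr 8 _^ₛ_

1ₛ : PowerSeries
1ₛ zero    = + 1
1ₛ (suc _) = + 0

_*ₛ_ : PowerSeries → PowerSeries → PowerSeries
(f *ₛ g) n = ∑[ i < suc n ] (f (toℕ i) * g (n ℕ.∸ toℕ i))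

_^ₛ_ : PowerSeries → ℕ → PowerSeries
f ^ₛ zero  = 1ₛ
f ^ₛ suc k = f *ₛ f ^ₛ k

-- Coefficients, constant term first; trailing zeros are allowed, so polynomials
-- are compared through their power series.
Polynomial : Set
Polynomial = List ℤ

⟦_⟧ : Polynomial → PowerSeries
⟦ [] ⟧    _       = + 0
⟦ c ∷ _ ⟧ zero    = c
⟦ _ ∷ P ⟧ (suc n) = ⟦ P ⟧ n

eval : Polynomial → ℤ → ℤ
eval P x = List.foldr (λ c s → c + x * s) (+ 0) P

u-1 : Polynomial
u-1 = - + 1 ∷ + 1 ∷ []

-- The cofactor must be a polynomial: as a power series, u - 1 is a unit.
HasPolynomialOrderAt1 : Polynomial → ℕ → Set
HasPolynomialOrderAt1 P k =
  ∃[ Q ] (⟦ P ⟧ ≗ ⟦ u-1 ⟧ ^ₛ k *ₛ ⟦ Q ⟧ × eval Q (+ 1) ≢ + 0)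

-- f is the expansion at u = 0 of a nonzero rational function N / D whose order at
-- u = 1 is k (N and D are nonzero since their orders are finite).
HasOrderAt1 : PowerSeries → ℤ → Set
HasOrderAt1 f k =
  ∃₂ λ N D → f *ₛ ⟦ D ⟧ ≗ ⟦ N ⟧ ×
    ∃₂ λ m n → HasPolynomialOrderAt1 N m × HasPolynomialOrderAt1 D n × k ≡ + m - + n

------------------------------------------------------------------------
-- Zeta function

module _ (X : Digraph) where
  open Digraph X using (#E; o; t)

  Composable : E X → E X → Set
  Composable e e′ = t e ≡ o e′

  -- Cycles are based and have positive length; appending the first edge again
  -- makes the closing condition one of the composability conditions.
  IsCycle : Pred (List (E X)) 0ℓ
  IsCycle []       = ⊥
  IsCycle (e ∷ es) = Linked Composable (e ∷ es ++ [ e ])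

  IsProperMultiple : Pred (List (E X)) 0ℓ
  IsProperMultiple w =
    ∃₂ λ m c → 2 ℕ.≤ m × IsCycle c × w ≡ List.concat (List.replicate m c)

  IsPrimitiveCycle : Pred (List (E X)) 0ℓ
  IsPrimitiveCycle w = IsCycle w × ¬ IsProperMultiple w

  CyclicPermutation : List (E X) → List (E X) → Set
  CyclicPermutation w w′ = ∃₂ λ xs ys → w ≡ xs ++ ys × w′ ≡ ys ++ xs

  private
    _≟ʷ_ : Decidable {A = List (E X)} _≡_
    _≟ʷ_ = List.≡-dec _≟_

    take-++ : ∀ (xs ys : List (E X)) → List.take (List.length xs) (xs ++ ys) ≡ xs
    take-++ []       ys = refl
    take-++ (x ∷ xs) ys = cong (x ∷_) (take-++ xs ys)

    drop-++ : ∀ (xs ys : List (E X)) → List.drop (List.length xs) (xs ++ ys) ≡ ys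
    drop-++ []       ys = refl
    drop-++ (x ∷ xs) ys = drop-++ xs ys

    length-≤ : ∀ (xs ys : List (E X)) → List.length xs ℕ.≤ List.length (xs ++ ys)
    length-≤ xs ys = subst (List.length xs ℕ.≤_) (sym (List.length-++ xs)) (ℕ.m≤m+n _ _)

    -- Existence of a number satisfying P can be decided if a bound is known.
    bounded? : ∀ {P : Pred ℕ 0ℓ} → U.Decidable P → ∀ N → (∀ {k} → P k → k ℕ.≤ N) → Dec (∃ P)
    bounded? {P} P? N bound = map′
      (λ (i , Pi) → toℕ i , Pi)
      (λ (k , Pk) → fromℕ< (ℕ.s≤s (bound Pk)) , subst P (sym (toℕ-fromℕ< (ℕ.s≤s (bound Pk)))) Pk)
      (any? {n = suc N} (λ i → P? (toℕ i)))

    replicate-bound : ∀ m c → IsCycle c → m ℕ.≤ List.length (List.concat (List.replicate m c))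
    replicate-bound zero    c        _   = ℕ.z≤n
    replicate-bound (suc m) c@(_ ∷ es) cyc =
      ℕ.s≤s (ℕ.≤-trans (replicate-bound m c cyc)
        (subst (List.length r ℕ.≤_) (sym (List.length-++ es)) (ℕ.m≤n+m (List.length r) (List.length es))))
      where r = List.concat (List.replicate m c)

  isCycle? : U.Decidable IsCycle
  isCycle? []       = no λ ()
  isCycle? (e ∷ es) = linked? (λ e e′ → t e ≟ o e′) (e ∷ es ++ [ e ])

  isProperMultiple? : U.Decidable IsProperMultiple
  isProperMultiple? w = map′
    (λ (m , k , _ , 2≤m , cyc , eq) → m , List.take k w , 2≤m , cyc , eq)
    (λ { (suc m , c , 2≤m , cyc , refl) →
           let c≡ = take-++ c (List.concat (List.replicate m c)) in
           suc m , List.length c , length-≤ c _ , 2≤m , subst IsCycle (sym c≡) cyc ,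
           cong (List.concat ∘ List.replicate (suc m)) (sym c≡) })
    (bounded? {P = P}
      (λ m → bounded? {P = Q m}
        (λ k → (k ℕ.≤? ℓ) ×-dec (2 ℕ.≤? m) ×-dec isCycle? (List.take k w)
                 ×-dec (w ≟ʷ List.concat (List.replicate m (List.take k w))))
        ℓ proj₁)
      ℓ (λ {m} (k , _ , _ , cyc , eq) →
           subst (m ℕ.≤_) (cong List.length (sym eq)) (replicate-bound m (List.take k w) cyc)))
    where
    ℓ = List.length w
    Q : ℕ → Pred ℕ 0ℓ
    Q m k = k ℕ.≤ ℓ × 2 ℕ.≤ m × IsCycle (List.take k w)
              × w ≡ List.concat (List.replicate m (List.take k w))
    P : Pred ℕ 0ℓ
    P m = ∃ (Q m)

  isPrimitiveCycle? : U.Decidable IsPrimitiveCycle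
  isPrimitiveCycle? w = isCycle? w ×-dec ¬? (isProperMultiple? w)

  cyclicPermutation? : Decidable CyclicPermutation
  cyclicPermutation? w w′ = map′
    (λ (k , _ , eq) → List.take k w , List.drop k w , sym (List.take++drop≡id k w) , eq)
    (λ { (xs , ys , refl , refl) → List.length xs , length-≤ xs ys ,
           sym (cong₂ _++_ (drop-++ xs ys) (take-++ xs ys)) })
    (bounded? {P = λ k → k ℕ.≤ ℓ × w′ ≡ List.drop k w ++ List.take k w}
      (λ k → (k ℕ.≤? ℓ) ×-dec (w′ ≟ʷ (List.drop k w ++ List.take k w))) ℓ proj₁)
    where
    ℓ = List.length w

  edgeWords : ℕ → List (List (E X))
  edgeWords zero    = [ [] ]
  edgeWords (suc n) = List.cartesianProductWith _∷_ (List.allFin #E) (edgeWords n)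

  -- One representative of every prime [C] with |[C]| = n.
  primes : ℕ → List (List (E X))
  primes n = List.deduplicate cyclicPermutation? (List.filter isPrimitiveCycle? (edgeWords n))

  primesUpTo : ℕ → List (List (E X))
  primesUpTo N = List.concatMap primes (List.applyUpTo suc N)

-- (1 - uᵏ)⁻¹ = 1 + uᵏ + u²ᵏ + ⋯, for k ≥ 1
geometric : ℕ → PowerSeries
geometric k n = if does (k ∣? n) then + 1 else + 0

partialZeta : Digraph → ℕ → PowerSeries
partialZeta X N = List.foldr (λ C f → geometric (List.length C) *ₛ f) 1ₛ (primesUpTo X N)

-- Primes longer than n contribute factors 1 + O(uⁿ⁺¹) to the Euler product, so they
-- do not affect the coefficient of uⁿ.
zeta : Digraph → PowerSeries
zeta X n = partialZeta X n n

------------------------------------------------------------------------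
-- Defect

HasAlgebraicRank : Digraph → ℕ → Set
HasAlgebraicRank X b = HasRank (BowenFranks X) b

HasAnalyticRank : Digraph → ℤ → Set
HasAnalyticRank X a = HasOrderAt1 (zeta X) (- a)

-- The defect as a functional relation: the rational function represented by zeta X
-- is unique and exists, and BowenFranks X is finitely generated.
HasDefect : Digraph → ℤ → Set
HasDefect X δ = ∃₂ λ a b → HasAnalyticRank X a × HasAlgebraicRank X b × δ ≡ a - + b

{-# OPTIONS --safe #-}
-- The matrix of a covering Y → X is block triangular: pushing vertices forward intertwines
-- A_Y with A_X, and B = A_Y e, where e is a projector onto the kernel of this map, is the
-- remaining block. Hence tr A_Yⁿ = tr A_Xⁿ + tr Bⁿ, and right exactness of cokernels gives
-- b(Y) ≤ b(X) + b, where b is the number of generators of the rational cokernel of 1 - B.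
-- The Euler product turns u Z′/Z into the generating function of tr Aⁿ, so that a(X) is the
-- residue-like coefficient of (1 - u)⁻¹ in it, which is additive: a(Y) = a(X) + a. Finally
-- a ≥ b, as the algebraic multiplicity of the eigenvalue 1 of B is at least the geometric one.
module Submission where

open import Defs
open import Data.Integer.Base using (ℤ) renaming (_≥_ to _≥ᶻ_)
open import Data.Nat.Base using (ℕ; _∸_; _≥_)
open import Data.Nat.Primality using (Prime)

open import Algebra.Bundles using (AbelianGroup; CommutativeRing)
import Algebra.Properties.CommutativeMonoid.Sum as CommutativeMonoidSum
import Algebra.Properties.Ring as RingProperties
import Algebra.Properties.Semiring.Sum as SemiringSum
import Algebra.Solver.Ring as RingSolver
open import Algebra.Solver.Ring.AlmostCommutativeRing using (fromCommutativeRing; _-Raw-AlmostCommutative⟶_)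
open import Algebra.Structures using (IsCommutativeRing)
open import Data.Bool.Base using (Bool; true; false; if_then_else_; _∧_)
open import Data.Fin.Base as Fin using (Fin; zero; suc; toℕ; _↑ˡ_; _↑ʳ_; punchIn)
open import Data.Fin.Properties as Fin using (any?)
import Data.Integer.Base as ℤ
import Data.Integer.Properties as ℤ
import Data.Integer.Tactic.RingSolver as ℤ
open import Data.List.Base as List using
  (List; []; _∷_; [_]; _++_; length; take; drop; concat; concatMap; replicate; map; filter; applyUpTo; deduplicate)
import Data.List.Properties as List
open import Data.List.Membership.Propositional using (_∈_; find; lose)
open import Data.List.Membership.Propositional.Properties using
  ( ∈-allFin; ∈-applyUpTo⁺; ∈-applyUpTo⁻; ∈-cartesianProductWith⁺; ∈-cartesianProductWith⁻
  ; ∈-concatMap⁺; ∈-concatMap⁻; ∈-filter⁺; ∈-filter⁻)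
open import Data.List.Membership.Propositional.Properties.WithK using (unique∧set⇒bag)
open import Data.List.Relation.Binary.BagAndSetEquality using (∼bag⇒↭)
open import Data.List.Relation.Binary.Disjoint.Propositional using (Disjoint)
open import Data.List.Relation.Binary.Permutation.Propositional.Properties using (↭-length)
open import Data.List.Relation.Unary.All as All using (All; []; _∷_)
import Data.List.Relation.Unary.All.Properties as All
open import Data.List.Relation.Unary.AllPairs as AllPairs using (AllPairs; []; _∷_)
import Data.List.Relation.Unary.AllPairs.Properties as AllPairs
open import Data.List.Relation.Unary.Any as Any using (here)
import Data.List.Relation.Unary.Any.Properties as Any
open import Data.List.Relation.Unary.Linked using (Linked; []; [-]; _∷_; linked?)
open import Data.List.Relation.Unary.Unique.Propositional using (Unique)
import Data.List.Relation.Unary.Unique.Propositional.Properties as Unique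
open import Data.Nat.Base as ℕ using (zero; suc; _≤_; _<_; z≤n; s≤s)
import Data.Nat.Coprimality as Coprimality
open import Data.Nat.Divisibility using (_∣_; _∣?_; divides; m%n≡0⇒n∣m; _∣0; ∣⇒≤; ∣m+n∣m⇒∣n; ∣m∣n⇒∣m+n; ∣-refl)
open import Data.Nat.DivMod using (_/_; _%_; m≡m%n+[m/n]*n; m%n<n)
import Data.Nat.ListAction as ℕ
import Data.Nat.Properties as ℕ
open import Data.Product.Base using (∃; ∃-syntax; ∃₂; _×_; _,_; proj₁; proj₂)
open import Data.Rational.Base as ℚ using (ℚ; mkℚ)
import Data.Rational.Properties as ℚ
open import Data.Rational.Unnormalised.Base using (*≡*)
import Data.Rational.Unnormalised.Properties as ℚᵘ
open import Data.Sum.Base using (_⊎_; inj₁; inj₂)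
open import Data.Vec.Base as Vec using ()
open import Data.Vec.Functional as Vector using () renaming (_++_ to _⧺_)
open import Data.Vec.Functional.Properties using (lookup-++ˡ; lookup-++ʳ; insertAt-lookup; insertAt-punchIn)
open import Function.Base using (_∘_; id)
open import Function.Bundles using (mk⇔)
open import Level using (0ℓ)
open import Relation.Binary.Core using (Rel)
open import Relation.Binary.Definitions as Binary using (DecidableEquality)
open import Relation.Binary.PropositionalEquality using
  (_≡_; _≢_; _≗_; refl; sym; trans; cong; cong₂; subst; module ≡-Reasoning)
open import Relation.Nullary using (¬_; Dec; yes; no; does; contradiction)
open import Relation.Nullary.Decidable using (dec⇒maybe; map′; dec-true; dec-false; ¬?; _×-dec_)
open import Relation.Unary using (Decidable; Pred)

-- No determinant, characteristic polynomial or eigenvalue is ever formed. In characteristic 0 the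
-- numbers tr Aⁿ already carry the multiplicities: their generating function is the sum of 1/(1 -
-- λu) over the eigenvalues, so its pole at u = 1 is simple whatever the Jordan structure, with the
-- algebraic multiplicity of λ = 1 as coefficient. The other poles are cleared by a multiplier that
-- does not vanish at 1, and `HasMultiplicity` merely asks for one. The block on the kernel is kept
-- as a matrix of the size of A_Y, so that no basis of the kernel has to be chosen. The price is
-- additional eigenvalues 0, which change neither tr Bⁿ for n ≥ 1 nor the cokernel of 1 - B. Ranks
-- are translated into numbers of generators over ℚ because generators of a subspace and of a
-- quotient combine directly. For B one number q is both the multiplicity and the size of a
-- generating set, hence a(Y) = a(X) + q and b(Y) ≤ b(X) + q, and q cancels in the defect.

private
  variable
    S T : Set

-- Words

least : {P : ℕ → Set} → Decidable P → ∀ {n} → P n → ∃ λ k → P k × (∀ {j} → P j → k ≤ j)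
least P? {zero}  p = 0 , p , λ _ → z≤n
least {P} P? {suc n} p with P? 0
... | yes p₀ = 0 , p₀ , λ _ → z≤n
... | no ¬p₀ =
  let k , pk , min = least {P ∘ suc} (P? ∘ suc) p
  in suc k , pk , λ { {zero} q → contradiction q ¬p₀ ; {suc j} q → s≤s (min q) }

++-injective : ∀ (xs ys : List S) {us vs} → length xs ≡ length ys →
               xs ++ us ≡ ys ++ vs → xs ≡ ys × us ≡ vs
++-injective []       []       _  eq = refl , eq
++-injective (x ∷ xs) (y ∷ ys) ℓ≡ eq =
  let x≡y , eq′ = List.∷-injective eq
      xs≡ys , us≡vs = ++-injective xs ys (ℕ.suc-injective ℓ≡) eq′
  in cong₂ _∷_ x≡y xs≡ys , us≡vs

rotate : List S → List S
rotate []       = []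
rotate (x ∷ xs) = xs ++ [ x ]

rotateBy : ℕ → List S → List S
rotateBy zero    w = w
rotateBy (suc k) w = rotateBy k (rotate w)

rotateBy-[] : ∀ k → rotateBy {S} k [] ≡ []
rotateBy-[] zero    = refl
rotateBy-[] (suc k) = rotateBy-[] k

rotateBy-++ : ∀ (xs ys : List S) → rotateBy (length xs) (xs ++ ys) ≡ ys ++ xs
rotateBy-++ []       ys = sym (List.++-identityʳ ys)
rotateBy-++ (x ∷ xs) ys = begin
  rotateBy (length xs) ((xs ++ ys) ++ [ x ])  ≡⟨ cong (rotateBy (length xs)) (List.++-assoc xs ys [ x ]) ⟩
  rotateBy (length xs) (xs ++ (ys ++ [ x ]))  ≡⟨ rotateBy-++ xs (ys ++ [ x ]) ⟩
  (ys ++ [ x ]) ++ xs                         ≡⟨ List.++-assoc ys [ x ] xs ⟩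
  ys ++ (x ∷ xs)                              ∎
  where open ≡-Reasoning

rotateBy-length : ∀ (w : List S) → rotateBy (length w) w ≡ w
rotateBy-length w = trans (cong (rotateBy (length w)) (sym (List.++-identityʳ w))) (rotateBy-++ w [])

rotateBy-+ : ∀ m n (w : List S) → rotateBy (m ℕ.+ n) w ≡ rotateBy n (rotateBy m w)
rotateBy-+ zero    n w = refl
rotateBy-+ (suc m) n w = rotateBy-+ m n (rotate w)

rotateBy-* : ∀ q k {w : List S} → rotateBy k w ≡ w → rotateBy (q ℕ.* k) w ≡ w
rotateBy-* zero    k     eq = refl
rotateBy-* (suc q) k {w} eq =
  trans (rotateBy-+ k (q ℕ.* k) w) (trans (cong (rotateBy (q ℕ.* k)) eq) (rotateBy-* q k eq))

length-rotate : ∀ (w : List S) → length (rotate w) ≡ length w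
length-rotate []       = refl
length-rotate (x ∷ xs) = trans (List.length-++ xs) (ℕ.+-comm (length xs) 1)

length-rotateBy : ∀ k (w : List S) → length (rotateBy k w) ≡ length w
length-rotateBy zero    w = refl
length-rotateBy (suc k) w = trans (length-rotateBy k (rotate w)) (length-rotate w)

rotate-injective : ∀ {v w : List S} → rotate v ≡ rotate w → v ≡ w
rotate-injective {v = []}     {[]}     eq = refl
rotate-injective {v = []}     {y ∷ ys} eq = contradiction (cong length eq)
  (subst (λ n → 0 ≢ n) (sym (length-rotate (y ∷ ys))) λ ())
rotate-injective {v = x ∷ xs} {[]}     eq = contradiction (cong length eq)
  (subst (λ n → n ≢ 0) (sym (length-rotate (x ∷ xs))) λ ())
rotate-injective {v = x ∷ xs} {y ∷ ys} eq =
  let p , q = List.∷ʳ-injective xs ys eq in cong₂ _∷_ q p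

rotateBy-injective : ∀ k {v w : List S} → rotateBy k v ≡ rotateBy k w → v ≡ w
rotateBy-injective zero    eq = eq
rotateBy-injective (suc k) eq = rotate-injective (rotateBy-injective k eq)

power : List S → ℕ → List S
power w m = concat (replicate m w)

length-power : ∀ (w : List S) m → length (power w m) ≡ m ℕ.* length w
length-power w zero    = refl
length-power w (suc m) = trans (List.length-++ w) (cong (length w ℕ.+_) (length-power w m))

power-comm : ∀ (w : List S) m → w ++ power w m ≡ power w m ++ w
power-comm w zero    = List.++-identityʳ w
power-comm w (suc m) = trans (cong (w ++_) (power-comm w m)) (sym (List.++-assoc w (power w m) w))

rotateBy-power-length : ∀ (w : List S) m → rotateBy (length w) (power w m) ≡ power w m
rotateBy-power-length w zero    = rotateBy-[] (length w)
rotateBy-power-length w (suc m) = trans (rotateBy-++ w (power w m)) (sym (power-comm w m))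

-- The first |c| letters of v ++ c = c ++ v are c; cancelling them leaves a shorter word that still
-- commutes with c.
commuting⇒power : ∀ m (c v : List S) → length v ≡ m ℕ.* length c → v ++ c ≡ c ++ v → v ≡ power c m
commuting⇒power zero    c []      _  _  = refl
commuting⇒power (suc m) c v ℓ≡ eq = begin
  v                         ≡⟨ v≡ ⟩
  a ++ b                    ≡⟨ cong₂ _++_ a≡c (commuting⇒power m c b ℓb eq′) ⟩
  c ++ power c m            ∎
  where
  open ≡-Reasoning
  a = take (length c) v
  b = drop (length c) v
  v≡ = sym (List.take++drop≡id (length c) v)
  ℓa : length a ≡ length c
  ℓa = trans (List.length-take (length c) v)
         (ℕ.m≤n⇒m⊓n≡m (subst (length c ≤_) (sym ℓ≡) (ℕ.m≤m+n _ _)))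
  ℓb : length b ≡ m ℕ.* length c
  ℓb = trans (List.length-drop (length c) v)
         (trans (cong (ℕ._∸ length c) ℓ≡) (ℕ.m+n∸m≡n (length c) _))
  split = ++-injective a c {b ++ c} {v} ℓa
    (trans (sym (List.++-assoc a b c)) (trans (cong (_++ c) (sym v≡)) eq))
  a≡c = proj₁ split
  eq′ : b ++ c ≡ c ++ b
  eq′ = trans (proj₂ split) (trans v≡ (cong (_++ b) a≡c))

-- Rotation by k swaps the prefix a of length k with the rest b. Invariance therefore means that a
-- and b commute, and the length of b makes it a power of a.
period⇒power : ∀ m k (w : List S) → length w ≡ suc m ℕ.* k → rotateBy k w ≡ w →
               length (take k w) ≡ k × w ≡ power (take k w) (suc m)
period⇒power m k w ℓ≡ eq = ℓa , trans v≡ (cong (a ++_) (commuting⇒power m a b ℓb comm))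
  where
  a = take k w
  b = drop k w
  v≡ = sym (List.take++drop≡id k w)
  ℓa : length a ≡ k
  ℓa = trans (List.length-take k w) (ℕ.m≤n⇒m⊓n≡m (subst (k ≤_) (sym ℓ≡) (ℕ.m≤m+n _ _)))
  ℓb : length b ≡ m ℕ.* length a
  ℓb = trans (trans (List.length-drop k w) (trans (cong (ℕ._∸ k) ℓ≡) (ℕ.m+n∸m≡n k _)))
             (cong (m ℕ.*_) (sym ℓa))
  comm : b ++ a ≡ a ++ b
  comm = trans (sym (rotateBy-++ a b))
    (trans (cong₂ rotateBy ℓa (sym v≡)) (trans eq v≡))

rotate-power : ∀ (w : List S) m → rotate (power w m) ≡ power (rotate w) m
rotate-power w        zero    = refl
rotate-power []       (suc m) = rotate-power [] m
rotate-power {S} (x ∷ xs) (suc m) = begin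
  (xs ++ power (x ∷ xs) m) ++ [ x ]  ≡⟨ List.++-assoc xs _ [ x ] ⟩
  xs ++ (power (x ∷ xs) m ++ [ x ])  ≡⟨ cong (xs ++_) (conj m) ⟩
  xs ++ x ∷ power (xs ++ [ x ]) m    ≡⟨ List.++-assoc xs [ x ] _ ⟨
  (xs ++ [ x ]) ++ power (xs ++ [ x ]) m ∎
  where
  open ≡-Reasoning
  conj : ∀ m → power (x ∷ xs) m ++ [ x ] ≡ x ∷ power (xs ++ [ x ]) m
  conj zero    = refl
  conj (suc m) = cong (x ∷_) (begin
    (xs ++ power (x ∷ xs) m) ++ [ x ]  ≡⟨ List.++-assoc xs _ [ x ] ⟩
    xs ++ (power (x ∷ xs) m ++ [ x ])  ≡⟨ cong (xs ++_) (conj m) ⟩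
    xs ++ x ∷ power (xs ++ [ x ]) m    ≡⟨ List.++-assoc xs [ x ] _ ⟨
    (xs ++ [ x ]) ++ power (xs ++ [ x ]) m ∎)

rotateBy-power : ∀ k (w : List S) m → rotateBy k (power w m) ≡ power (rotateBy k w) m
rotateBy-power zero    w m = refl
rotateBy-power (suc k) w m = trans (cong (rotateBy k) (rotate-power w m)) (rotateBy-power k (rotate w) m)

power-injective : ∀ m (v w : List S) → length v ≡ length w → power v (suc m) ≡ power w (suc m) → v ≡ w
power-injective m v w ℓ≡ eq = proj₁ (++-injective v w ℓ≡ eq)

-- Periods of words under rotation

IsPeriod : List S → ℕ → Set
IsPeriod w k = rotateBy k w ≡ w

IsMinimalPeriod : List S → ℕ → Set
IsMinimalPeriod w k = 1 ≤ k × IsPeriod w k × (∀ {j} → 1 ≤ j → IsPeriod w j → k ≤ j)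

minimalPeriod : DecidableEquality S → ∀ {w : List S} {n} → 1 ≤ n → IsPeriod w n → ∃ (IsMinimalPeriod w)
minimalPeriod _≟_ {w} {suc n} _ p =
  let k , pk , min = least {λ k → IsPeriod w (suc k)} (λ k → List.≡-dec _≟_ (rotateBy (suc k) w) w) {n} p
  in suc k , s≤s z≤n , pk , λ { {suc j} _ q → s≤s (min q) }

-- Removing multiples of k from n leaves the period n % k, which lies below the minimal positive
-- period and so is 0.
minimalPeriod-∣ : ∀ {w : List S} {k n} → IsMinimalPeriod w k → IsPeriod w n → k ∣ n
minimalPeriod-∣ {w = w} {k@(suc _)} {n} (_ , pk , min) pn = m%n≡0⇒n∣m n k (zero? (n % k) refl)
  where
  r-period : IsPeriod w (n % k)
  r-period = begin
    rotateBy (n % k) w                               ≡⟨ cong (rotateBy (n % k)) (rotateBy-* (n / k) k pk) ⟨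
    rotateBy (n % k) (rotateBy (n / k ℕ.* k) w)      ≡⟨ rotateBy-+ (n / k ℕ.* k) (n % k) w ⟨
    rotateBy (n / k ℕ.* k ℕ.+ n % k) w               ≡⟨ cong (λ i → rotateBy i w)
      (trans (ℕ.+-comm (n / k ℕ.* k) (n % k)) (sym (m≡m%n+[m/n]*n n k))) ⟩
    rotateBy n w                                     ≡⟨ pn ⟩
    w                                                ∎
    where open ≡-Reasoning
  zero? : ∀ r → n % k ≡ r → n % k ≡ 0
  zero? zero    eq = eq
  zero? (suc r) eq = contradiction (min (subst (1 ≤_) (sym eq) (s≤s z≤n)) r-period) (ℕ.<⇒≱ (m%n<n n k))

minimalPeriod-unique : ∀ {w : List S} {j k} → IsMinimalPeriod w j → IsMinimalPeriod w k → j ≡ k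
minimalPeriod-unique (1≤j , pj , minj) (1≤k , pk , mink) = ℕ.≤-antisym (minj 1≤k pk) (mink 1≤j pj)

minimalPeriod-power : ∀ {w : List S} {k} m → IsMinimalPeriod w k → IsMinimalPeriod (power w (suc m)) k
minimalPeriod-power {w = w} {k} m (1≤k , pk , min) =
  1≤k , trans (rotateBy-power k w (suc m)) (cong (λ v → power v (suc m)) pk) ,
  λ {j} 1≤j pj → min 1≤j (power-injective m (rotateBy j w) w (length-rotateBy j w)
    (trans (sym (rotateBy-power j w (suc m))) pj))

minimalPeriod-root : ∀ {w : List S} {k} m → IsMinimalPeriod (power w (suc m)) k → IsMinimalPeriod w k
minimalPeriod-root {w = w} {k} m (1≤k , pk , min) =
  1≤k , power-injective m (rotateBy k w) w (length-rotateBy k w) (trans (sym (rotateBy-power k w (suc m))) pk) ,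
  λ {j} 1≤j pj → min 1≤j (trans (rotateBy-power j w (suc m)) (cong (λ v → power v (suc m)) pj))

rotateBy-comm : ∀ j k (w : List S) → rotateBy j (rotateBy k w) ≡ rotateBy k (rotateBy j w)
rotateBy-comm j k w = trans (sym (rotateBy-+ k j w))
  (trans (cong (λ i → rotateBy i w) (ℕ.+-comm k j)) (rotateBy-+ j k w))

minimalPeriod-rotateBy : ∀ {w : List S} {k} i → IsMinimalPeriod w k → IsMinimalPeriod (rotateBy i w) k
minimalPeriod-rotateBy {w = w} {k} i (1≤k , pk , min) =
  1≤k , trans (rotateBy-comm k i w) (cong (rotateBy i) pk) ,
  λ {j} 1≤j pj → min 1≤j (rotateBy-injective i (trans (sym (rotateBy-comm j i w)) pj))

-- Rotations are injective, so a coincidence at i < j makes j - i a period shorter than k. This is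
-- why a prime C has exactly |C| different rotations.
rotateBy-distinct : ∀ {w : List S} {k i j} → IsMinimalPeriod w k → i < j → j < k → rotateBy i w ≢ rotateBy j w
rotateBy-distinct {w = w} {k} {i} {j} (_ , _ , min) i<j j<k eq =
  ℕ.<⇒≱ (ℕ.≤-<-trans (ℕ.m∸n≤m j i) j<k) (min (ℕ.m<n⇒0<n∸m i<j) (rotateBy-injective i (begin
    rotateBy i (rotateBy (j ℕ.∸ i) w)  ≡⟨ rotateBy-comm i (j ℕ.∸ i) w ⟩
    rotateBy (j ℕ.∸ i) (rotateBy i w)  ≡⟨ rotateBy-+ i (j ℕ.∸ i) w ⟨
    rotateBy (i ℕ.+ (j ℕ.∸ i)) w       ≡⟨ cong (λ k → rotateBy k w) (ℕ.m+[n∸m]≡n (ℕ.<⇒≤ i<j)) ⟩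
    rotateBy j w                       ≡⟨ eq ⟨
    rotateBy i w                       ∎)))
  where open ≡-Reasoning

module _ {R : Rel S 0ℓ} where

  -- The junction x belongs to both parts. This fits `IsCycle`, where the first edge repeated at the
  -- end of one lap is also the start of the next lap.
  Linked-++⁻ : ∀ xs {x ys} → Linked R (xs ++ x ∷ ys) → Linked R (xs ++ [ x ]) × Linked R (x ∷ ys)
  Linked-++⁻ []           l       = [-] , l
  Linked-++⁻ (y ∷ [])     (r ∷ l) = r ∷ [-] , l
  Linked-++⁻ (y ∷ z ∷ xs) (r ∷ l) = let l₁ , l₂ = Linked-++⁻ (z ∷ xs) l in r ∷ l₁ , l₂

  Linked-++⁺ : ∀ xs {x ys} → Linked R (xs ++ [ x ]) → Linked R (x ∷ ys) → Linked R (xs ++ x ∷ ys)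
  Linked-++⁺ []           _        l₂ = l₂
  Linked-++⁺ (y ∷ [])     (r ∷ _)  l₂ = r ∷ l₂
  Linked-++⁺ (y ∷ z ∷ xs) (r ∷ l₁) l₂ = r ∷ Linked-++⁺ (z ∷ xs) l₁ l₂

-- Cycles and primes

Unique-length : {xs ys : List S} → Unique xs → Unique ys →
                (∀ {z} → z ∈ xs → z ∈ ys) → (∀ {z} → z ∈ ys → z ∈ xs) → length xs ≡ length ys
Unique-length u v to from = ↭-length (∼bag⇒↭ (unique∧set⇒bag u v (mk⇔ to from)))

length-concatMap : ∀ (f : S → List T) xs → length (concatMap f xs) ≡ ℕ.sum (map (length ∘ f) xs)
length-concatMap f []       = refl
length-concatMap f (x ∷ xs) =
  trans (List.length-++ (f x)) (cong (length (f x) ℕ.+_) (length-concatMap f xs))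

deduplicate-AllPairs : {R : Rel S 0ℓ} (R? : Binary.Decidable R) → ∀ xs → AllPairs (λ x y → ¬ R x y) (deduplicate R? xs)
deduplicate-AllPairs R? []       = []
deduplicate-AllPairs R? (x ∷ xs) =
  All.all-filter _ (deduplicate R? xs) ∷ AllPairs.filter⁺ _ (deduplicate-AllPairs R? xs)

AllPairs-zipAll : {P : Pred S 0ℓ} {R : Rel S 0ℓ} → ∀ {xs} → All P xs → AllPairs R xs →
                  AllPairs (λ x y → P x × P y × R x y) xs
AllPairs-zipAll []         []         = []
AllPairs-zipAll (px ∷ pxs) (rx ∷ rxs) = All.zipWith (λ (py , r) → px , py , r) (pxs , rx) ∷ AllPairs-zipAll pxs rxs

module _ (X : Digraph) where

  private
    variable
      v w C : List (E X)

  isCycle-nonempty : ∀ w → IsCycle X w → 1 ≤ length w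
  isCycle-nonempty (_ ∷ _) _ = s≤s z≤n

  isCycle-rotate : ∀ w → IsCycle X w → IsCycle X (rotate w)
  isCycle-rotate (x ∷ [])     c       = c
  isCycle-rotate (x ∷ y ∷ ys) (r ∷ l) =
    subst (Linked (Composable X)) (sym (List.++-assoc (y ∷ ys) [ x ] [ y ]))
      (Linked-++⁺ (y ∷ ys) l (r ∷ [-]))

  isCycle-rotateBy : ∀ i w → IsCycle X w → IsCycle X (rotateBy i w)
  isCycle-rotateBy zero    w c = c
  isCycle-rotateBy (suc i) w c = isCycle-rotateBy i (rotate w) (isCycle-rotate w c)

  private
    power-head : ∀ (x : E X) xs m → ∃[ ys ] power (x ∷ xs) m ++ [ x ] ≡ x ∷ ys
    power-head x xs zero    = [] , refl
    power-head x xs (suc m) = _ , refl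

  isCycle-power : ∀ w m → IsCycle X w → IsCycle X (power w (suc m))
  isCycle-power (x ∷ xs) m c = linked (suc m)
    where
    linked : ∀ m → Linked (Composable X) (power (x ∷ xs) m ++ [ x ])
    linked zero    = [-]
    linked (suc m) with power-head x xs m
    ... | ys , eq = subst (Linked (Composable X))
      (trans (cong ((x ∷ xs) ++_) (sym eq)) (sym (List.++-assoc (x ∷ xs) (power (x ∷ xs) m) [ x ])))
      (Linked-++⁺ (x ∷ xs) c (subst (Linked (Composable X)) eq (linked m)))

  isCycle-root : ∀ w m → IsCycle X (power w (suc m)) → IsCycle X w
  isCycle-root []       (suc m) c = isCycle-root [] m c
  isCycle-root (x ∷ xs) m c with power-head x xs m
  ... | ys , eq = proj₁ (Linked-++⁻ (x ∷ xs) (subst (Linked (Composable X))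
    (trans (List.++-assoc (x ∷ xs) (power (x ∷ xs) m) [ x ]) (cong ((x ∷ xs) ++_) eq)) c))

  -- The minimal period divides the length, and a quotient of at least 2 would exhibit w as a proper
  -- multiple of its first k letters. Primitivity thus becomes a statement on rotations, which is
  -- easily carried along powers and rotated words.
  isPrimitive⇒minimalPeriod : ∀ w → IsPrimitiveCycle X w → IsMinimalPeriod w (length w)
  isPrimitive⇒minimalPeriod w (c , ¬p)
    with minimalPeriod Fin._≟_ {w} (isCycle-nonempty w c) (rotateBy-length w)
  ... | k , mp@(1≤k , pk , min) with minimalPeriod-∣ {w = w} mp (rotateBy-length w)
  ... | divides zero          eq = contradiction (isCycle-nonempty w c) (ℕ.<⇒≱ (subst (ℕ._< 1) (sym eq) (s≤s z≤n)))
  ... | divides (suc zero)    eq = subst (IsMinimalPeriod w) (sym (trans eq (ℕ.*-identityˡ k))) mp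
  ... | divides (suc (suc m)) eq =
    let _ , w≡ = period⇒power (suc m) k w eq pk in
    contradiction (suc (suc m) , take k w , s≤s (s≤s z≤n) ,
      isCycle-root (take k w) (suc m) (subst (IsCycle X) w≡ c) , w≡) ¬p

  minimalPeriod⇒isPrimitive : ∀ w → IsCycle X w → IsMinimalPeriod w (length w) → IsPrimitiveCycle X w
  minimalPeriod⇒isPrimitive w cw (_ , _ , min) = cw , λ { (suc (suc m) , c , s≤s (s≤s _) , cc , refl) →
    ℕ.<⇒≱ (subst (length c <_) (sym (length-power c (suc (suc m))))
             (ℕ.m<m+n (length c) (ℕ.<-≤-trans (isCycle-nonempty c cc) (ℕ.m≤m+n (length c) _))))
      (min (isCycle-nonempty c cc) (rotateBy-power-length c (suc (suc m)))) }

  -- The root is the prefix of length k, the minimal period of w: a word and its powers share their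
  -- minimal period, so that of the prefix is its own length.
  isCycle-decompose : ∀ w → IsCycle X w →
    ∃₂ λ c m → IsPrimitiveCycle X c × w ≡ power c (suc m)
  isCycle-decompose w cw
    with minimalPeriod Fin._≟_ {w} (isCycle-nonempty w cw) (rotateBy-length w)
  ... | k , mp@(1≤k , pk , min) with minimalPeriod-∣ {w = w} mp (rotateBy-length w)
  ... | divides zero    eq = contradiction (isCycle-nonempty w cw) (ℕ.<⇒≱ (subst (ℕ._< 1) (sym eq) (s≤s z≤n)))
  ... | divides (suc m) eq =
    let ℓ≡ , w≡ = period⇒power m k w eq pk in
    take k w , m ,
    minimalPeriod⇒isPrimitive (take k w) (isCycle-root (take k w) m (subst (IsCycle X) w≡ cw))
      (subst (IsMinimalPeriod (take k w)) (sym ℓ≡)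
        (minimalPeriod-root m (subst (λ v → IsMinimalPeriod v k) w≡ mp))) ,
    w≡

  private
    _~_ = CyclicPermutation X

  ~-rotate : v ~ w → v ~ rotate w
  ~-rotate (x ∷ xs , []     , refl , refl) = [ x ] , xs , cong (x ∷_) (List.++-identityʳ xs) , refl
  ~-rotate ([]     , []     , refl , refl) = [] , [] , refl , refl
  ~-rotate (xs     , y ∷ ys , refl , refl) =
    xs ++ [ y ] , ys , sym (List.++-assoc xs [ y ] ys) , List.++-assoc ys xs [ y ]

  ~-rotateBy : ∀ i → v ~ w → v ~ rotateBy i w
  ~-rotateBy zero    r = r
  ~-rotateBy (suc i) r = ~-rotateBy i (~-rotate r)

  ~-refl : ∀ w → w ~ w
  ~-refl w = [] , w , refl , sym (List.++-identityʳ w)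

  ~-sym : v ~ w → w ~ v
  ~-sym (xs , ys , p , q) = ys , xs , q , p

  ~⇒rotateBy : v ~ w → ∃[ i ] i ≤ length v × w ≡ rotateBy i v
  ~⇒rotateBy (xs , ys , refl , refl) = length xs ,
    subst (length xs ≤_) (sym (List.length-++ xs)) (ℕ.m≤m+n _ _) , sym (rotateBy-++ xs ys)

  ~-trans : ∀ {u} → u ~ v → v ~ w → u ~ w
  ~-trans p q with ~⇒rotateBy q
  ... | i , _ , refl = ~-rotateBy i p

  -- Rotation by the full length is traded for rotation by 0, so that the amount falls into the
  -- range enumerated by `powersOfLength`.
  ~⇒rotateBy< : 1 ≤ length v → v ~ w → ∃[ i ] i < length v × w ≡ rotateBy i v
  ~⇒rotateBy< {v} 1≤ r with ~⇒rotateBy r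
  ... | i , i≤ , refl with ℕ.m≤n⇒m<n∨m≡n i≤
  ...   | inj₁ i<   = i , i< , refl
  ...   | inj₂ refl = 0 , 1≤ , rotateBy-length v

  ∈-edgeWords⁺ : ∀ w → w ∈ edgeWords X (length w)
  ∈-edgeWords⁺ []       = here refl
  ∈-edgeWords⁺ (e ∷ es) = ∈-cartesianProductWith⁺ _∷_ (∈-allFin e) (∈-edgeWords⁺ es)

  ∈-edgeWords⁻ : ∀ n → w ∈ edgeWords X n → length w ≡ n
  ∈-edgeWords⁻ zero    (here refl) = refl
  ∈-edgeWords⁻ (suc n) w∈
    with _ , _ , _ , es∈ , refl ← ∈-cartesianProductWith⁻ _∷_ (List.allFin _) (edgeWords X n) w∈
    = cong suc (∈-edgeWords⁻ n es∈)

  edgeWords-unique : ∀ n → Unique (edgeWords X n)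
  edgeWords-unique zero    = [] ∷ []
  edgeWords-unique (suc n) =
    Unique.cartesianProductWith⁺ _∷_ List.∷-injective (Unique.allFin⁺ _) (edgeWords-unique n)

  cycles : ℕ → List (List (E X))
  cycles n = filter (isCycle? X) (edgeWords X n)

  ∈-cycles⁺ : ∀ {n} → IsCycle X w → length w ≡ n → w ∈ cycles n
  ∈-cycles⁺ {w} c refl = ∈-filter⁺ (isCycle? X) (∈-edgeWords⁺ w) c

  ∈-primes⁻ : ∀ n → C ∈ primes X n → IsPrimitiveCycle X C × length C ≡ n
  ∈-primes⁻ {C} n C∈ =
    let C∈′ , p = ∈-filter⁻ (isPrimitiveCycle? X) {xs = edgeWords X n}
                    (Any.deduplicate⁻ (cyclicPermutation? X) C∈)
    in p , ∈-edgeWords⁻ n C∈′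

  ∈-primes⁺ : ∀ w → IsPrimitiveCycle X w → ∃[ C ] C ∈ primes X (length w) × C ~ w
  ∈-primes⁺ w p = find (Any.deduplicate⁺ (cyclicPermutation? X) {P = _~ w}
    ~-trans
    (Any.map (λ { {C} refl → ~-refl C })
      (∈-filter⁺ (isPrimitiveCycle? X) (∈-edgeWords⁺ w) p)))

  ∈-primesUpTo⁻ : ∀ N → C ∈ primesUpTo X N → IsPrimitiveCycle X C
  ∈-primesUpTo⁻ N C∈ with Any.satisfied (∈-concatMap⁻ (primes X) {xs = applyUpTo suc N} C∈)
  ... | n , C∈′ = proj₁ (∈-primes⁻ n C∈′)

  ∈-primesUpTo⁺ : ∀ {N} n → 1 ≤ n → n ≤ N → C ∈ primes X n → C ∈ primesUpTo X N
  ∈-primesUpTo⁺ (suc n) _ n≤N C∈ = ∈-concatMap⁺ (primes X) (lose (∈-applyUpTo⁺ suc n≤N) C∈)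

  -- Within one length this is the effect of `deduplicate`; between different lengths it holds
  -- because cyclic permutations preserve the length.
  primesUpTo-AllPairs : ∀ N → AllPairs (λ C C′ → ¬ C ~ C′) (primesUpTo X N)
  primesUpTo-AllPairs N = AllPairs.concat⁺
    (All.map⁺ (All.applyUpTo⁺₂ suc N λ i →
      deduplicate-AllPairs (cyclicPermutation? X) (filter (isPrimitiveCycle? X) (edgeWords X (suc i)))))
    (AllPairs.map⁺ (AllPairs.applyUpTo⁺₁ suc N λ {i} {j} i<j _ →
      All.tabulate λ {C} C∈ → All.tabulate λ {C′} C′∈ C~C′ →
        ℕ.<⇒≢ (s≤s i<j) (trans (sym (proj₂ (∈-primes⁻ (suc i) C∈)))
          (trans (~-length C~C′) (proj₂ (∈-primes⁻ (suc j) C′∈))))))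
    where
    ~-length : v ~ w → length v ≡ length w
    ~-length r with ~⇒rotateBy r
    ... | i , _ , refl = sym (length-rotateBy i _)

  -- Every cycle of length n is, in a unique way, a power of a rotation of a chosen prime.
  private
    powers′ : ∀ n (C : List (E X)) → Dec (length C ∣ n) → List (List (E X))
    powers′ n C (yes (divides m _)) = applyUpTo (λ i → power (rotateBy i C) m) (length C)
    powers′ n C (no _)              = []

  powersOfLength : ℕ → List (E X) → List (List (E X))
  powersOfLength n C = powers′ n C (length C ∣? n)

  length-powersOfLength : ∀ n C → length (powersOfLength n C) ≡ (if does (length C ∣? n) then length C else 0)
  length-powersOfLength n C with length C ∣? n
  ... | yes (divides m _) = List.length-applyUpTo (λ i → power (rotateBy i C) m) (length C)
  ... | no _              = refl

  ∈-powersOfLength⁻ : ∀ {n C w} → 1 ≤ n → w ∈ powersOfLength n C →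
    ∃₂ λ i m → n ≡ suc m ℕ.* length C × w ≡ power (rotateBy i C) (suc m)
  ∈-powersOfLength⁻ {n} {C} 1≤n w∈ with length C ∣? n
  ... | yes (divides zero    refl) = contradiction 1≤n λ ()
  ... | yes (divides (suc m) n≡) =
    let i , _ , w≡ = ∈-applyUpTo⁻ (λ i → power (rotateBy i C) (suc m)) w∈ in i , m , n≡ , w≡
  ... | no _ = contradiction w∈ λ ()

  ∈-powersOfLength⁺ : ∀ C i m → i < length C → power (rotateBy i C) m ∈ powersOfLength (m ℕ.* length C) C
  ∈-powersOfLength⁺ C i m i< with length C ∣? (m ℕ.* length C)
  ... | yes (divides q eq) = subst (λ k → power (rotateBy i C) m ∈ applyUpTo (λ i → power (rotateBy i C) k) (length C))
    (ℕ.*-cancelʳ-≡ m q (length C) {{ℕ.>-nonZero (ℕ.≤-<-trans z≤n i<)}} eq)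
    (∈-applyUpTo⁺ (λ i → power (rotateBy i C) m) i<)
  ... | no ¬d = contradiction (divides m refl) ¬d

  powersOfLength-unique : ∀ {n C} → 1 ≤ n → IsPrimitiveCycle X C → Unique (powersOfLength n C)
  powersOfLength-unique {n} {C} 1≤n p with length C ∣? n
  ... | yes (divides zero    refl) = contradiction 1≤n λ ()
  ... | yes (divides (suc m) n≡) = Unique.applyUpTo⁺₁ _ (length C) λ {i} {j} i<j j< eq →
    rotateBy-distinct (isPrimitive⇒minimalPeriod C p) i<j j<
      (power-injective m (rotateBy i C) (rotateBy j C)
        (trans (length-rotateBy i C) (sym (length-rotateBy j C))) eq)
  ... | no _ = []

  -- A common word would have both |C| and |C′| as its minimal period. So the lengths agree, then
  -- the exponents, and extracting roots identifies a rotation of C with a rotation of C′.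
  powersOfLength-disjoint : ∀ {n C C′} → 1 ≤ n → IsPrimitiveCycle X C → IsPrimitiveCycle X C′ → ¬ C ~ C′ →
    Disjoint (powersOfLength n C) (powersOfLength n C′)
  powersOfLength-disjoint {n} {C} {C′} 1≤n p p′ ¬C~C′ {w} (w∈ , w∈′)
    with i , m , n≡ , w≡ ← ∈-powersOfLength⁻ {n} {C} 1≤n w∈
       | j , m′ , n≡′ , w≡′ ← ∈-powersOfLength⁻ {n} {C′} 1≤n w∈′ =
    ¬C~C′ (~-trans (~-rotateBy i (~-refl C)) (~-sym (subst (C′ ~_) (sym rot≡) (~-rotateBy j (~-refl C′)))))
    where
    period : IsMinimalPeriod w (length C)
    period = subst (λ v → IsMinimalPeriod v _) (sym w≡)
      (minimalPeriod-power m (minimalPeriod-rotateBy i (isPrimitive⇒minimalPeriod C p)))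
    period′ : IsMinimalPeriod w (length C′)
    period′ = subst (λ v → IsMinimalPeriod v _) (sym w≡′)
      (minimalPeriod-power m′ (minimalPeriod-rotateBy j (isPrimitive⇒minimalPeriod C′ p′)))
    ℓ≡ : length C ≡ length C′
    ℓ≡ = minimalPeriod-unique {w = w} period period′
    m≡ : m ≡ m′
    m≡ = ℕ.suc-injective (ℕ.*-cancelʳ-≡ (suc m) (suc m′) (length C)
      {{ℕ.>-nonZero (isCycle-nonempty C (proj₁ p))}}
      (trans (sym n≡) (trans n≡′ (cong (suc m′ ℕ.*_) (sym ℓ≡)))))
    rot≡ : rotateBy i C ≡ rotateBy j C′
    rot≡ = power-injective m _ _ (trans (length-rotateBy i C) (trans ℓ≡ (sym (length-rotateBy j C′))))
      (trans (sym w≡) (trans w≡′ (cong (λ k → power (rotateBy j C′) (suc k)) (sym m≡))))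

  -- Two duplicate-free lists with the same members have the same length, and C contributes its |C|
  -- rotations whenever |C| divides n. Primes longer than n contribute 0, so every truncation N ≥ n
  -- gives the same sum.
  cycles-count : ∀ N n → 1 ≤ n → n ≤ N →
    length (cycles n) ≡ ℕ.sum (map (λ C → if does (length C ∣? n) then length C else 0) (primesUpTo X N))
  cycles-count N n 1≤n n≤N = begin
    length (cycles n)                                            ≡⟨ Unique-length
      (Unique.filter⁺ (isCycle? X) (edgeWords-unique n)) powers-unique to from ⟩
    length (concatMap (powersOfLength n) (primesUpTo X N))       ≡⟨ length-concatMap (powersOfLength n) (primesUpTo X N) ⟩
    ℕ.sum (map (length ∘ powersOfLength n) (primesUpTo X N))
      ≡⟨ cong ℕ.sum (List.map-cong (length-powersOfLength n) (primesUpTo X N)) ⟩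
    ℕ.sum (map (λ C → if does (length C ∣? n) then length C else 0) (primesUpTo X N)) ∎
    where
    open ≡-Reasoning
    allPrimitive : All (IsPrimitiveCycle X) (primesUpTo X N)
    allPrimitive = All.tabulate (∈-primesUpTo⁻ N)
    powers-unique : Unique (concatMap (powersOfLength n) (primesUpTo X N))
    powers-unique = Unique.concat⁺
      (All.map⁺ (All.map (powersOfLength-unique 1≤n) allPrimitive))
      (AllPairs.map⁺ (AllPairs.map (λ {C} {C′} (p , p′ , r) {w} → powersOfLength-disjoint {n} {C} {C′} 1≤n p p′ r {w})
        (AllPairs-zipAll allPrimitive (primesUpTo-AllPairs N))))
    to : ∀ {w} → w ∈ cycles n → w ∈ concatMap (powersOfLength n) (primesUpTo X N)
    to {w} w∈ with w∈′ , cw ← ∈-filter⁻ (isCycle? X) {xs = edgeWords X n} w∈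
      with c , m , p , refl ← isCycle-decompose w cw
      with C , C∈ , C~c ← ∈-primes⁺ c p
      with p′ , ℓ≡ ← ∈-primes⁻ (length c) C∈
      with i , i< , refl ← ~⇒rotateBy< (isCycle-nonempty C (proj₁ p′)) C~c
      = ∈-concatMap⁺ (powersOfLength n) (Any.map (λ { refl →
          subst (λ k → power (rotateBy i C) (suc m) ∈ powersOfLength k C) ℓn (∈-powersOfLength⁺ C i (suc m) i<) })
          (∈-primesUpTo⁺ (length (rotateBy i C)) (isCycle-nonempty (rotateBy i C) (proj₁ p))
            (ℕ.≤-trans (subst (length (rotateBy i C) ≤_) ℓ≡n (ℕ.m≤m+n _ _)) n≤N) C∈))
      where
      ℓ≡n : suc m ℕ.* length (rotateBy i C) ≡ n
      ℓ≡n = trans (sym (length-power (rotateBy i C) (suc m))) (∈-edgeWords⁻ n w∈′)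
      ℓn : suc m ℕ.* length C ≡ n
      ℓn = trans (cong (suc m ℕ.*_) ℓ≡) ℓ≡n
    from : ∀ {w} → w ∈ concatMap (powersOfLength n) (primesUpTo X N) → w ∈ cycles n
    from w∈ with C , C∈ , w∈′ ← find (∈-concatMap⁻ (powersOfLength n) {xs = primesUpTo X N} w∈)
      with i , m , n≡ , refl ← ∈-powersOfLength⁻ {n} {C} 1≤n w∈′ =
      ∈-cycles⁺ (isCycle-power (rotateBy i C) m (isCycle-rotateBy i C (proj₁ (∈-primesUpTo⁻ N C∈))))
        (trans (length-power (rotateBy i C) (suc m)) (trans (cong (suc m ℕ.*_) (length-rotateBy i C)) (sym n≡)))

-- The field of fractions of ℤ

-- Keeping ℚ behind this interface prevents its arithmetic from being unfolded.
record FractionField : Set₁ where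
  infixl 6 _+_
  infixl 7 _*_
  infix  8 -_
  field
    K        : Set
    _+_ _*_  : K → K → K
    -_       : K → K
    0# 1#    : K
    isCommutativeRing : IsCommutativeRing _≡_ _+_ _*_ -_ 0# 1#
    _≟_      : DecidableEquality K
    inverse  : ∀ x → x ≢ 0# → ∃ λ y → x * y ≡ 1#
    ι        : ℤ → K
    ι-+      : ∀ m n → ι (m ℤ.+ n) ≡ ι m + ι n
    ι-*      : ∀ m n → ι (m ℤ.* n) ≡ ι m * ι n
    ι-neg    : ∀ n → ι (ℤ.- n) ≡ - ι n
    ι-0      : ι ℤ.0ℤ ≡ 0#
    ι-1      : ι ℤ.1ℤ ≡ 1#
    ι-injective : ∀ {m n} → ι m ≡ ι n → m ≡ n
    fraction : ∀ x → ∃₂ λ d n → d ≢ ℤ.0ℤ × ι d * x ≡ ι n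

  commutativeRing : CommutativeRing 0ℓ 0ℓ
  commutativeRing = record { isCommutativeRing = isCommutativeRing }

  private
    morphism : CommutativeRing.rawRing ℤ.+-*-commutativeRing -Raw-AlmostCommutative⟶ fromCommutativeRing commutativeRing
    morphism = record
      { ⟦_⟧    = ι
      ; +-homo = ι-+
      ; *-homo = ι-*
      ; -‿homo = ι-neg
      ; 0-homo = ι-0
      ; 1-homo = ι-1
      }

  open RingSolver (CommutativeRing.rawRing ℤ.+-*-commutativeRing) (fromCommutativeRing commutativeRing) morphism
    (λ m n → dec⇒maybe (map′ (cong ι) ι-injective (m ℤ.≟ n))) public
    using (solve; _:=_; _:+_; _:*_; _:-_; :-_; con)

  infixl 6 _-_
  _-_ : K → K → K
  x - y = x + - y

ℚ-fractionField : FractionField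
ℚ-fractionField = record
  { K = ℚ
  ; _+_ = ℚ._+_
  ; _*_ = ℚ._*_
  ; -_ = ℚ.-_
  ; 0# = ℚ.0ℚ
  ; 1# = ℚ.1ℚ
  ; isCommutativeRing = ℚ.+-*-isCommutativeRing
  ; _≟_ = ℚ._≟_
  ; inverse = λ x x≢0 → (ℚ.1/ x) {{ℚ.≢-nonZero x≢0}} , ℚ.*-inverseʳ x {{ℚ.≢-nonZero x≢0}}
  ; ι = ι
  ; ι-+ = λ m n → ℚ.toℚᵘ-injective (ℚᵘ.≃-trans (*≡* (cong (ℤ._* ℤ.1ℤ) (sym (cong₂ ℤ._+_ (ℤ.*-identityʳ m) (ℤ.*-identityʳ n)))))
      (ℚᵘ.≃-sym (ℚ.toℚᵘ-homo-+ (ι m) (ι n))))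
  ; ι-* = λ m n → ℚ.toℚᵘ-injective (ℚᵘ.≃-sym (ℚ.toℚᵘ-homo-* (ι m) (ι n)))
  ; ι-neg = λ n → ℚ.toℚᵘ-injective (ℚᵘ.≃-sym (ℚ.toℚᵘ-homo‿- (ι n)))
  ; ι-0 = refl
  ; ι-1 = refl
  ; ι-injective = cong ℚ.numerator
  ; fraction = λ { x@(mkℚ n d-1 _) → ℤ.+[1+ d-1 ] , n , (λ ()) ,
      ℚ.toℚᵘ-injective (ℚᵘ.≃-trans (ℚ.toℚᵘ-homo-* (ι ℤ.+[1+ d-1 ]) x)
        (*≡* (lemma (ℤ.+[1+ d-1 ]) n))) }
  }
  where
  ι : ℤ → ℚ
  ι n = mkℚ n 0 (Coprimality.sym (Coprimality.1-coprimeTo _))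
  lemma : ∀ d n → d ℤ.* n ℤ.* ℤ.1ℤ ≡ n ℤ.* (ℤ.1ℤ ℤ.* d)
  lemma = ℤ.solve-∀

module OverFractionField (F : FractionField) where

  open FractionField F
  open CommutativeRing commutativeRing using
    ( +-identityˡ; +-identityʳ; +-assoc; +-comm; +-congˡ; +-congʳ; -‿inverseˡ; -‿inverseʳ
    ; *-identityˡ; *-identityʳ; *-assoc; *-comm; *-congˡ; *-congʳ; zeroˡ; zeroʳ; distribˡ; distribʳ
    ; ring; semiring)
  open RingProperties ring using (-0#≈0#; -‿distribʳ-*)
  open SemiringSum semiring using
    (sum; sum-cong-≗; ∑-distrib-+; ∑-comm; *-distribˡ-sum; *-distribʳ-sum; sum-remove; sum-replicate-zero)
  open SemiringSum ℤ.+-*-semiring using () renaming (sum to sumᶻ)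

  private
    variable
      k l m n : ℕ

  -- Formal power series

  1≢0 : 1# ≢ 0#
  1≢0 eq with ι-injective (trans ι-1 (trans eq (sym ι-0)))
  ... | ()

  ι-nat-suc : ∀ n → ι (ℤ.+ suc n) ≡ 1# + ι (ℤ.+ n)
  ι-nat-suc n = trans (ι-+ (ℤ.+ 1) (ℤ.+ n)) (cong (_+ ι (ℤ.+ n)) ι-1)

  *-cancelˡ : ∀ {x y z} → x ≢ 0# → x * y ≡ x * z → y ≡ z
  *-cancelˡ {x} {y} {z} x≢0 eq with w , xw≡1 ← inverse x x≢0 = begin
    y             ≡⟨ unit y ⟨
    w * (x * y)   ≡⟨ cong (w *_) eq ⟩
    w * (x * z)   ≡⟨ unit z ⟩
    z             ∎
    where
    open ≡-Reasoning
    unit : ∀ t → w * (x * t) ≡ t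
    unit t = trans (solve 3 (λ w x t → w :* (x :* t) := (x :* w) :* t) refl w x t)
                   (trans (cong (_* t) xw≡1) (*-identityˡ t))

  *-≢0 : ∀ {x y} → x ≢ 0# → y ≢ 0# → x * y ≢ 0#
  *-≢0 {x} x≢0 y≢0 eq = y≢0 (*-cancelˡ x≢0 (trans eq (sym (zeroʳ x))))

  Series : Set
  Series = ℕ → K

  infixl 6 _⊕_
  infixl 7 _⊛_

  -- The Cauchy product by recursion on the degree, splitting f as f 0 + u (f ∘ suc). The finite sum
  -- in `_*ₛ_` unfolds in the same way, which makes `ιₛ-*ₛ` a plain induction.
  _⊕_ _⊛_ : Series → Series → Series
  (f ⊕ g) n = f n + g n
  (f ⊛ g) zero    = f 0 * g 0
  (f ⊛ g) (suc n) = f 0 * g (suc n) + ((f ∘ suc) ⊛ g) n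

  ⊖_ : Series → Series
  (⊖ f) n = - f n

  const : K → Series
  const c zero    = c
  const c (suc _) = 0#

  𝟘 𝟙 : Series
  𝟘 _ = 0#
  𝟙 = const 1#

  ⊛-cong≤ : ∀ n {f f′ g g′ : Series} → (∀ {i} → i ≤ n → f i ≡ f′ i) → (∀ {i} → i ≤ n → g i ≡ g′ i) →
            (f ⊛ g) n ≡ (f′ ⊛ g′) n
  ⊛-cong≤ zero    p q = cong₂ _*_ (p z≤n) (q z≤n)
  ⊛-cong≤ (suc n) p q = cong₂ _+_ (cong₂ _*_ (p z≤n) (q ℕ.≤-refl))
    (⊛-cong≤ n (λ i≤n → p (s≤s i≤n)) (λ i≤n → q (ℕ.m≤n⇒m≤1+n i≤n)))

  ⊛-cong : ∀ {f f′ g g′ : Series} → f ≗ f′ → g ≗ g′ → f ⊛ g ≗ f′ ⊛ g′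
  ⊛-cong p q n = ⊛-cong≤ n (λ _ → p _) (λ _ → q _)

  ⊛-zeroˡ : ∀ f → 𝟘 ⊛ f ≗ 𝟘
  ⊛-zeroˡ f zero    = zeroˡ _
  ⊛-zeroˡ f (suc n) = trans (cong₂ _+_ (zeroˡ _) (⊛-zeroˡ f n)) (+-identityˡ 0#)

  const-⊛ : ∀ c f → const c ⊛ f ≗ λ n → c * f n
  const-⊛ c f zero    = refl
  const-⊛ c f (suc n) = trans (cong (c * f (suc n) +_) (⊛-zeroˡ f n)) (+-identityʳ _)

  scale-⊛ : ∀ c f g → (λ n → c * f n) ⊛ g ≗ λ n → c * (f ⊛ g) n
  scale-⊛ c f g zero    = *-assoc _ _ _
  scale-⊛ c f g (suc n) = trans (cong₂ _+_ (*-assoc _ _ _) (scale-⊛ c (f ∘ suc) g n)) (sym (distribˡ _ _ _))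

  ⊛-distribʳ : ∀ h f g → (f ⊕ g) ⊛ h ≗ f ⊛ h ⊕ g ⊛ h
  ⊛-distribʳ h f g zero    = distribʳ _ _ _
  ⊛-distribʳ h f g (suc n) = trans (+-congˡ (⊛-distribʳ h (f ∘ suc) (g ∘ suc) n))
    (solve 5 (λ a b c d e → (a :+ b) :* c :+ (d :+ e) := (a :* c :+ d) :+ (b :* c :+ e)) refl _ _ _ _ _)

  -- The mirror image of the defining recursion, splitting off the constant term of the second
  -- factor; commutativity comes from comparing the two.
  ⊛-suc : ∀ f g n → (f ⊛ g) (suc n) ≡ (f ⊛ (g ∘ suc)) n + f (suc n) * g 0
  ⊛-suc f g zero    = refl
  ⊛-suc f g (suc n) = trans (+-congˡ (⊛-suc (f ∘ suc) g n)) (sym (+-assoc _ _ _))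

  ⊛-comm : ∀ f g → f ⊛ g ≗ g ⊛ f
  ⊛-comm f g zero    = *-comm _ _
  ⊛-comm f g (suc n) = begin
    f 0 * g (suc n) + ((f ∘ suc) ⊛ g) n  ≡⟨ cong₂ _+_ (*-comm _ _) (⊛-comm (f ∘ suc) g n) ⟩
    g (suc n) * f 0 + (g ⊛ (f ∘ suc)) n  ≡⟨ +-comm _ _ ⟩
    (g ⊛ (f ∘ suc)) n + g (suc n) * f 0  ≡⟨ ⊛-suc g f n ⟨
    (g ⊛ f) (suc n)                      ∎
    where open ≡-Reasoning

  ⊛-assoc : ∀ f g h → (f ⊛ g) ⊛ h ≗ f ⊛ (g ⊛ h)
  ⊛-assoc f g h zero    = *-assoc _ _ _
  ⊛-assoc f g h (suc n) = begin
    f 0 * g 0 * h (suc n) + (((λ n → f 0 * g (suc n)) ⊕ (f ∘ suc) ⊛ g) ⊛ h) n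
      ≡⟨ +-congˡ (⊛-distribʳ h _ _ n) ⟩
    f 0 * g 0 * h (suc n) + (((λ n → f 0 * g (suc n)) ⊛ h) n + (((f ∘ suc) ⊛ g) ⊛ h) n)
      ≡⟨ +-congˡ (cong₂ _+_ (scale-⊛ _ _ _ n) (⊛-assoc (f ∘ suc) g h n)) ⟩
    f 0 * g 0 * h (suc n) + (f 0 * ((g ∘ suc) ⊛ h) n + ((f ∘ suc) ⊛ (g ⊛ h)) n)
      ≡⟨ solve 5 (λ a b c d e → a :* b :* c :+ (a :* d :+ e) := a :* (b :* c :+ d) :+ e) refl _ _ _ _ _ ⟩
    f 0 * (g 0 * h (suc n) + ((g ∘ suc) ⊛ h) n) + ((f ∘ suc) ⊛ (g ⊛ h)) n ∎
    where open ≡-Reasoning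

  ⊛-identityˡ : ∀ f → 𝟙 ⊛ f ≗ f
  ⊛-identityˡ f n = trans (const-⊛ 1# f n) (*-identityˡ _)

  seriesRing : CommutativeRing 0ℓ 0ℓ
  seriesRing = record
    { Carrier = Series ; _≈_ = _≗_ ; _+_ = _⊕_ ; _*_ = _⊛_ ; -_ = ⊖_ ; 0# = 𝟘 ; 1# = 𝟙
    ; isCommutativeRing = record
      { isRing = record
        { +-isAbelianGroup = record
          { isGroup = record
            { isMonoid = record
              { isSemigroup = record
                { isMagma = record
                  { isEquivalence = record
                    { refl = λ _ → refl ; sym = λ p n → sym (p n) ; trans = λ p q n → trans (p n) (q n) }
                  ; ∙-cong = λ p q n → cong₂ _+_ (p n) (q n)
                  }
                ; assoc = λ f g h n → +-assoc (f n) (g n) (h n)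
                }
              ; identity = (λ f n → +-identityˡ (f n)) , (λ f n → +-identityʳ (f n))
              }
            ; inverse = (λ f n → -‿inverseˡ (f n)) , (λ f n → -‿inverseʳ (f n))
            ; ⁻¹-cong = λ p n → cong -_ (p n)
            }
          ; comm = λ f g n → +-comm (f n) (g n)
          }
        ; *-cong = ⊛-cong
        ; *-assoc = ⊛-assoc
        ; *-identity = ⊛-identityˡ , λ f n → trans (⊛-comm f 𝟙 n) (⊛-identityˡ f n)
        ; distrib = (λ h f g n → trans (⊛-comm h (f ⊕ g) n) (trans (⊛-distribʳ h f g n)
                      (cong₂ _+_ (⊛-comm f h n) (⊛-comm g h n)))) , ⊛-distribʳ
        }
      ; *-comm = ⊛-comm
      }
    }

  module S = CommutativeRing seriesRing

  const-+ : ∀ a b → const (a + b) ≗ const a ⊕ const b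
  const-+ a b zero    = refl
  const-+ a b (suc _) = sym (+-identityˡ 0#)

  module SeriesSolver where
    private
      morphism : CommutativeRing.rawRing ℤ.+-*-commutativeRing -Raw-AlmostCommutative⟶ fromCommutativeRing seriesRing
      morphism = record
        { ⟦_⟧    = const ∘ ι
        ; +-homo = λ m n i → trans (cong (λ c → const c i) (ι-+ m n)) (const-+ (ι m) (ι n) i)
        ; *-homo = λ { m n zero    → ι-* m n
                     ; m n (suc i) → sym (trans (const-⊛ (ι m) (const (ι n)) (suc i)) (zeroʳ _)) }
        ; -‿homo = λ { n zero → ι-neg n ; n (suc i) → sym (-0#≈0#) }
        ; 0-homo = λ { zero → ι-0 ; (suc i) → refl }
        ; 1-homo = λ { zero → ι-1 ; (suc i) → refl }
        }

      const-ι-cong : ∀ {m n} → m ≡ n → const (ι m) ≗ const (ι n)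
      const-ι-cong refl _ = refl

    open RingSolver (CommutativeRing.rawRing ℤ.+-*-commutativeRing) (fromCommutativeRing seriesRing) morphism
      (λ m n → dec⇒maybe (map′ const-ι-cong (λ p → ι-injective (p 0)) (m ℤ.≟ n))) public
      using () renaming (solve to solveₛ; _:=_ to _⊜_; _:+_ to _⊹_; _:*_ to _⊠_; :-_ to ⊟_)

  open SeriesSolver public
  open import Relation.Binary.Reasoning.Setoid S.setoid as ≗-Reasoning using ()

  -- Logarithmic derivatives for the Euler operator u d/du

  θ : Series → Series
  θ f n = ι (ℤ.+ n) * f n

  θ-cong : ∀ {f g} → f ≗ g → θ f ≗ θ g
  θ-cong p n = *-congˡ (p n)

  θ-⊕ : ∀ f g → θ (f ⊕ g) ≗ θ f ⊕ θ g
  θ-⊕ f g n = distribˡ _ _ _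

  θ-const : ∀ c → θ (const c) ≗ 𝟘
  θ-const c zero    = trans (cong (_* c) ι-0) (zeroˡ c)
  θ-const c (suc n) = zeroʳ _

  θ-⊛ : ∀ f g → θ (f ⊛ g) ≗ θ f ⊛ g ⊕ f ⊛ θ g
  θ-⊛ f g zero    = solve 3 (λ z a b → z :* (a :* b) := (z :* a) :* b :+ a :* (con (ℤ.+ 0) :* b)) 
    refl (ι (ℤ.+ 0)) (f 0) (g 0)
  θ-⊛ f g (suc n) = begin
    ι (ℤ.+ suc n) * (f 0 * g (suc n) + ((f ∘ suc) ⊛ g) n)
      ≡⟨ distribˡ _ _ _ ⟩
    ι (ℤ.+ suc n) * (f 0 * g (suc n)) + ι (ℤ.+ suc n) * ((f ∘ suc) ⊛ g) n
      -- The degree splits as n + 1 = 1 + n. Accordingly the shift of `θ f` is (f ∘ suc) ⊕ θ (f ∘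
      -- suc), and the summand without the factor n is recombined below.
      ≡⟨ cong₂ _+_ refl (trans (suc-* n _) (cong (((f ∘ suc) ⊛ g) n +_) (θ-⊛ (f ∘ suc) g n))) ⟩
    ι (ℤ.+ suc n) * (f 0 * g (suc n)) + (((f ∘ suc) ⊛ g) n + ((θ (f ∘ suc) ⊛ g) n + ((f ∘ suc) ⊛ θ g) n))
      ≡⟨ solve 6 (λ k a b s t r → k :* (a :* b) :+ (s :+ (t :+ r)) :=
           (con (ℤ.+ 0) :* a :* b :+ (s :+ t)) :+ (a :* (k :* b) :+ r)) refl _ _ _ _ _ _ ⟩
    (ι (ℤ.+ 0) * f 0 * g (suc n) + (((f ∘ suc) ⊛ g) n + (θ (f ∘ suc) ⊛ g) n)) + (f 0 * (ι (ℤ.+ suc n) * g (suc n)) + ((f ∘ suc) ⊛ θ g) n)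
      ≡⟨ +-congʳ (+-congˡ (trans (sym (⊛-distribʳ g (f ∘ suc) (θ (f ∘ suc)) n))
           (⊛-cong {f = (f ∘ suc) ⊕ θ (f ∘ suc)} {g = g} (λ i → sym (suc-* i (f (suc i)))) (λ _ → refl) n))) ⟩
    (θ f ⊛ g ⊕ f ⊛ θ g) (suc n) ∎
    where
    open ≡-Reasoning
    suc-* : ∀ n x → ι (ℤ.+ suc n) * x ≡ x + ι (ℤ.+ n) * x
    suc-* n x = trans (cong (_* x) (ι-nat-suc n)) (trans (distribʳ _ _ _) (+-congʳ (*-identityˡ x)))

  -- Here l is u f′/f, stated without division so that f need not be inverted.
  HasLogDerivative : Series → Series → Set
  HasLogDerivative f l = θ f ≗ f ⊛ l

  logDerivative-⊛ : ∀ {f g l m} → HasLogDerivative f l → HasLogDerivative g m → HasLogDerivative (f ⊛ g) (l ⊕ m)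
  logDerivative-⊛ {f} {g} {l} {m} p q = begin
    θ (f ⊛ g)                    ≈⟨ θ-⊛ f g ⟩
    θ f ⊛ g ⊕ f ⊛ θ g            ≈⟨ S.+-cong (S.*-congʳ {g} p) (S.*-congˡ {f} q) ⟩
    (f ⊛ l) ⊛ g ⊕ f ⊛ (g ⊛ m)    ≈⟨ solveₛ 4 (λ f g l m → (f ⊠ l) ⊠ g ⊹ f ⊠ (g ⊠ m) ⊜ (f ⊠ g) ⊠ (l ⊹ m)) (λ _ → refl) f g l m ⟩
    (f ⊛ g) ⊛ (l ⊕ m)            ∎
    where open ≗-Reasoning

  logDerivative-𝟙 : HasLogDerivative 𝟙 𝟘
  logDerivative-𝟙 n = trans (θ-const 1# n) (sym (S.zeroʳ 𝟙 n))

  infixr 8 _^_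
  _^_ : Series → ℕ → Series
  f ^ zero  = 𝟙
  f ^ suc n = f ⊛ f ^ n

  logDerivative-^ : ∀ {f l} → HasLogDerivative f l → ∀ n → HasLogDerivative (f ^ n) (const (ι (ℤ.+ n)) ⊛ l)
  logDerivative-^ {f} {l} p zero    i = trans (logDerivative-𝟙 i)
    (S.*-congˡ {𝟙} (λ j → sym (trans (const-⊛ _ l j) (trans (cong (_* l j) ι-0) (zeroˡ _)))) i)
  logDerivative-^ {f} {l} p (suc n) i = trans (logDerivative-⊛ {f} {f ^ n} {l} p (logDerivative-^ p n) i)
    (S.*-congˡ {f ^ suc n} (λ j → sym (begin
      (const (ι (ℤ.+ suc n)) ⊛ l) j      ≡⟨ const-⊛ _ l j ⟩
      ι (ℤ.+ suc n) * l j                ≡⟨ cong (_* l j) (ι-nat-suc n) ⟩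
      (1# + ι (ℤ.+ n)) * l j             ≡⟨ distribʳ _ _ _ ⟩
      1# * l j + ι (ℤ.+ n) * l j         ≡⟨ cong₂ _+_ (*-identityˡ _) (sym (const-⊛ _ l j)) ⟩
      l j + (const (ι (ℤ.+ n)) ⊛ l) j    ∎)) i)
    where open ≡-Reasoning

  -- As l has no constant term, the equation in degree n + 1 expresses (n + 1) f (n + 1) through
  -- lower coefficients of f, and in characteristic 0 the factor n + 1 can be cancelled.
  logDerivative-determines : ∀ {f g l m N} → f 0 ≡ g 0 → HasLogDerivative f l → HasLogDerivative g m →
    l 0 ≡ 0# → m 0 ≡ 0# → (∀ {i} → i ≤ N → l i ≡ m i) → ∀ {i} → i ≤ N → f i ≡ g i
  logDerivative-determines {f} {g} {l} {m} {N} f₀≡g₀ p q l₀ m₀ l≡m {i} i≤N = go i i≤N ℕ.≤-refl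
    where
    open ≡-Reasoning
    go : ∀ n → n ≤ N → ∀ {i} → i ≤ n → f i ≡ g i
    go zero    _   z≤n = f₀≡g₀
    go (suc n) n<N i≤1+n with ℕ.m≤n⇒m<n∨m≡n i≤1+n
    ... | inj₁ (s≤s i≤n) = go n (ℕ.<⇒≤ n<N) i≤n
    ... | inj₂ refl = *-cancelˡ (λ eq → case-0 (ι-injective (trans eq (sym ι-0)))) (begin
      ι (ℤ.+ suc n) * f (suc n)                     ≡⟨ p (suc n) ⟩
      (f ⊛ l) (suc n)                             ≡⟨ drop-0 f l l₀ ⟩
      (f ⊛ (l ∘ suc)) n                           ≡⟨ ⊛-cong≤ n (go n (ℕ.<⇒≤ n<N)) (λ i≤n → l≡m (ℕ.≤-trans (s≤s i≤n) n<N)) ⟩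
      (g ⊛ (m ∘ suc)) n                           ≡⟨ drop-0 g m m₀ ⟨
      (g ⊛ m) (suc n)                             ≡⟨ q (suc n) ⟨
      ι (ℤ.+ suc n) * g (suc n)                     ∎)
      where
      case-0 : ℤ.+ suc n ≢ ℤ.+ 0
      case-0 ()
      drop-0 : ∀ f l → l 0 ≡ 0# → (f ⊛ l) (suc n) ≡ (f ⊛ (l ∘ suc)) n
      drop-0 f l l₀ = trans (⊛-suc f l n) (trans (+-congˡ (trans (*-congˡ l₀) (zeroʳ _))) (+-identityʳ _))

  -- Eventually constant sequences and multiplicities at u = 1

  Eventually : Series → K → Set
  Eventually f c = ∃ λ N → ∀ {n} → N ≤ n → f n ≡ c

  eventually-cong : ∀ {f g c} → f ≗ g → Eventually f c → Eventually g c
  eventually-cong p (N , q) = N , λ {n} N≤n → trans (sym (p n)) (q N≤n)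

  eventually-⊕ : ∀ {f g c d} → Eventually f c → Eventually g d → Eventually (f ⊕ g) (c + d)
  eventually-⊕ (M , p) (N , q) = M ℕ.+ N , λ M+N≤n →
    cong₂ _+_ (p (ℕ.≤-trans (ℕ.m≤m+n M N) M+N≤n)) (q (ℕ.≤-trans (ℕ.m≤n+m N M) M+N≤n))

  eventually-⊖ : ∀ {f c} → Eventually f c → Eventually (⊖ f) (- c)
  eventually-⊖ (N , p) = N , λ N≤n → cong -_ (p N≤n)

  eventually-const⊛ : ∀ {f c} a → Eventually f c → Eventually (const a ⊛ f) (a * c)
  eventually-const⊛ {f} a (N , p) = N , λ {n} N≤n → trans (const-⊛ a f n) (*-congˡ (p N≤n))

  eventually-unique : ∀ {f c d} → Eventually f c → Eventually f d → c ≡ d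
  eventually-unique (M , p) (N , q) = trans (sym (p (ℕ.m≤m+n M N))) (q (ℕ.m≤n+m N M))

  -- q acts on eventually constant sequences as the polynomials with value v at 1 do.
  HasValueAt1 : Series → K → Set
  HasValueAt1 q v = ∀ {f c} → Eventually f c → Eventually (q ⊛ f) (v * c)

  hasValueAt1-cong : ∀ {q r v} → q ≗ r → HasValueAt1 q v → HasValueAt1 r v
  hasValueAt1-cong p val {f} ev = eventually-cong (S.*-congʳ {f} p) (val ev)

  hasValueAt1-⊛ : ∀ {q r v w} → HasValueAt1 q v → HasValueAt1 r w → HasValueAt1 (q ⊛ r) (v * w)
  hasValueAt1-⊛ {q} {r} val val′ {f} ev =
    eventually-cong (λ n → sym (⊛-assoc q r f n)) (subst (Eventually _) (sym (*-assoc _ _ _)) (val (val′ ev)))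

  hasValueAt1-⊕ : ∀ {q r v w} → HasValueAt1 q v → HasValueAt1 r w → HasValueAt1 (q ⊕ r) (v + w)
  hasValueAt1-⊕ {q} {r} val val′ {f} ev =
    eventually-cong (λ n → sym (⊛-distribʳ f q r n)) (subst (Eventually _) (sym (distribʳ _ _ _)) (eventually-⊕ (val ev) (val′ ev)))

  hasValueAt1-const : ∀ a → HasValueAt1 (const a) a
  hasValueAt1-const a = eventually-const⊛ a

  u : Series
  u zero    = 0#
  u (suc n) = 𝟙 n

  u-⊛ : ∀ f n → (u ⊛ f) (suc n) ≡ f n
  u-⊛ f n = trans (cong₂ _+_ (zeroˡ _) (⊛-identityˡ f n)) (+-identityˡ _)

  hasValueAt1-u : HasValueAt1 u 1#
  hasValueAt1-u {f} {c} (N , p) = suc N , λ { (s≤s N≤n) → trans (u-⊛ f _) (trans (p N≤n) (sym (*-identityˡ c))) }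

  -- For f = ∑ₙ tr(Aⁿ) uⁿ, whose pole at u = 1 is simple, a is the coefficient of (1 - u)⁻¹:
  -- multiplying by the rest q of the denominator leaves the eventually constant sequence q(1) a.
  HasMultiplicity : Series → K → Set
  HasMultiplicity f a = ∃₂ λ q v → v ≢ 0# × HasValueAt1 q v × Eventually (q ⊛ f) (v * a)

  -- The series q r f is eventually equal to w v a and to v w b, and v and w are nonzero.
  hasMultiplicity-unique : ∀ {f a b} → HasMultiplicity f a → HasMultiplicity f b → a ≡ b
  hasMultiplicity-unique {f} {a} {b} (q , v , v≢0 , val , ev) (r , w , w≢0 , val′ , ev′) =
    *-cancelˡ v≢0 (*-cancelˡ w≢0 (trans
      (eventually-unique (val′ ev)
        (eventually-cong {q ⊛ (r ⊛ f)} (solveₛ 3 (λ q r f → q ⊠ (r ⊠ f) ⊜ r ⊠ (q ⊠ f)) (λ _ → refl) q r f) (val ev′)))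
      (solve 3 (λ v w b → v :* (w :* b) := w :* (v :* b)) refl v w b)))

  eventually⇒hasMultiplicity : ∀ {f a} → Eventually f a → HasMultiplicity f a
  eventually⇒hasMultiplicity {f} {a} ev = 𝟙 , 1# , 1≢0 , hasValueAt1-const 1# , hasValueAt1-const 1# {f} ev

  hasMultiplicity-⊕ : ∀ {f g a b} → HasMultiplicity f a → HasMultiplicity g b → HasMultiplicity (f ⊕ g) (a + b)
  hasMultiplicity-⊕ {f} {g} {a} {b} (q , v , v≢0 , val , ev) (r , w , w≢0 , val′ , ev′) =
    q ⊛ r , v * w , *-≢0 v≢0 w≢0 , hasValueAt1-⊛ {q} {r} val val′ ,
    subst (Eventually _) (solve 4 (λ v w a b → w :* (v :* a) :+ v :* (w :* b) := (v :* w) :* (a :+ b)) refl v w a b)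
      (eventually-cong {r ⊛ (q ⊛ f) ⊕ q ⊛ (r ⊛ g)}
        (solveₛ 4 (λ q r f g → r ⊠ (q ⊠ f) ⊹ q ⊠ (r ⊠ g) ⊜ (q ⊠ r) ⊠ (f ⊹ g)) (λ _ → refl) q r f g)
        (eventually-⊕ (val′ ev) (val ev′)))

  -- Multipliers preserve being eventually 0, so finitely many coefficients do not matter. This
  -- absorbs degree 0, where `traces M` is the size of M while u Z′/Z vanishes.
  hasMultiplicity-cong : ∀ {f g a} → (∃ λ N → ∀ {n} → N ≤ n → f n ≡ g n) → HasMultiplicity f a → HasMultiplicity g a
  hasMultiplicity-cong {f} {g} {a} (N , p) (q , v , v≢0 , val , ev) = q , v , v≢0 , val ,
    subst (Eventually _) (trans (+-congˡ (zeroʳ v)) (+-identityʳ _))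
      (eventually-cong {q ⊛ f ⊕ q ⊛ (g ⊕ ⊖ f)} (solveₛ 3 (λ q f g → q ⊠ f ⊹ q ⊠ (g ⊹ ⊟ f) ⊜ q ⊠ g) (λ _ → refl) q f g)
        (eventually-⊕ ev (val {g ⊕ ⊖ f} (N , λ N≤n → trans (+-congʳ (sym (p N≤n))) (-‿inverseʳ _)))))

  -- Orders at u = 1 of rational functions

  ιₛ : PowerSeries → Series
  ιₛ f n = ι (f n)

  hasValueAt1-eval : ∀ P → HasValueAt1 (ιₛ ⟦ P ⟧) (ι (eval P (ℤ.+ 1)))
  hasValueAt1-eval []      {f} {c} ev = 0 , λ {n} _ →
    trans (⊛-cong {ιₛ ⟦ [] ⟧} {𝟘} {f} (λ _ → ι-0) (λ _ → refl) n) (trans (⊛-zeroˡ f n) (sym (trans (*-congʳ ι-0) (zeroˡ c))))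
  hasValueAt1-eval (a ∷ P) = subst (HasValueAt1 _)
      (trans (+-congˡ (*-identityˡ _)) (trans (sym (ι-+ a _)) (cong (λ x → ι (a ℤ.+ x)) (sym (ℤ.*-identityˡ _)))))
      (hasValueAt1-cong {const (ι a) ⊕ u ⊛ ιₛ ⟦ P ⟧}
        (λ { zero → trans (+-congˡ (zeroˡ _)) (+-identityʳ _) ; (suc n) → trans (+-identityˡ _) (u-⊛ _ n) })
        (hasValueAt1-⊕ {const (ι a)} {u ⊛ ιₛ ⟦ P ⟧} (hasValueAt1-const (ι a)) (hasValueAt1-⊛ {u} {ιₛ ⟦ P ⟧} hasValueAt1-u (hasValueAt1-eval P))))

  ⟦⟧-eventually : ∀ P → Eventually (ιₛ ⟦ P ⟧) 0#
  ⟦⟧-eventually []      = 0 , λ _ → ι-0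
  ⟦⟧-eventually (a ∷ P) = let N , p = ⟦⟧-eventually P in suc N , λ { (s≤s N≤n) → p N≤n }

  θ-eventually : ∀ {f} → Eventually f 0# → Eventually (θ f) 0#
  θ-eventually (N , p) = N , λ N≤n → trans (*-congˡ (p N≤n)) (zeroʳ _)

  ones : Series
  ones _ = 1#

  u∸1 : Series
  u∸1 = u ⊕ ⊖ 𝟙

  u∸1-inverse : u∸1 ⊛ ⊖ ones ≗ 𝟙
  u∸1-inverse n = trans (solveₛ 3 (λ u i g → (u ⊹ ⊟ i) ⊠ ⊟ g ⊜ i ⊠ g ⊹ ⊟ (u ⊠ g)) (λ _ → refl) u 𝟙 ones n) (trans
    (+-congʳ (⊛-identityˡ ones n)) (telescope n))
    where
    telescope : ∀ n → 1# + - (u ⊛ ones) n ≡ 𝟙 n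
    telescope zero    = trans (cong (λ x → 1# + - x) (zeroˡ _)) (trans (+-congˡ (-0#≈0#)) (+-identityʳ 1#))
    telescope (suc n) = trans (cong (λ x → 1# + - x) (u-⊛ ones n)) (-‿inverseʳ 1#)

  θ-u : θ u ≗ u
  θ-u zero          = zeroʳ _
  θ-u (suc zero)    = trans (*-congʳ ι-1) (*-identityˡ _)
  θ-u (suc (suc n)) = zeroʳ _

  -- This is u/(u - 1), the logarithmic derivative of u - 1; from degree 1 on all its coefficients
  -- are -1.
  pole : Series
  pole = ⊖ ones ⊛ u

  logDerivative-u∸1 : HasLogDerivative u∸1 pole
  logDerivative-u∸1 n = begin
    θ u∸1 n                          ≡⟨ θ-⊕ u (⊖ 𝟙) n ⟩
    θ u n + θ (⊖ 𝟙) n                ≡⟨ cong₂ _+_ (θ-u n) (θ-⊖𝟙 n) ⟩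
    u n + 0#                         ≡⟨ +-identityʳ _ ⟩
    u n                              ≡⟨ ⊛-identityˡ u n ⟨
    (𝟙 ⊛ u) n                        ≡⟨ S.*-congʳ {u} u∸1-inverse n ⟨
    ((u∸1 ⊛ ⊖ ones) ⊛ u) n           ≡⟨ ⊛-assoc u∸1 (⊖ ones) u n ⟩
    (u∸1 ⊛ pole) n                   ∎
    where
    open ≡-Reasoning
    θ-⊖𝟙 : θ (⊖ 𝟙) ≗ 𝟘
    θ-⊖𝟙 n = trans (sym (-‿distribʳ-* _ _)) (trans (cong -_ (θ-const 1# n)) (-0#≈0#))

  -- Applied to f = u - 1, which is a unit among power series though not among polynomials.
  ⊛-^-cancelˡ : ∀ {f f⁻¹ g h} → f ⊛ f⁻¹ ≗ 𝟙 → ∀ n → f ^ n ⊛ g ≗ f ^ n ⊛ h → g ≗ h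
  ⊛-^-cancelˡ {g = g} {h} inv zero eq = λ n → trans (sym (⊛-identityˡ g n)) (trans (eq n) (⊛-identityˡ h n))
  ⊛-^-cancelˡ {f} {f⁻¹} {g} {h} inv (suc n) eq = ⊛-^-cancelˡ {f} {f⁻¹} inv n (begin
    f ^ n ⊛ g                    ≈⟨ insert g ⟩
    f⁻¹ ⊛ (f ^ suc n ⊛ g)        ≈⟨ S.*-congˡ {f⁻¹} eq ⟩
    f⁻¹ ⊛ (f ^ suc n ⊛ h)        ≈⟨ insert h ⟨
    f ^ n ⊛ h                    ∎)
    where
    open ≗-Reasoning
    insert : ∀ g → f ^ n ⊛ g ≗ f⁻¹ ⊛ (f ^ suc n ⊛ g)
    insert g = begin
      f ^ n ⊛ g                  ≈⟨ ⊛-identityˡ (f ^ n ⊛ g) ⟨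
      𝟙 ⊛ (f ^ n ⊛ g)            ≈⟨ S.*-congʳ {f ^ n ⊛ g} inv ⟨
      (f ⊛ f⁻¹) ⊛ (f ^ n ⊛ g)    ≈⟨ solveₛ 4 (λ f i p g → (f ⊠ i) ⊠ (p ⊠ g) ⊜ i ⊠ ((f ⊠ p) ⊠ g)) (λ _ → refl) f f⁻¹ (f ^ n) g ⟩
      f⁻¹ ⊛ (f ^ suc n ⊛ g)      ∎

  -- Taking θ of z D = N, with N = (u-1)ᵐ P and D = (u-1)ⁿ Q, gives
  -- P Q t = (m - n) (u/(u-1)) P Q + θP Q - P θQ, where θz = z t.
  residue : ∀ {z t N D P Q} m n → HasLogDerivative z t →
    z ⊛ D ≗ N → N ≗ u∸1 ^ m ⊛ P → D ≗ u∸1 ^ n ⊛ Q →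
    (P ⊛ Q) ⊛ t ≗ (const (ι (ℤ.+ m)) ⊕ ⊖ const (ι (ℤ.+ n))) ⊛ ((P ⊛ Q) ⊛ pole) ⊕ (θ P ⊛ Q ⊕ ⊖ (P ⊛ θ Q))
  residue {z} {t} {N} {D} {P} {Q} m n zt zD N≗ D≗ = begin
    (P ⊛ Q) ⊛ t
      ≈⟨ solveₛ 5 (λ P Q t θQ w → (P ⊠ Q) ⊠ t ⊜ P ⊠ (t ⊠ Q ⊹ (w ⊠ Q ⊹ θQ)) ⊹ ⊟ (w ⊠ (P ⊠ Q) ⊹ P ⊠ θQ)) (λ _ → refl) P Q t (θ Q) w ⟩
    P ⊛ (t ⊛ Q ⊕ (w ⊛ Q ⊕ θ Q)) ⊕ ⊖ (w ⊛ (P ⊛ Q) ⊕ P ⊛ θ Q)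
      ≈⟨ S.+-congʳ {⊖ (w ⊛ (P ⊛ Q) ⊕ P ⊛ θ Q)} (⊛-^-cancelˡ {u∸1} {⊖ ones} u∸1-inverse m key) ⟩
    (v ⊛ P ⊕ θ P) ⊛ Q ⊕ ⊖ (w ⊛ (P ⊛ Q) ⊕ P ⊛ θ Q)
      ≈⟨ solveₛ 7 (λ P Q θP θQ cm cn p → (cm ⊠ p ⊠ P ⊹ θP) ⊠ Q ⊹ ⊟ (cn ⊠ p ⊠ (P ⊠ Q) ⊹ P ⊠ θQ)
           ⊜ (cm ⊹ ⊟ cn) ⊠ ((P ⊠ Q) ⊠ p) ⊹ (θP ⊠ Q ⊹ ⊟ (P ⊠ θQ))) (λ _ → refl) P Q (θ P) (θ Q) (const (ι (ℤ.+ m))) (const (ι (ℤ.+ n))) pole ⟩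
    (const (ι (ℤ.+ m)) ⊕ ⊖ const (ι (ℤ.+ n))) ⊛ ((P ⊛ Q) ⊛ pole) ⊕ (θ P ⊛ Q ⊕ ⊖ (P ⊛ θ Q)) ∎
    where
    open ≗-Reasoning
    A = u∸1 ^ m
    B = u∸1 ^ n
    v = const (ι (ℤ.+ m)) ⊛ pole
    w = const (ι (ℤ.+ n)) ⊛ pole
    θ-factor : ∀ k Q → θ (u∸1 ^ k ⊛ Q) ≗ u∸1 ^ k ⊛ (const (ι (ℤ.+ k)) ⊛ pole ⊛ Q ⊕ θ Q)
    θ-factor k Q = begin
      θ (u∸1 ^ k ⊛ Q)                   ≈⟨ θ-⊛ (u∸1 ^ k) Q ⟩
      θ (u∸1 ^ k) ⊛ Q ⊕ u∸1 ^ k ⊛ θ Q   ≈⟨ S.+-congʳ {u∸1 ^ k ⊛ θ Q} (S.*-congʳ {Q} (logDerivative-^ {u∸1} logDerivative-u∸1 k)) ⟩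
      (u∸1 ^ k ⊛ r) ⊛ Q ⊕ u∸1 ^ k ⊛ θ Q
        ≈⟨ solveₛ 4 (λ U l Q θQ → (U ⊠ l) ⊠ Q ⊹ U ⊠ θQ ⊜ U ⊠ (l ⊠ Q ⊹ θQ)) (λ _ → refl) (u∸1 ^ k) r Q (θ Q) ⟩
      u∸1 ^ k ⊛ (r ⊛ Q ⊕ θ Q)           ∎
      where r = const (ι (ℤ.+ k)) ⊛ pole
    zB : z ⊛ (B ⊛ Q) ≗ A ⊛ P
    zB = S.trans {z ⊛ (B ⊛ Q)} {z ⊛ D} (S.*-congˡ {z} (λ i → sym (D≗ i))) (S.trans {z ⊛ D} {N} zD N≗)
    -- By the product rule, z B times the bracket is `θ` of z B Q. As z B Q = A P, both sides are Q
    -- times `θ` of the same series.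
    key : A ⊛ (P ⊛ (t ⊛ Q ⊕ (w ⊛ Q ⊕ θ Q))) ≗ A ⊛ ((v ⊛ P ⊕ θ P) ⊛ Q)
    key = begin
      A ⊛ (P ⊛ (t ⊛ Q ⊕ (w ⊛ Q ⊕ θ Q)))       ≈⟨ ⊛-assoc A P _ ⟨
      (A ⊛ P) ⊛ (t ⊛ Q ⊕ (w ⊛ Q ⊕ θ Q))       ≈⟨ S.*-congʳ {t ⊛ Q ⊕ (w ⊛ Q ⊕ θ Q)} zB ⟨
      (z ⊛ (B ⊛ Q)) ⊛ (t ⊛ Q ⊕ (w ⊛ Q ⊕ θ Q))
        ≈⟨ solveₛ 6 (λ z B Q t w θQ → (z ⊠ (B ⊠ Q)) ⊠ (t ⊠ Q ⊹ (w ⊠ Q ⊹ θQ)) ⊜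
             (((z ⊠ t) ⊠ (B ⊠ Q)) ⊹ z ⊠ (B ⊠ (w ⊠ Q ⊹ θQ))) ⊠ Q) (λ _ → refl) z B Q t w (θ Q) ⟩
      ((z ⊛ t) ⊛ (B ⊛ Q) ⊕ z ⊛ (B ⊛ (w ⊛ Q ⊕ θ Q))) ⊛ Q
        ≈⟨ S.*-congʳ {Q} (S.+-cong (S.*-congʳ {B ⊛ Q} zt) (S.*-congˡ {z} (θ-factor n Q))) ⟨
      (θ z ⊛ (B ⊛ Q) ⊕ z ⊛ θ (B ⊛ Q)) ⊛ Q     ≈⟨ S.*-congʳ {Q} (θ-⊛ z (B ⊛ Q)) ⟨
      θ (z ⊛ (B ⊛ Q)) ⊛ Q                     ≈⟨ S.*-congʳ {Q} (θ-cong zB) ⟩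
      θ (A ⊛ P) ⊛ Q                           ≈⟨ S.*-congʳ {Q} (θ-factor m P) ⟩
      (A ⊛ (v ⊛ P ⊕ θ P)) ⊛ Q                 ≈⟨ ⊛-assoc A _ Q ⟩
      A ⊛ ((v ⊛ P ⊕ θ P) ⊛ Q)                 ∎

  ιₛ-*ₛ : ∀ f g → ιₛ (f *ₛ g) ≗ ιₛ f ⊛ ιₛ g
  ιₛ-*ₛ f g zero    = trans (ι-+ _ _) (trans (cong₂ _+_ (ι-* _ _) ι-0) (+-identityʳ _))
  ιₛ-*ₛ f g (suc n) = trans (ι-+ _ _) (cong₂ _+_ (ι-* _ _) (ιₛ-*ₛ (f ∘ suc) g n))

  ιₛ-1ₛ : ιₛ 1ₛ ≗ 𝟙
  ιₛ-1ₛ zero    = ι-1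
  ιₛ-1ₛ (suc n) = ι-0

  ιₛ-^ₛ : ∀ f n → ιₛ (f ^ₛ n) ≗ ιₛ f ^ n
  ιₛ-^ₛ f zero    = ιₛ-1ₛ
  ιₛ-^ₛ f (suc n) i = trans (ιₛ-*ₛ f (f ^ₛ n) i) (S.*-congˡ {ιₛ f} (ιₛ-^ₛ f n) i)

  ιₛ-u-1 : ιₛ ⟦ u-1 ⟧ ≗ u∸1
  ιₛ-u-1 zero          = trans (ι-neg (ℤ.+ 1)) (trans (cong -_ ι-1) (sym (+-identityˡ _)))
  ιₛ-u-1 (suc zero)    = trans ι-1 (sym (trans (+-congˡ (-0#≈0#)) (+-identityʳ _)))
  ιₛ-u-1 (suc (suc n)) = trans ι-0 (sym (-‿inverseʳ _))

  ^-cong : ∀ {f g} → f ≗ g → ∀ n → f ^ n ≗ g ^ n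
  ^-cong p zero    = λ _ → refl
  ^-cong p (suc n) = S.*-cong p (^-cong p n)

  -- The multiplier is P Q from `residue`. On the right of that identity `pole` is eventually -1,
  -- and θP Q - P θQ is a polynomial, hence eventually 0. The sign of `pole` turns the order k = m -
  -- n into the multiplicity -k.
  hasOrderAt1⇒hasMultiplicity : ∀ {z t k} → HasLogDerivative (ιₛ z) t → HasOrderAt1 z k → HasMultiplicity t (ι (ℤ.- k))
  hasOrderAt1⇒hasMultiplicity {z} {t} zt (N , D , zD , m , n , (P , N≗ , P≢0) , (Q , D≗ , Q≢0) , refl) =
    p ⊛ q , vp * vq , *-≢0 (ι-≢0 P≢0) (ι-≢0 Q≢0) , value ,
    subst (Eventually _) value≡ (eventually-cong {(cm ⊕ ⊖ cn) ⊛ ((p ⊛ q) ⊛ pole) ⊕ (θ p ⊛ q ⊕ ⊖ (p ⊛ θ q))} (λ i → sym (residue m n zt zD′ (factor N P m N≗) (factor D Q n D≗) i))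
      (eventually-⊕
        (hasValueAt1-⊕ {cm} {⊖ cn} (hasValueAt1-const _) (hasValueAt1-cong ⊖-const (hasValueAt1-const _)) (value eventually-pole))
        (eventually-⊕ (eventually-cong (⊛-comm q (θ p)) (valq (θ-eventually (⟦⟧-eventually P))))
          (eventually-⊖ (valp (θ-eventually (⟦⟧-eventually Q)))))))
    where
    p = ιₛ ⟦ P ⟧
    q = ιₛ ⟦ Q ⟧
    vp = ι (eval P (ℤ.+ 1))
    vq = ι (eval Q (ℤ.+ 1))
    cm = const (ι (ℤ.+ m))
    cn = const (ι (ℤ.+ n))
    valp : HasValueAt1 p vp
    valp {f} = hasValueAt1-eval P {f}
    valq : HasValueAt1 q vq
    valq {f} = hasValueAt1-eval Q {f}
    value : HasValueAt1 (p ⊛ q) (vp * vq)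
    value {f} = hasValueAt1-⊛ {p} {q} valp valq {f}
    ι-≢0 : ∀ {n} → n ≢ ℤ.+ 0 → ι n ≢ 0#
    ι-≢0 n≢0 eq = n≢0 (ι-injective (trans eq (sym ι-0)))
    ⊖-const : const (- ι (ℤ.+ n)) ≗ ⊖ cn
    ⊖-const zero    = refl
    ⊖-const (suc _) = sym (-0#≈0#)
    zD′ : ιₛ z ⊛ ιₛ ⟦ D ⟧ ≗ ιₛ ⟦ N ⟧
    zD′ i = trans (sym (ιₛ-*ₛ z ⟦ D ⟧ i)) (cong ι (zD i))
    factor : ∀ N P k → ⟦ N ⟧ ≗ ⟦ u-1 ⟧ ^ₛ k *ₛ ⟦ P ⟧ → ιₛ ⟦ N ⟧ ≗ u∸1 ^ k ⊛ ιₛ ⟦ P ⟧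
    factor N P k eq i = trans (cong ι (eq i)) (trans (ιₛ-*ₛ (⟦ u-1 ⟧ ^ₛ k) ⟦ P ⟧ i)
      (S.*-congʳ {ιₛ ⟦ P ⟧} (λ j → trans (ιₛ-^ₛ ⟦ u-1 ⟧ k j) (^-cong ιₛ-u-1 k j)) i))
    eventually-pole : Eventually pole (- 1#)
    eventually-pole = 1 , λ { {suc n} _ → trans (⊛-comm (⊖ ones) u (suc n)) (u-⊛ (⊖ ones) n) }
    value≡ : (ι (ℤ.+ m) + - ι (ℤ.+ n)) * (vp * vq * - 1#) + (vq * 0# + - (vp * 0#)) ≡ vp * vq * ι (ℤ.- (ℤ.+ m ℤ.- ℤ.+ n))
    value≡ = begin
      (ι (ℤ.+ m) + - ι (ℤ.+ n)) * (vp * vq * - 1#) + (vq * 0# + - (vp * 0#))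
        -- To the solver `0#` and `1#` are opaque, so they are first rewritten as images of
        -- integers.
        ≡⟨ cong₂ (λ i o → (ι (ℤ.+ m) + - ι (ℤ.+ n)) * (vp * vq * - i) + (vq * o + - (vp * o))) ι-1 ι-0 ⟨
      (ι (ℤ.+ m) + - ι (ℤ.+ n)) * (vp * vq * - ι (ℤ.+ 1)) + (vq * ι (ℤ.+ 0) + - (vp * ι (ℤ.+ 0)))
        ≡⟨ solve 4 (λ a b v w → (a :+ :- b) :* (v :* w :* :- con (ℤ.+ 1)) :+ (w :* con (ℤ.+ 0) :+ :- (v :* con (ℤ.+ 0)))
             := v :* w :* (:- (a :+ :- b))) refl (ι (ℤ.+ m)) (ι (ℤ.+ n)) vp vq ⟩
      vp * vq * (- (ι (ℤ.+ m) + - ι (ℤ.+ n)))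
        ≡⟨ *-congˡ (trans (cong -_ (trans (+-congˡ (sym (ι-neg _))) (sym (ι-+ _ _)))) (sym (ι-neg _))) ⟩
      vp * vq * ι (ℤ.- (ℤ.+ m ℤ.- ℤ.+ n)) ∎
      where open ≡-Reasoning

  -- The zeta function

  private
    u^-⊛-≥ : ∀ k f n → (u ^ k ⊛ f) (k ℕ.+ n) ≡ f n
    u^-⊛-≥ zero    f n = ⊛-identityˡ f n
    u^-⊛-≥ (suc k) f n = trans (⊛-assoc u (u ^ k) f (suc k ℕ.+ n)) (trans (u-⊛ (u ^ k ⊛ f) (k ℕ.+ n)) (u^-⊛-≥ k f n))

    u^-⊛-< : ∀ k f {n} → n < k → (u ^ k ⊛ f) n ≡ 0#
    u^-⊛-< (suc k) f {zero}  _         = trans (⊛-assoc u (u ^ k) f 0) (zeroˡ _)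
    u^-⊛-< (suc k) f {suc n} (s≤s n<k) = trans (⊛-assoc u (u ^ k) f (suc n)) (trans (u-⊛ (u ^ k ⊛ f) n) (u^-⊛-< k f n<k))

  geometricₖ : ℕ → Series
  geometricₖ k = ιₛ (geometric k)

  -- Below degree k only 0 is a multiple of k, and from k on divisibility is unchanged by
  -- subtracting k.
  geometric-recurrence : ∀ k → 1 ≤ k → geometricₖ k ≗ 𝟙 ⊕ u ^ k ⊛ geometricₖ k
  geometric-recurrence k 1≤k n with n ℕ.<? k
  geometric-recurrence k 1≤k zero    | yes n<k =
    trans (cong (λ b → ι (if b then ℤ.1ℤ else ℤ.0ℤ)) (dec-true (k ∣? 0) (k ∣0)))
      (trans ι-1 (sym (trans (+-congˡ (u^-⊛-< k (geometricₖ k) n<k)) (+-identityʳ _))))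
  geometric-recurrence k 1≤k (suc n) | yes n<k =
    trans (cong (λ b → ι (if b then ℤ.1ℤ else ℤ.0ℤ)) (dec-false (k ∣? suc n) (λ k∣n → ℕ.<⇒≱ n<k (∣⇒≤ k∣n))))
      (trans ι-0 (sym (trans (+-congˡ (u^-⊛-< k (geometricₖ k) n<k)) (+-identityʳ _))))
  ... | no n≮k with ℕ.m≤n⇒∃[o]m+o≡n (ℕ.≮⇒≥ n≮k)
  ... | m , refl = trans (trans (periodic (k ∣? m) (k ∣? (k ℕ.+ m))) (sym (u^-⊛-≥ k (geometricₖ k) m)))
    (sym (trans (+-congʳ (𝟙-pos k m 1≤k)) (+-identityˡ _)))
    where
    𝟙-pos : ∀ k m → 1 ≤ k → 𝟙 (k ℕ.+ m) ≡ 0#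
    𝟙-pos (suc k) m _ = refl
    periodic : (d : Dec (k ∣ m)) (d′ : Dec (k ∣ k ℕ.+ m)) →
      ι (if does d′ then ℤ.1ℤ else ℤ.0ℤ) ≡ ι (if does d then ℤ.1ℤ else ℤ.0ℤ)
    periodic (yes _) (yes _) = refl
    periodic (no _)  (no _)  = refl
    periodic (yes p) (no ¬q) = contradiction (∣m∣n⇒∣m+n ∣-refl p) ¬q
    periodic (no ¬p) (yes q) = contradiction (∣m+n∣m⇒∣n q ∣-refl) ¬p

  logDerivative-u : HasLogDerivative u 𝟙
  logDerivative-u n = trans (θ-u n) (sym (S.*-identityʳ u n))

  -- With y = uᵏ, applying `θ` to g = 1 + y g gives (1 - y) θg = k y g. Multiplying by g, the
  -- inverse of 1 - y, gives θg = g (k y g), and y g = g - 1.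
  logDerivative-geometric : ∀ k → 1 ≤ k →
    HasLogDerivative (geometricₖ k) (const (ι (ℤ.+ k)) ⊛ (geometricₖ k ⊕ ⊖ 𝟙))
  logDerivative-geometric k 1≤k = begin
    θ g                                          ≈⟨ ⊛-identityˡ (θ g) ⟨
    𝟙 ⊛ θ g                                      ≈⟨ S.*-congʳ {θ g} inverse-g ⟨
    (g ⊛ (𝟙 ⊕ ⊖ y)) ⊛ θ g
      ≈⟨ solveₛ 4 (λ g i y θg → (g ⊠ (i ⊹ ⊟ y)) ⊠ θg ⊜ g ⊠ (i ⊠ θg ⊹ ⊟ (y ⊠ θg))) (λ _ → refl) g 𝟙 y (θ g) ⟩
    g ⊛ (𝟙 ⊛ θ g ⊕ ⊖ (y ⊛ θ g))
      ≈⟨ S.*-congˡ {g} (S.+-congʳ {⊖ (y ⊛ θ g)} (S.trans {𝟙 ⊛ θ g} (⊛-identityˡ (θ g)) θg)) ⟩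
    g ⊛ (c ⊛ (y ⊛ g) ⊕ y ⊛ θ g ⊕ ⊖ (y ⊛ θ g))
      ≈⟨ solveₛ 4 (λ g c y θg → g ⊠ (c ⊠ (y ⊠ g) ⊹ y ⊠ θg ⊹ ⊟ (y ⊠ θg)) ⊜ g ⊠ (c ⊠ (y ⊠ g))) (λ _ → refl) g c y (θ g) ⟩
    g ⊛ (c ⊛ (y ⊛ g))
      ≈⟨ S.*-congˡ {g} (S.*-congˡ {c} (λ i → trans (solveₛ 2 (λ i t → t ⊜ (i ⊹ t) ⊹ ⊟ i) (λ _ → refl) 𝟙 (y ⊛ g) i)
           (+-congʳ (sym (rec i))))) ⟩
    g ⊛ (c ⊛ (g ⊕ ⊖ 𝟙))                          ∎
    where
    open ≗-Reasoning
    g = geometricₖ k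
    y = u ^ k
    c = const (ι (ℤ.+ k))
    rec = geometric-recurrence k 1≤k
    θg : θ g ≗ c ⊛ (y ⊛ g) ⊕ y ⊛ θ g
    θg = begin
      θ g                        ≈⟨ θ-cong rec ⟩
      θ (𝟙 ⊕ y ⊛ g)              ≈⟨ θ-⊕ 𝟙 (y ⊛ g) ⟩
      θ 𝟙 ⊕ θ (y ⊛ g)            ≈⟨ S.+-cong (θ-const 1#) (θ-⊛ y g) ⟩
      𝟘 ⊕ (θ y ⊛ g ⊕ y ⊛ θ g)    ≈⟨ S.+-identityˡ _ ⟩
      θ y ⊛ g ⊕ y ⊛ θ g          ≈⟨ S.+-congʳ {y ⊛ θ g} (S.*-congʳ {g} (logDerivative-^ {u} logDerivative-u k)) ⟩
      (y ⊛ (c ⊛ 𝟙)) ⊛ g ⊕ y ⊛ θ g ≈⟨ S.+-congʳ {y ⊛ θ g} (S.*-congʳ {g} (S.*-congˡ {y} (S.*-identityʳ c))) ⟩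
      (y ⊛ c) ⊛ g ⊕ y ⊛ θ g      ≈⟨ solveₛ 4 (λ y c g θg → (y ⊠ c) ⊠ g ⊹ y ⊠ θg ⊜ c ⊠ (y ⊠ g) ⊹ y ⊠ θg) (λ _ → refl) y c g (θ g) ⟩
      c ⊛ (y ⊛ g) ⊕ y ⊛ θ g      ∎
    inverse-g : g ⊛ (𝟙 ⊕ ⊖ y) ≗ 𝟙
    inverse-g i = trans (solveₛ 3 (λ g i y → g ⊠ (i ⊹ ⊟ y) ⊜ i ⊠ g ⊹ ⊟ (y ⊠ g)) (λ _ → refl) g 𝟙 y i)
      (trans (+-congʳ (trans (⊛-identityˡ g i) (rec i)))
        (solve 2 (λ a b → a :+ b :+ :- b := a) refl (𝟙 i) ((y ⊛ g) i)))

  module _ (X : Digraph) where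

    eulerProduct : List (List (E X)) → PowerSeries
    eulerProduct = List.foldr (λ C f → geometric (length C) *ₛ f) 1ₛ

    logDerivatives : List (List (E X)) → Series
    logDerivatives = List.foldr (λ C f → const (ι (ℤ.+ length C)) ⊛ (geometricₖ (length C) ⊕ ⊖ 𝟙) ⊕ f) 𝟘

    logDerivative-eulerProduct : ∀ {Cs} → All (λ C → 1 ≤ length C) Cs →
      HasLogDerivative (ιₛ (eulerProduct Cs)) (logDerivatives Cs)
    logDerivative-eulerProduct []                 n = trans (θ-cong ιₛ-1ₛ n)
      (trans (logDerivative-𝟙 n) (S.*-congʳ {𝟘} (λ i → sym (ιₛ-1ₛ i)) n))
    logDerivative-eulerProduct {C ∷ Cs} (1≤ ∷ ps) n = trans (θ-cong (ιₛ-*ₛ (geometric (length C)) (eulerProduct Cs)) n)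
      (trans (logDerivative-⊛ {geometricₖ (length C)} {ιₛ (eulerProduct Cs)} (logDerivative-geometric (length C) 1≤) (logDerivative-eulerProduct ps) n)
        (S.*-congʳ {logDerivatives (C ∷ Cs)} (λ i → sym (ιₛ-*ₛ (geometric (length C)) (eulerProduct Cs) i)) n))

    logDerivatives-0 : ∀ Cs → logDerivatives Cs 0 ≡ 0#
    logDerivatives-0 []       = refl
    logDerivatives-0 (C ∷ Cs) = trans (cong₂ _+_
      (trans (*-congˡ (trans (+-congʳ (trans (cong (λ b → ι (if b then ℤ.1ℤ else ℤ.0ℤ)) (dec-true (length C ∣? 0) (length C ∣0))) ι-1))
        (solve 1 (λ x → x :+ :- x := con (ℤ.+ 0)) refl 1#))) (trans (*-congˡ ι-0) (zeroʳ _))) (logDerivatives-0 Cs)) (+-identityˡ _)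

    logDerivatives-suc : ∀ Cs n →
      logDerivatives Cs (suc n) ≡ ι (ℤ.+ ℕ.sum (map (λ C → if does (length C ∣? suc n) then length C else 0) Cs))
    logDerivatives-suc []       n = sym ι-0
    logDerivatives-suc (C ∷ Cs) n =
      trans (cong₂ _+_ (trans (const-⊛ _ (geometricₖ (length C) ⊕ ⊖ 𝟙) (suc n)) (term (length C ∣? suc n))) (logDerivatives-suc Cs n)) (sym (ι-+ _ _))
      where
      term : (d : Dec (length C ∣ suc n)) → ι (ℤ.+ length C) * (ι (if does d then ℤ.1ℤ else ℤ.0ℤ) + - 0#) ≡ ι (ℤ.+ (if does d then length C else 0))
      term (yes _) =
        trans (*-congˡ (trans (cong₂ (λ i o → i + - o) ι-1 refl) (trans (+-congˡ (-0#≈0#)) (+-identityʳ _)))) (*-identityʳ _)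
      term (no _)  = trans (trans (*-congˡ (trans (+-congˡ (-0#≈0#)) (trans (+-identityʳ _) ι-0))) (zeroʳ _)) (sym ι-0)

    cycleCounts : Series
    cycleCounts zero    = 0#
    cycleCounts (suc n) = ι (ℤ.+ length (cycles X (suc n)))

    logDerivatives≡cycleCounts : ∀ {N n} → n ≤ N → logDerivatives (primesUpTo X N) n ≡ cycleCounts n
    logDerivatives≡cycleCounts {N} {zero}  _   = logDerivatives-0 (primesUpTo X N)
    logDerivatives≡cycleCounts {N} {suc n} n≤N = trans (logDerivatives-suc (primesUpTo X N) n)
      (cong (λ k → ι (ℤ.+ k)) (sym (cycles-count X N (suc n) (s≤s z≤n) n≤N)))

    logDerivative-partialZeta : ∀ N → HasLogDerivative (ιₛ (partialZeta X N)) (logDerivatives (primesUpTo X N))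
    logDerivative-partialZeta N = logDerivative-eulerProduct
      (All.tabulate λ {C} C∈ → isCycle-nonempty X C (proj₁ (∈-primesUpTo⁻ X N C∈)))

    eulerProduct-0 : ∀ Cs → ιₛ (eulerProduct Cs) 0 ≡ 1#
    eulerProduct-0 []       = ι-1
    eulerProduct-0 (C ∷ Cs) = trans (ιₛ-*ₛ (geometric (length C)) (eulerProduct Cs) 0)
      (trans (cong₂ _*_ (trans (cong (λ b → ι (if b then ℤ.1ℤ else ℤ.0ℤ)) (dec-true (length C ∣? 0) (length C ∣0))) ι-1) (eulerProduct-0 Cs)) (*-identityˡ _))

    -- Rather than the additional Euler factors, the logarithmic derivatives are compared: up to
    -- degree n both equal `cycleCounts`, and both products have constant term 1.
    partialZeta-stable : ∀ {n N} → n ≤ N → ιₛ (partialZeta X N) n ≡ ιₛ (zeta X) n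
    partialZeta-stable {n} {N} n≤N = logDerivative-determines
      (trans (eulerProduct-0 (primesUpTo X N)) (sym (eulerProduct-0 (primesUpTo X n))))
      (logDerivative-partialZeta N) (logDerivative-partialZeta n)
      (logDerivatives-0 (primesUpTo X N)) (logDerivatives-0 (primesUpTo X n))
      (λ i≤n → trans (logDerivatives≡cycleCounts (ℕ.≤-trans i≤n n≤N)) (sym (logDerivatives≡cycleCounts i≤n)))
      ℕ.≤-refl

    -- Every coefficient of `zeta` comes from a truncation of its own; for the equation in degree n
    -- all of them may be taken from `partialZeta X n`.
    logDerivative-zeta : HasLogDerivative (ιₛ (zeta X)) cycleCounts
    logDerivative-zeta n = trans (logDerivative-partialZeta n n) (⊛-cong≤ n partialZeta-stable logDerivatives≡cycleCounts)

  -- Linear algebra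

  Mat : ℕ → ℕ → Set
  Mat m n = Fin m → Fin n → K

  Vect : ℕ → Set
  Vect m = Fin m → K

  infix 4 _≈_
  _≈_ : Mat m n → Mat m n → Set
  A ≈ B = ∀ i j → A i j ≡ B i j

  infixl 7 _∙_ _▸_
  infixl 6 _⊝_

  _∙_ : Mat k m → Mat m n → Mat k n
  (A ∙ B) i k = sum (λ j → A i j * B j k)

  _▸_ : Mat m n → Vect n → Vect m
  (A ▸ v) i = sum (λ j → A i j * v j)

  _⊝_ : Mat m n → Mat m n → Mat m n
  (A ⊝ B) i j = A i j - B i j

  δ : Mat n n
  δ i j = if does (i Fin.≟ j) then 1# else 0#

  dot : Vect n → Vect n → K
  dot v w = sum (λ i → v i * w i)

  δ-refl : ∀ (i : Fin n) → δ i i ≡ 1#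
  δ-refl i with i Fin.≟ i
  ... | yes _  = refl
  ... | no i≢i = contradiction refl i≢i

  δ-≢ : ∀ {i j : Fin n} → i ≢ j → δ i j ≡ 0#
  δ-≢ {i = i} {j} i≢j with i Fin.≟ j
  ... | yes i≡j = contradiction i≡j i≢j
  ... | no _    = refl

  δ-sym : ∀ (i j : Fin n) → δ i j ≡ δ j i
  δ-sym i j with i Fin.≟ j
  ... | yes refl = sym (δ-refl i)
  ... | no i≢j   = sym (δ-≢ (i≢j ∘ sym))

  sum-0 : {f : Vect n} → (∀ i → f i ≡ 0#) → sum f ≡ 0#
  sum-0 {n} p = trans (sum-cong-≗ p) (sum-replicate-zero n)

  sum-δˡ : ∀ (i : Fin n) (f : Vect n) → sum (λ j → δ i j * f j) ≡ f i
  sum-δˡ zero    f = trans (cong₂ _+_ (*-identityˡ _) (sum-0 λ j → zeroˡ (f (suc j)))) (+-identityʳ _)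
  sum-δˡ (suc i) f = trans (cong₂ _+_ (zeroˡ _) (sum-δˡ i (f ∘ suc))) (+-identityˡ _)

  sum-δʳ : ∀ (i : Fin n) (f : Vect n) → sum (λ j → f j * δ j i) ≡ f i
  sum-δʳ i f = trans (sum-cong-≗ λ j → trans (*-comm (f j) (δ j i)) (*-congʳ (δ-sym j i))) (sum-δˡ i f)

  sum-split : ∀ k {l} (f : Vect (k ℕ.+ l)) → sum f ≡ sum (λ i → f (i ↑ˡ l)) + sum (λ j → f (k ↑ʳ j))
  sum-split zero    f = sym (+-identityˡ _)
  sum-split (suc k) f = trans (+-congˡ (sum-split k (f ∘ suc))) (solve 3 (λ a b c → a :+ (b :+ c) := (a :+ b) :+ c) refl _ _ _)

  sum-neg : ∀ (f : Vect n) → sum (λ i → - f i) ≡ - sum f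
  sum-neg {zero}  f = sym -0#≈0#
  sum-neg {suc n} f = trans (+-congˡ (sum-neg (f ∘ suc))) (solve 2 (λ a b → :- a :+ :- b := :- (a :+ b)) refl _ _)

  sum-- : ∀ (f g : Vect n) → sum (λ i → f i - g i) ≡ sum f - sum g
  sum-- f g = trans (∑-distrib-+ f (λ i → - g i)) (+-congˡ (sum-neg g))

  ∙-cong : {A A′ : Mat k m} {B B′ : Mat m n} → A ≈ A′ → B ≈ B′ → A ∙ B ≈ A′ ∙ B′
  ∙-cong p q i k = sum-cong-≗ (λ j → cong₂ _*_ (p i j) (q j k))

  ∙-congˡ : (A : Mat k m) {B B′ : Mat m n} → B ≈ B′ → A ∙ B ≈ A ∙ B′
  ∙-congˡ A = ∙-cong {A = A} (λ _ _ → refl)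

  ∙-congʳ : {A A′ : Mat k m} (B : Mat m n) → A ≈ A′ → A ∙ B ≈ A′ ∙ B
  ∙-congʳ B p = ∙-cong {B = B} p (λ _ _ → refl)

  ∙-assoc : (A : Mat k l) (B : Mat l m) (C : Mat m n) → (A ∙ B) ∙ C ≈ A ∙ (B ∙ C)
  ∙-assoc A B C i k = begin
    sum (λ j → sum (λ a → A i a * B a j) * C j k)    ≡⟨ sum-cong-≗ (λ j → *-distribʳ-sum (C j k) (λ a → A i a * B a j)) ⟩
    sum (λ j → sum (λ a → A i a * B a j * C j k))    ≡⟨ ∑-comm (λ j a → A i a * B a j * C j k) ⟩
    sum (λ a → sum (λ j → A i a * B a j * C j k))    ≡⟨ sum-cong-≗ (λ a → sum-cong-≗ (λ j → *-assoc (A i a) (B a j) (C j k))) ⟩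
    sum (λ a → sum (λ j → A i a * (B a j * C j k)))  ≡⟨ sum-cong-≗ (λ a → *-distribˡ-sum (A i a) (λ j → B a j * C j k)) ⟨
    sum (λ a → A i a * sum (λ j → B a j * C j k))    ∎
    where open ≡-Reasoning

  ∙-identityˡ : (A : Mat m n) → δ ∙ A ≈ A
  ∙-identityˡ A i j = sum-δˡ i (λ k → A k j)

  ∙-identityʳ : (A : Mat m n) → A ∙ δ ≈ A
  ∙-identityʳ A i j = sum-δʳ j (A i)

  ∙-distribˡ-⊝ : (A : Mat k m) (B C : Mat m n) → A ∙ (B ⊝ C) ≈ A ∙ B ⊝ A ∙ C
  ∙-distribˡ-⊝ A B C i k =
    trans (sum-cong-≗ λ j → solve 3 (λ a b c → a :* (b :- c) := a :* b :- a :* c) refl (A i j) (B j k) (C j k))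
    (sum-- (λ j → A i j * B j k) (λ j → A i j * C j k))

  ∙-distribʳ-⊝ : (A B : Mat k m) (C : Mat m n) → (A ⊝ B) ∙ C ≈ A ∙ C ⊝ B ∙ C
  ∙-distribʳ-⊝ A B C i k =
    trans (sum-cong-≗ λ j → solve 3 (λ a b c → (a :- b) :* c := a :* c :- b :* c) refl (A i j) (B i j) (C j k))
    (sum-- (λ j → A i j * C j k) (λ j → B i j * C j k))

  ▸-cong : (A : Mat m n) {v w : Vect n} → v ≗ w → A ▸ v ≗ A ▸ w
  ▸-cong A p i = sum-cong-≗ (λ j → *-congˡ (p j))

  -- Here and below a vector is read as a matrix with one column or one row, indexed by `Fin 1`, so
  -- that identities between matrices apply to it.
  ∙-▸ : (A : Mat k m) (B : Mat m n) (v : Vect n) → (A ∙ B) ▸ v ≗ A ▸ (B ▸ v)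
  ∙-▸ A B v i = ∙-assoc A B (λ j (_ : Fin 1) → v j) i zero

  ▸-identityˡ : (v : Vect n) → δ ▸ v ≗ v
  ▸-identityˡ v i = sum-δˡ i v

  ▸-+ : (A : Mat m n) (v w : Vect n) → A ▸ (λ i → v i + w i) ≗ λ i → (A ▸ v) i + (A ▸ w) i
  ▸-+ A v w i = trans (sum-cong-≗ λ j → distribˡ (A i j) (v j) (w j)) (∑-distrib-+ (λ j → A i j * v j) (λ j → A i j * w j))

  ▸-- : (A : Mat m n) (v w : Vect n) → A ▸ (λ i → v i - w i) ≗ λ i → (A ▸ v) i - (A ▸ w) i
  ▸-- A v w i = ∙-distribˡ-⊝ A (λ j (_ : Fin 1) → v j) (λ j _ → w j) i zero

  ⊝-▸ : (A B : Mat m n) (v : Vect n) → (A ⊝ B) ▸ v ≗ λ i → (A ▸ v) i - (B ▸ v) i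
  ⊝-▸ A B v i = ∙-distribʳ-⊝ A B (λ j (_ : Fin 1) → v j) i zero

  ▸-0 : (A : Mat m n) {v : Vect n} → (∀ i → v i ≡ 0#) → ∀ i → (A ▸ v) i ≡ 0#
  ▸-0 A p i = sum-0 (λ j → trans (*-congˡ (p j)) (zeroʳ _))

  tr : Mat n n → K
  tr A = sum (λ i → A i i)

  tr-cong : {A B : Mat n n} → A ≈ B → tr A ≡ tr B
  tr-cong p = sum-cong-≗ (λ i → p i i)

  tr-∙-comm : (A : Mat m n) (B : Mat n m) → tr (A ∙ B) ≡ tr (B ∙ A)
  tr-∙-comm A B = trans (∑-comm (λ i j → A i j * B j i)) (sum-cong-≗ λ j → sum-cong-≗ λ i → *-comm (A i j) (B j i))

  infixr 8 _^ᴹ_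
  _^ᴹ_ : Mat n n → ℕ → Mat n n
  M ^ᴹ zero  = δ
  M ^ᴹ suc n = M ^ᴹ n ∙ M

  ^ᴹ-suc : ∀ (M : Mat m m) n → M ^ᴹ suc n ≈ M ∙ M ^ᴹ n
  ^ᴹ-suc M zero    i j = trans (∙-identityˡ M i j) (sym (∙-identityʳ M i j))
  ^ᴹ-suc M (suc n) i j = trans (∙-congʳ M (^ᴹ-suc M n) i j) (∙-assoc M (M ^ᴹ n) M i j)

  traces : Mat m m → Series
  traces M n = tr (M ^ᴹ n)

  -- The columns of x generate the cokernel of 1 - M.
  IsGeneratedBy : Mat m m → Mat m k → Set
  IsGeneratedBy M x = ∀ (v : Vect _) → ∃₂ λ (c : Vect _) (w : Vect _) → ∀ i → v i ≡ (x ▸ c) i + (w i - (M ▸ w) i)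

  IsGenerated : Mat m m → ℕ → Set
  IsGenerated {m} M g = ∃ λ (x : Mat m g) → IsGeneratedBy M x

  -- If A is the action induced by M on the image of p, the action of M on the kernel of p
  -- is represented by M ∙ e, where e is the projector onto this kernel along the image of s.
  module Quotient (M : Mat m m) (A : Mat k k) (p : Mat k m) (s : Mat m k) (ps≈δ : p ∙ s ≈ δ) (pM≈Ap : p ∙ M ≈ A ∙ p) where

    e B : Mat m m
    e = δ ⊝ s ∙ p
    B = M ∙ e

    private
      open ≡-Reasoning

      pe≈0 : ∀ i j → (p ∙ e) i j ≡ 0#
      pe≈0 i j = begin
        (p ∙ e) i j                      ≡⟨ ∙-distribˡ-⊝ p δ (s ∙ p) i j ⟩
        (p ∙ δ) i j - (p ∙ (s ∙ p)) i j
          ≡⟨ cong₂ _-_ (∙-identityʳ p i j) (trans (sym (∙-assoc p s p i j)) (trans (∙-congʳ p ps≈δ i j) (∙-identityˡ p i j))) ⟩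
        p i j - p i j                    ≡⟨ -‿inverseʳ _ ⟩
        0#                               ∎

      e∙ : ∀ {n} (C : Mat m n) → (∀ i j → (p ∙ C) i j ≡ 0#) → e ∙ C ≈ C
      e∙ C pC≈0 i j = begin
        (e ∙ C) i j                        ≡⟨ ∙-distribʳ-⊝ δ (s ∙ p) C i j ⟩
        (δ ∙ C) i j - ((s ∙ p) ∙ C) i j
          ≡⟨ cong₂ _-_ (∙-identityˡ C i j) (trans (∙-assoc s p C i j) (▸-0 s (λ k → pC≈0 k j) i)) ⟩
        C i j - 0#                         ≡⟨ trans (+-congˡ -0#≈0#) (+-identityʳ _) ⟩
        C i j                              ∎

      -- The kernel of p is stable under M: p M e = A p e = 0, and e fixes whatever p kills.
      eMe≈Me : e ∙ (M ∙ e) ≈ M ∙ e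
      eMe≈Me = e∙ (M ∙ e) λ i j → begin
        (p ∙ (M ∙ e)) i j    ≡⟨ ∙-assoc p M e i j ⟨
        ((p ∙ M) ∙ e) i j    ≡⟨ ∙-congʳ e pM≈Ap i j ⟩
        ((A ∙ p) ∙ e) i j    ≡⟨ ∙-assoc A p e i j ⟩
        (A ∙ (p ∙ e)) i j    ≡⟨ ▸-0 A (λ k → pe≈0 k j) i ⟩
        0#                   ∎

      -- Each inner factor e is absorbed by `eMe≈Me`. Exponent 0 is excluded, as `B ^ᴹ 0` is the
      -- identity and not e; hence `traces-+` starts at exponent 1.
      B^≈M^e : ∀ n → B ^ᴹ suc n ≈ M ^ᴹ suc n ∙ e
      B^≈M^e zero    i j = trans (∙-identityˡ B i j) (sym (∙-congʳ e (∙-identityˡ M) i j))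
      B^≈M^e (suc n) i j = begin
        (B ^ᴹ suc n ∙ B) i j                  ≡⟨ ∙-congʳ B (B^≈M^e n) i j ⟩
        ((M ^ᴹ suc n ∙ e) ∙ (M ∙ e)) i j      ≡⟨ ∙-assoc (M ^ᴹ suc n) e (M ∙ e) i j ⟩
        (M ^ᴹ suc n ∙ (e ∙ (M ∙ e))) i j      ≡⟨ ∙-congˡ (M ^ᴹ suc n) eMe≈Me i j ⟩
        (M ^ᴹ suc n ∙ (M ∙ e)) i j            ≡⟨ ∙-assoc (M ^ᴹ suc n) M e i j ⟨
        (M ^ᴹ suc (suc n) ∙ e) i j            ∎

      pM^≈A^p : ∀ n → p ∙ M ^ᴹ n ≈ A ^ᴹ n ∙ p
      pM^≈A^p zero    i j = trans (∙-identityʳ p i j) (sym (∙-identityˡ p i j))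
      pM^≈A^p (suc n) i j = begin
        (p ∙ (M ^ᴹ n ∙ M)) i j    ≡⟨ ∙-assoc p (M ^ᴹ n) M i j ⟨
        ((p ∙ M ^ᴹ n) ∙ M) i j    ≡⟨ ∙-congʳ M (pM^≈A^p n) i j ⟩
        ((A ^ᴹ n ∙ p) ∙ M) i j    ≡⟨ ∙-assoc (A ^ᴹ n) p M i j ⟩
        (A ^ᴹ n ∙ (p ∙ M)) i j    ≡⟨ ∙-congˡ (A ^ᴹ n) pM≈Ap i j ⟩
        (A ^ᴹ n ∙ (A ∙ p)) i j    ≡⟨ ∙-assoc (A ^ᴹ n) A p i j ⟨
        (A ^ᴹ suc n ∙ p) i j      ∎

    -- Split the identity as s p + e. For positive n cyclicity gives tr (Mⁿ s p) = tr (p Mⁿ s) = tr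
    -- (Aⁿ p s) = tr Aⁿ, while Mⁿ e = Bⁿ.
    traces-+ : ∀ n → traces M (suc n) ≡ traces A (suc n) + traces B (suc n)
    traces-+ n = begin
      tr M′                                  ≡⟨ solve 2 (λ a b → a := b :+ (a :- b)) refl (tr M′) (tr (M′ ∙ (s ∙ p))) ⟩
      tr (M′ ∙ (s ∙ p)) + (tr M′ - tr (M′ ∙ (s ∙ p))) ≡⟨ cong₂ _+_ tr-sp tr-e ⟩
      tr (A ^ᴹ suc n) + tr (B ^ᴹ suc n)      ∎
      where
      M′ = M ^ᴹ suc n
      tr-sp : tr (M′ ∙ (s ∙ p)) ≡ tr (A ^ᴹ suc n)
      tr-sp = begin
        tr (M′ ∙ (s ∙ p))            ≡⟨ tr-cong (λ i j → sym (∙-assoc M′ s p i j)) ⟩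
        tr ((M′ ∙ s) ∙ p)            ≡⟨ tr-∙-comm (M′ ∙ s) p ⟩
        tr (p ∙ (M′ ∙ s))            ≡⟨ tr-cong (λ i j → sym (∙-assoc p M′ s i j)) ⟩
        tr ((p ∙ M′) ∙ s)            ≡⟨ tr-cong (∙-congʳ s (pM^≈A^p (suc n))) ⟩
        tr ((A ^ᴹ suc n ∙ p) ∙ s)    ≡⟨ tr-cong (∙-assoc (A ^ᴹ suc n) p s) ⟩
        tr (A ^ᴹ suc n ∙ (p ∙ s))    ≡⟨ tr-cong (∙-congˡ (A ^ᴹ suc n) ps≈δ) ⟩
        tr (A ^ᴹ suc n ∙ δ)          ≡⟨ tr-cong (∙-identityʳ (A ^ᴹ suc n)) ⟩
        tr (A ^ᴹ suc n)              ∎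
      tr-e : tr M′ - tr (M′ ∙ (s ∙ p)) ≡ tr (B ^ᴹ suc n)
      tr-e = begin
        tr M′ - tr (M′ ∙ (s ∙ p))          ≡⟨ cong (_- tr (M′ ∙ (s ∙ p))) (tr-cong (λ i j → sym (∙-identityʳ M′ i j))) ⟩
        tr (M′ ∙ δ) - tr (M′ ∙ (s ∙ p))    ≡⟨ sum-- (λ i → (M′ ∙ δ) i i) (λ i → (M′ ∙ (s ∙ p)) i i) ⟨
        tr (M′ ∙ δ ⊝ M′ ∙ (s ∙ p))         ≡⟨ tr-cong (λ i j → sym (∙-distribˡ-⊝ M′ δ (s ∙ p) i j)) ⟩
        tr (M′ ∙ e)                        ≡⟨ tr-cong (λ i j → sym (B^≈M^e n i j)) ⟩
        tr (B ^ᴹ suc n)                    ∎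

    hasMultiplicity-+ : ∀ {a b} → HasMultiplicity (traces A) a → HasMultiplicity (traces B) b → HasMultiplicity (traces M) (a + b)
    hasMultiplicity-+ p q = hasMultiplicity-cong (1 , λ { {suc n} _ → sym (traces-+ n) }) (hasMultiplicity-⊕ p q)

    -- Generators for A are lifted by s, those for B are projected by e. Subtracting from v the lift
    -- of a decomposition of p v leaves v′ in the kernel of p, where B takes over.
    isGenerated-+ : ∀ {a b} → IsGenerated A a → IsGenerated B b → IsGenerated M (a ℕ.+ b)
    isGenerated-+ {a} {b} (x , genA) (y , genB) = z , gen
      where
      z : Mat m (a ℕ.+ b)
      z i = (s ∙ x) i ⧺ (e ∙ y) i
      z-▸ : ∀ c d i → (z ▸ (c ⧺ d)) i ≡ ((s ∙ x) ▸ c) i + ((e ∙ y) ▸ d) i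
      z-▸ c d i = trans (sum-split a (λ j → z i j * (c ⧺ d) j)) (cong₂ _+_
        (sum-cong-≗ λ j → cong₂ _*_ (lookup-++ˡ ((s ∙ x) i) ((e ∙ y) i) j) (lookup-++ˡ c d j))
        (sum-cong-≗ λ j → cong₂ _*_ (lookup-++ʳ ((s ∙ x) i) ((e ∙ y) i) j) (lookup-++ʳ c d j)))
      gen : IsGeneratedBy M z
      gen v with c , w , pv≡ ← genA (p ▸ v)
        with d , t , v′≡ ← genB (λ i → (v i - (s ▸ (x ▸ c)) i) - ((s ▸ w) i - (M ▸ (s ▸ w)) i))
        = c ⧺ d , (λ i → (s ▸ w) i + (e ▸ t) i) , λ i → begin
          v i
            ≡⟨ solve 3 (λ v a b → v := (a :+ b) :+ ((v :- a) :- b)) refl (v i) ((s ▸ (x ▸ c)) i) ((s ▸ w) i - (M ▸ (s ▸ w)) i) ⟩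
          ((s ▸ (x ▸ c)) i + ((s ▸ w) i - (M ▸ (s ▸ w)) i)) + v′ i
            ≡⟨ +-congˡ (trans (sym (ev′≡v′ i)) (ev′≡ i)) ⟩
          ((s ▸ (x ▸ c)) i + ((s ▸ w) i - (M ▸ (s ▸ w)) i)) + (((e ∙ y) ▸ d) i + ((e ▸ t) i - (M ▸ (e ▸ t)) i))
            ≡⟨ solve 6 (λ a b c d e f → (a :+ (b :- c)) :+ (d :+ (e :- f)) := (a :+ d) :+ ((b :+ e) :- (c :+ f))) refl _ _ _ _ _ _ ⟩
          ((s ▸ (x ▸ c)) i + ((e ∙ y) ▸ d) i) + (((s ▸ w) i + (e ▸ t) i) - ((M ▸ (s ▸ w)) i + (M ▸ (e ▸ t)) i))
            ≡⟨ cong₂ (λ a b → (a + ((e ∙ y) ▸ d) i) + (((s ▸ w) i + (e ▸ t) i) - b)) (sym (∙-▸ s x c i)) (sym (▸-+ M (s ▸ w) (e ▸ t) i)) ⟩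
          (((s ∙ x) ▸ c) i + ((e ∙ y) ▸ d) i) + (((s ▸ w) i + (e ▸ t) i) - (M ▸ (λ i → (s ▸ w) i + (e ▸ t) i)) i)
            ≡⟨ +-congʳ (sym (z-▸ c d i)) ⟩
          (z ▸ (c ⧺ d)) i + (((s ▸ w) i + (e ▸ t) i) - (M ▸ (λ i → (s ▸ w) i + (e ▸ t) i)) i) ∎
        where
        v′ : Vect m
        v′ i = (v i - (s ▸ (x ▸ c)) i) - ((s ▸ w) i - (M ▸ (s ▸ w)) i)
        ps▸ : ∀ (c : Vect k) i → (p ▸ (s ▸ c)) i ≡ c i
        ps▸ c i = trans (sym (∙-▸ p s c i)) (trans (∙-congʳ (λ j (_ : Fin 1) → c j) ps≈δ i zero) (▸-identityˡ c i))
        pM▸ : ∀ v i → (p ▸ (M ▸ v)) i ≡ (A ▸ (p ▸ v)) i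
        pM▸ v i = trans (sym (∙-▸ p M v i)) (trans (∙-congʳ (λ j (_ : Fin 1) → v j) pM≈Ap i zero) (∙-▸ A p v i))
        pv′≡0 : ∀ i → (p ▸ v′) i ≡ 0#
        pv′≡0 i = begin
          (p ▸ v′) i
            ≡⟨ trans (▸-- p (λ i → v i - (s ▸ (x ▸ c)) i) (λ i → (s ▸ w) i - (M ▸ (s ▸ w)) i) i)
                 (cong₂ _-_ (▸-- p v (s ▸ (x ▸ c)) i) (▸-- p (s ▸ w) (M ▸ (s ▸ w)) i)) ⟩
          ((p ▸ v) i - (p ▸ (s ▸ (x ▸ c))) i) - ((p ▸ (s ▸ w)) i - (p ▸ (M ▸ (s ▸ w))) i)
            ≡⟨ cong₂ _-_ (cong₂ _-_ (pv≡ i) (ps▸ (x ▸ c) i)) (cong₂ _-_ (ps▸ w i) (trans (pM▸ (s ▸ w) i) (▸-cong A (ps▸ w) i))) ⟩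
          (((x ▸ c) i + (w i - (A ▸ w) i)) - (x ▸ c) i) - (w i - (A ▸ w) i)
            ≡⟨ solve 2 (λ a b → ((a :+ b) :- a) :- b := con (ℤ.+ 0)) refl ((x ▸ c) i) (w i - (A ▸ w) i) ⟩
          ι (ℤ.+ 0) ≡⟨ ι-0 ⟩
          0# ∎
        ev′≡v′ : ∀ i → (e ▸ v′) i ≡ v′ i
        ev′≡v′ i = e∙ (λ i (_ : Fin 1) → v′ i) (λ i _ → pv′≡0 i) i zero
        -- Since e B = M e, applying e to the decomposition of v′ turns t - B t into e t - M (e t),
        -- which lies in the image of 1 - M.
        ev′≡ : ∀ i → (e ▸ v′) i ≡ ((e ∙ y) ▸ d) i + ((e ▸ t) i - (M ▸ (e ▸ t)) i)
        ev′≡ i = begin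
          (e ▸ v′) i                                                   ≡⟨ ▸-cong e v′≡ i ⟩
          (e ▸ (λ i → (y ▸ d) i + (t i - (B ▸ t) i))) i                ≡⟨ ▸-+ e (y ▸ d) (λ i → t i - (B ▸ t) i) i ⟩
          (e ▸ (y ▸ d)) i + (e ▸ (λ i → t i - (B ▸ t) i)) i            ≡⟨ cong₂ _+_ (sym (∙-▸ e y d i)) (▸-- e t (B ▸ t) i) ⟩
          ((e ∙ y) ▸ d) i + ((e ▸ t) i - (e ▸ (B ▸ t)) i)              ≡⟨ +-congˡ (cong (λ x → (e ▸ t) i - x)
            (trans (sym (∙-▸ e B t i)) (trans (∙-congʳ (λ j (_ : Fin 1) → t j) eMe≈Me i zero) (∙-▸ M e t i)))) ⟩
          ((e ∙ y) ▸ d) i + ((e ▸ t) i - (M ▸ (e ▸ t)) i)              ∎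

  -- The Fredholm alternative and linear dependence over a field

  choose : ∀ {n} {P Q : Fin n → Set} → (∀ i → P i ⊎ Q i) → (∀ i → P i) ⊎ ∃ Q
  choose {zero}          f = inj₁ λ ()
  choose {suc n} {P} {Q} f with f zero | choose {n} {P ∘ suc} {Q ∘ suc} (f ∘ suc)
  ... | inj₂ q | _            = inj₂ (zero , q)
  ... | inj₁ p | inj₁ ps      = inj₁ λ { zero → p ; (suc i) → ps i }
  ... | inj₁ p | inj₂ (i , q) = inj₂ (suc i , q)

  x-0≡x : ∀ x → x - 0# ≡ x
  x-0≡x x = trans (+-congˡ -0#≈0#) (+-identityʳ x)

  Solvable : Mat m n → Vect m → Set
  Solvable N v = ∃ λ w → v ≗ N ▸ w

  -- A linear functional that separates v from the column space of N, normalised to the value 1 on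
  -- v.
  Obstructed : Mat m n → Vect m → Set
  Obstructed {m} N v = ∃ λ (ℓ : Vect m) → (∀ j → dot ℓ (λ i → N i j) ≡ 0#) × dot ℓ v ≡ 1#

  dot-+* : ∀ (ℓ v n : Vect m) a → dot ℓ (λ i → v i + a * n i) ≡ dot ℓ v + a * dot ℓ n
  dot-+* ℓ v n a =
    trans (sum-cong-≗ λ i → solve 4 (λ l v a n → l :* (v :+ a :* n) := l :* v :+ a :* (l :* n)) refl (ℓ i) (v i) a (n i))
    (trans (∑-distrib-+ (λ i → ℓ i * v i) (λ i → a * (ℓ i * n i))) (+-congˡ (sym (*-distribˡ-sum a (λ i → ℓ i * n i)))))

  dot-comm : ∀ (v w : Vect m) → dot v w ≡ dot w v
  dot-comm v w = sum-cong-≗ λ i → *-comm (v i) (w i)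

  alternative : ∀ n (N : Mat m n) v → Solvable N v ⊎ Obstructed N v
  alternative zero    N v with choose {P = λ i → v i ≡ 0#} {Q = λ i → v i ≢ 0#} (λ i → dec (v i ≟ 0#))
    where
    dec : ∀ {A : Set} → Dec A → A ⊎ ¬ A
    dec (yes p) = inj₁ p
    dec (no ¬p) = inj₂ ¬p
  ... | inj₁ v≡0 = inj₁ ((λ ()) , v≡0)
  ... | inj₂ (i , vᵢ≢0) with a , vᵢa≡1 ← inverse (v i) vᵢ≢0 =
    inj₂ ((λ j → δ i j * a) , (λ ()) ,
      trans (sum-cong-≗ (λ j → *-assoc (δ i j) a (v j))) (trans (sum-δˡ i (λ j → a * v j)) (trans (*-comm a (v i)) vᵢa≡1)))
  alternative (suc n) N v with alternative n (λ i j → N i (suc j)) (λ i → N i zero)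
  ... | inj₁ (w , N₀≡) with alternative n (λ i j → N i (suc j)) v
  ...   | inj₁ (w′ , v≡) = inj₁ ((λ { zero → 0# ; (suc j) → w′ j }) ,
            λ i → trans (v≡ i) (sym (trans (+-congʳ (zeroʳ _)) (+-identityˡ _))))
  ...   | inj₂ (ℓ , ℓN , ℓv) = inj₂ (ℓ , (λ { zero → ℓN₀ ; (suc j) → ℓN j }) , ℓv)
    where
    N′ = λ i j → N i (suc j)
    ℓN₀ : dot ℓ (λ i → N i zero) ≡ 0#
    ℓN₀ = trans (sum-cong-≗ λ i → *-congˡ (N₀≡ i))
      (trans (sym (∙-▸ (λ (_ : Fin 1) → ℓ) N′ w zero)) (sum-0 λ j → trans (*-congʳ (ℓN j)) (zeroˡ _)))
  -- Now ℓ kills the other columns and is 1 on N₀, so the coefficient of N₀ in v can only be ℓ · v;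
  -- the remainder has to come from the other columns.
  alternative (suc n) N v | inj₂ (ℓ , ℓN , ℓN₀)
    with alternative n (λ i j → N i (suc j)) (λ i → v i + - dot ℓ v * N i zero)
  ... | inj₁ (w , v≡) = inj₁ ((λ { zero → dot ℓ v ; (suc j) → w j }) , λ i →
          trans (solve 3 (λ v a n → v := n :* a :+ (v :+ :- a :* n)) refl (v i) (dot ℓ v) (N i zero)) (+-congˡ (v≡ i)))
  ... | inj₂ (ℓ′ , ℓ′N , ℓ′v) = inj₂ (ℓ″ , (λ { zero → ℓ″N₀ ; (suc j) → ℓ″N j }) , ℓ″v)
    where
    a = dot ℓ′ (λ i → N i zero)
    -- The multiple of ℓ is chosen to kill N₀ as well; on v the result takes the value of ℓ′ on the
    -- remainder, which is 1.
    ℓ″ = λ i → ℓ′ i + - a * ℓ i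
    ℓ″▸ : ∀ w → dot ℓ″ w ≡ dot ℓ′ w + - a * dot ℓ w
    ℓ″▸ w = trans (dot-comm ℓ″ w) (trans (dot-+* w ℓ′ ℓ (- a)) (cong₂ (λ x y → x + - a * y) (dot-comm w ℓ′) (dot-comm w ℓ)))
    ℓ″N₀ : dot ℓ″ (λ i → N i zero) ≡ 0#
    ℓ″N₀ = trans (ℓ″▸ _) (trans (+-congˡ (trans (*-congˡ ℓN₀) (*-identityʳ _))) (-‿inverseʳ a))
    ℓ″N : ∀ j → dot ℓ″ (λ i → N i (suc j)) ≡ 0#
    ℓ″N j = trans (ℓ″▸ _) (trans (cong₂ (λ x y → x + - a * y) (ℓ′N j) (ℓN j)) (trans (+-congˡ (zeroʳ _)) (+-identityʳ _)))
    ℓ″v : dot ℓ″ v ≡ 1#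
    ℓ″v = trans (ℓ″▸ v) (trans (solve 3 (λ x a y → x :+ :- a :* y := x :+ :- y :* a) refl (dot ℓ′ v) a (dot ℓ v))
      (trans (sym (dot-+* ℓ′ v (λ i → N i zero) (- dot ℓ v))) ℓ′v))

  -- Gaussian elimination on the first row. With or without a pivot, one row and one column are
  -- given up, so the columns remain in the majority.
  dependence : ∀ n m → n < m → (C : Mat n m) → ∃ λ c → (∃ λ i → c i ≢ 0#) × (∀ j → (C ▸ c) j ≡ 0#)
  dependence zero    (suc m) _         C = (λ _ → 1#) , (zero , 1≢0) , λ ()
  dependence (suc n) (suc m) (s≤s n<m) C with any? (λ i → ¬? (C zero i ≟ 0#))
  ... | no ¬p with c , (i , cᵢ≢0) , Cc≡0 ← dependence n m n<m (λ j i → C (suc j) (suc i)) =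
    c′ , (suc i , cᵢ≢0) , λ
      { zero    → sum-0 λ i → trans (*-congʳ (C₀≡0 i)) (zeroˡ (c′ i))
      ; (suc j) → trans (+-congʳ (zeroʳ _)) (trans (+-identityˡ _) (Cc≡0 j)) }
    where
    c′ : Vect (suc m)
    c′ zero    = 0#
    c′ (suc i) = c i
    C₀≡0 : ∀ i → C zero i ≡ 0#
    C₀≡0 i with C zero i ≟ 0#
    ... | yes p = p
    ... | no ≢0 = contradiction (i , ≢0) ¬p
  ... | yes (i , C₀ᵢ≢0) with a , C₀ᵢa≡1 ← inverse (C zero i) C₀ᵢ≢0
    with c , (k , cₖ≢0) , Cc≡0 ← dependence n m n<m
      (λ j k → C (suc j) (punchIn i k) - C (suc j) i * (a * C zero (punchIn i k))) =
    c′ , (punchIn i k , λ eq → cₖ≢0 (trans (sym (c′-punchIn k)) eq)) , Cc′≡0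
    where
    -- The first row contributes r from the columns other than i. As a is the inverse of the pivot,
    -- the coefficient -(a r) in position i solves the first equation.
    r = sum (λ k → C zero (punchIn i k) * c k)
    c′ : Vect (suc m)
    c′ = Vector.insertAt c i (- (a * r))
    c′-punchIn : ∀ k → c′ (punchIn i k) ≡ c k
    c′-punchIn = insertAt-punchIn c i (- (a * r))
    expand : ∀ j → (C ▸ c′) j ≡ C j i * - (a * r) + sum (λ k → C j (punchIn i k) * c k)
    expand j = trans (sum-remove {i = i} (λ k → C j k * c′ k)) (cong₂ _+_ (*-congˡ (insertAt-lookup c i (- (a * r))))
      (sum-cong-≗ λ k → *-congˡ (c′-punchIn k)))
    Cc′≡0 : ∀ j → (C ▸ c′) j ≡ 0#
    Cc′≡0 zero    =
      trans (expand zero) (trans (solve 3 (λ c a r → c :* :- (a :* r) :+ r := (c :* a) :* :- r :+ r) refl (C zero i) a r)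
      (trans (+-congʳ (trans (*-congʳ C₀ᵢa≡1) (*-identityˡ _))) (trans (solve 1 (λ r → :- r :+ r := con (ℤ.+ 0)) refl r) ι-0)))
    Cc′≡0 (suc j) = begin
      (C ▸ c′) (suc j)                                                   ≡⟨ expand (suc j) ⟩
      b * - (a * r) + s
        ≡⟨ solve 4 (λ b a r s → b :* :- (a :* r) :+ s := s :- (b :* a) :* r) refl b a r s ⟩
      s - (b * a) * r
        ≡⟨ cong (λ x → s - x) (*-distribˡ-sum (b * a) (λ k → C zero (punchIn i k) * c k)) ⟩
      s - sum (λ k → (b * a) * (C zero (punchIn i k) * c k))
        ≡⟨ sum-- (λ k → C (suc j) (punchIn i k) * c k) (λ k → (b * a) * (C zero (punchIn i k) * c k)) ⟨
      sum (λ k → C (suc j) (punchIn i k) * c k - (b * a) * (C zero (punchIn i k) * c k))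
        ≡⟨ sum-cong-≗ (λ k → solve 5 (λ x c b a y → x :* c :- (b :* a) :* (y :* c) := (x :- b :* (a :* y)) :* c) refl
             (C (suc j) (punchIn i k)) (c k) b a (C zero (punchIn i k))) ⟩
      sum (λ k → (C (suc j) (punchIn i k) - b * (a * C zero (punchIn i k))) * c k) ≡⟨ Cc≡0 j ⟩
      0#                                                                 ∎
      where
      open ≡-Reasoning
      b = C (suc j) i
      s = sum (λ k → C (suc j) (punchIn i k) * c k)

  -- The coordinates of the columns of y form a matrix C with more columns than rows. For c in its
  -- kernel the generators drop out and y c = (1 - M) W c remains.
  isGenerated⇒dependent : {M : Mat m m} → IsGenerated M n → n < k → (y : Mat m k) →
    ∃₂ λ (c : Vect k) (w : Vect m) → (∃ λ i → c i ≢ 0#) × (∀ i → (y ▸ c) i ≡ w i - (M ▸ w) i)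
  isGenerated⇒dependent {m} {n} {k} {M} (x , gen) n<k y
    with c , c≢0 , Cc≡0 ← dependence n k n<k (λ j i → proj₁ (gen (λ a → y a i)) j) =
    c , (W ▸ c) , c≢0 , λ i → begin
      (y ▸ c) i                                       ≡⟨ sum-cong-≗ (λ j → *-congʳ (y≡ i j)) ⟩
      sum (λ j → ((x ∙ C) i j + (W ⊝ M ∙ W) i j) * c j) ≡⟨ sum-cong-≗ (λ j → distribʳ (c j) ((x ∙ C) i j) ((W ⊝ M ∙ W) i j)) ⟩
      sum (λ j → (x ∙ C) i j * c j + (W ⊝ M ∙ W) i j * c j)
        ≡⟨ ∑-distrib-+ (λ j → (x ∙ C) i j * c j) (λ j → (W ⊝ M ∙ W) i j * c j) ⟩
      ((x ∙ C) ▸ c) i + ((W ⊝ M ∙ W) ▸ c) i           ≡⟨ cong₂ _+_ (trans (∙-▸ x C c i) (▸-0 x Cc≡0 i)) (⊝-▸ W (M ∙ W) c i) ⟩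
      0# + ((W ▸ c) i - ((M ∙ W) ▸ c) i)              ≡⟨ +-identityˡ _ ⟩
      (W ▸ c) i - ((M ∙ W) ▸ c) i                     ≡⟨ cong (λ x → (W ▸ c) i - x) (∙-▸ M W c i) ⟩
      (W ▸ c) i - (M ▸ (W ▸ c)) i                     ∎
    where
    open ≡-Reasoning
    C : Mat n k
    C j i = proj₁ (gen (λ a → y a i)) j
    W : Mat m k
    W j i = proj₁ (proj₂ (gen (λ a → y a i))) j
    y≡ : ∀ i j → y i j ≡ (x ∙ C) i j + (W ⊝ M ∙ W) i j
    y≡ i j = proj₂ (proj₂ (gen (λ a → y a j))) i

  -- Independence modulo the image of 1 - M

  IsIndependentModulo : Mat m m → Mat m k → Set
  IsIndependentModulo {m} {k} M x = ∀ (c : Vect k) (w : Vect m) →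
    (∀ i → (x ▸ c) i ≡ w i - (M ▸ w) i) → ∀ i → c i ≡ 0#

  standard : (Fin k → Fin m) → Mat m k
  standard js i j = δ i (js j)

  -- If a standard vector lies outside the span of the chosen ones and the image of 1 - M, an
  -- obstruction ℓ kills both and is 1 on the new vector, which forces its coefficient in any
  -- relation to be 0. Standard vectors are used because they are integral and so give elements of
  -- the Bowen-Franks group.
  generatedOrExtendable : (M : Mat m m) (js : Fin k → Fin m) → IsIndependentModulo M (standard js) →
    IsGenerated M k ⊎ ∃ λ (js′ : Fin (suc k) → Fin m) → IsIndependentModulo M (standard js′)
  generatedOrExtendable {m} {k} M js independent
    with choose {P = λ j → Solvable N (λ i → δ i j)} {Q = λ j → Obstructed N (λ i → δ i j)} (λ j → alternative _ N (λ i → δ i j))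
    where
    N : Mat m (k ℕ.+ m)
    N i = standard js i ⧺ (δ ⊝ M) i
  ... | inj₁ solutions = inj₁ (standard js , λ v → (λ a → (R ▸ v) (a ↑ˡ m)) , (λ a → (R ▸ v) (k ↑ʳ a)) , λ i → begin
        v i                                      ≡⟨ ▸-identityˡ v i ⟨
        (δ ▸ v) i                                ≡⟨ sum-cong-≗ (λ j → *-congʳ (proj₂ (solutions j) i)) ⟩
        ((N ∙ R) ▸ v) i                          ≡⟨ ∙-▸ N R v i ⟩
        (N ▸ (R ▸ v)) i                          ≡⟨ sum-split k (λ a → N i a * (R ▸ v) a) ⟩
        sum (λ a → N i (a ↑ˡ m) * (R ▸ v) (a ↑ˡ m)) + sum (λ a → N i (k ↑ʳ a) * (R ▸ v) (k ↑ʳ a))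
          ≡⟨ cong₂ _+_ (sum-cong-≗ λ a → *-congʳ (lookup-++ˡ (standard js i) ((δ ⊝ M) i) a))
                       (sum-cong-≗ λ a → *-congʳ (lookup-++ʳ (standard js i) ((δ ⊝ M) i) a)) ⟩
        (standard js ▸ (λ a → (R ▸ v) (a ↑ˡ m))) i + ((δ ⊝ M) ▸ (λ a → (R ▸ v) (k ↑ʳ a))) i
          ≡⟨ +-congˡ (trans (⊝-▸ δ M (λ a → (R ▸ v) (k ↑ʳ a)) i) (+-congʳ (▸-identityˡ (λ a → (R ▸ v) (k ↑ʳ a)) i))) ⟩
        _ ∎)
    where
    open ≡-Reasoning
    N : Mat m (k ℕ.+ m)
    N i = standard js i ⧺ (δ ⊝ M) i
    R : Mat (k ℕ.+ m) m
    R a j = proj₁ (solutions j) a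
  ... | inj₂ (j , ℓ , ℓN , ℓj) = inj₂ (js′ , independent′)
    where
    open ≡-Reasoning
    N : Mat m (k ℕ.+ m)
    N i = standard js i ⧺ (δ ⊝ M) i
    js′ : Fin (suc k) → Fin m
    js′ zero    = j
    js′ (suc a) = js a
    ℓx : ∀ a → dot ℓ (λ i → standard js i a) ≡ 0#
    ℓx a = trans (sum-cong-≗ λ i → *-congˡ (sym (lookup-++ˡ (standard js i) ((δ ⊝ M) i) a))) (ℓN (a ↑ˡ m))
    ℓM : ∀ a → dot ℓ (λ i → (δ ⊝ M) i a) ≡ 0#
    ℓM a = trans (sum-cong-≗ λ i → *-congˡ (sym (lookup-++ʳ (standard js i) ((δ ⊝ M) i) a))) (ℓN (k ↑ʳ a))
    kills : ∀ {n} (N : Mat m n) → (∀ a → dot ℓ (λ i → N i a) ≡ 0#) → ∀ c → dot ℓ (N ▸ c) ≡ 0#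
    kills N ℓN c = trans (sym (∙-▸ (λ (_ : Fin 1) → ℓ) N c zero)) (sum-0 λ a → trans (*-congʳ (ℓN a)) (zeroˡ _))
    independent′ : IsIndependentModulo M (standard js′)
    independent′ c w eq = λ { zero → c₀≡0 ; (suc a) → independent (c ∘ suc) w (λ i → begin
        (standard js ▸ (c ∘ suc)) i                     ≡⟨ +-identityˡ _ ⟨
        0# + (standard js ▸ (c ∘ suc)) i                ≡⟨ +-congʳ (trans (*-congˡ c₀≡0) (zeroʳ _)) ⟨
        (standard js′ ▸ c) i                            ≡⟨ eq i ⟩
        w i - (M ▸ w) i                                 ∎) a }
      where
      c₀≡0 : c zero ≡ 0#
      c₀≡0 = begin
        c zero                                                          ≡⟨ trans (+-identityʳ _) (*-identityʳ _) ⟨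
        c zero * 1# + 0#
          ≡⟨ cong₂ (λ a b → c zero * a + b) ℓj (kills (standard js) ℓx (c ∘ suc)) ⟨
        c zero * dot ℓ (λ i → δ i j) + dot ℓ (standard js ▸ (c ∘ suc))  ≡⟨ solve 2 (λ a b → a :+ b := b :+ a) refl _ _ ⟩
        dot ℓ (standard js ▸ (c ∘ suc)) + c zero * dot ℓ (λ i → δ i j)
          ≡⟨ dot-+* ℓ (standard js ▸ (c ∘ suc)) (λ i → δ i j) (c zero) ⟨
        dot ℓ (λ i → (standard js ▸ (c ∘ suc)) i + c zero * δ i j)
          ≡⟨ sum-cong-≗ (λ i → *-congˡ (trans (solve 3 (λ a b c → a :+ b :* c := c :* b :+ a) refl ((standard js ▸ (c ∘ suc)) i) (c zero) (δ i j)) (eq i))) ⟩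
        dot ℓ (λ i → w i - (M ▸ w) i)
          ≡⟨ sum-cong-≗ (λ i → *-congˡ (trans (+-congʳ (sym (▸-identityˡ w i))) (sym (⊝-▸ δ M w i)))) ⟩
        dot ℓ ((δ ⊝ M) ▸ w)                                             ≡⟨ kills (δ ⊝ M) ℓM w ⟩
        0#                                                              ∎

  -- Greedy extension of the empty family cannot reach b + 1 vectors, and where it stops the family
  -- generates. The number f counts the extensions still allowed.
  isGenerated-bound : (M : Mat m m) → ∀ b → (∀ (js : Fin (suc b) → Fin m) → ¬ IsIndependentModulo M (standard js)) →
    ∃ λ g → g ≤ b × IsGenerated M g
  isGenerated-bound {m} M b dependent = go b 0 (ℕ.+-identityʳ b) (λ ()) (λ _ _ _ ())
    where
    go : ∀ f g → f ℕ.+ g ≡ b → (js : Fin g → Fin m) → IsIndependentModulo M (standard js) → ∃ λ g → g ≤ b × IsGenerated M g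
    go f g f+g≡b js independent with generatedOrExtendable M js independent
    ... | inj₁ gen = g , subst (g ≤_) f+g≡b (ℕ.m≤n+m g f) , gen
    go zero    g refl  js independent | inj₂ (js′ , independent′) = contradiction independent′ (dependent js′)
    go (suc f) g f+g≡b js independent | inj₂ (js′ , independent′) = go f (suc g) (trans (ℕ.+-suc f g) f+g≡b) js′ independent′

  -- The multiplicity of the eigenvalue 1

  hasMultiplicity-sum : (f : Fin m → Series) → (∀ i → HasMultiplicity (f i) 0#) → HasMultiplicity (λ n → sum (λ i → f i n)) 0#
  hasMultiplicity-sum {zero}  f mult = eventually⇒hasMultiplicity (0 , λ _ → refl)
  hasMultiplicity-sum {suc m} f mult = subst (HasMultiplicity _) (+-identityˡ 0#)
    (hasMultiplicity-⊕ (mult zero) (hasMultiplicity-sum (f ∘ suc) (mult ∘ suc)))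

  infix 4 _∼_
  _∼_ : Series → Series → Set
  f ∼ g = Eventually (f ⊕ ⊖ g) 0#

  ∼-⊛ : ∀ {q v f g} → HasValueAt1 q v → f ∼ g → q ⊛ f ∼ q ⊛ g
  ∼-⊛ {q} {v} {f} {g} val r = eventually-cong
    (solveₛ 3 (λ q f g → q ⊠ (f ⊹ ⊟ g) ⊜ q ⊠ f ⊹ ⊟ (q ⊠ g)) (λ _ → refl) q f g)
    (subst (Eventually _) (zeroʳ v) (val r))

  ∼-⊕ : ∀ {f g f′ g′} → f ∼ g → f′ ∼ g′ → f ⊕ f′ ∼ g ⊕ g′
  ∼-⊕ {f} {g} {f′} {g′} r s = eventually-cong
    (solveₛ 4 (λ f g f′ g′ → (f ⊹ ⊟ g) ⊹ (f′ ⊹ ⊟ g′) ⊜ (f ⊹ f′) ⊹ ⊟ (g ⊹ g′)) (λ _ → refl) f g f′ g′)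
    (subst (Eventually _) (+-identityˡ 0#) (eventually-⊕ r s))

  ∼-respˡ : ∀ {f g h} → f ≗ g → f ∼ h → g ∼ h
  ∼-respˡ p = eventually-cong (λ n → +-congʳ (p n))

  ∼-respʳ : ∀ {f g h} → g ≗ h → f ∼ g → f ∼ h
  ∼-respʳ p = eventually-cong (λ n → +-congˡ (cong -_ (p n)))

  ∼-trans : ∀ {f g h} → f ∼ g → g ∼ h → f ∼ h
  ∼-trans {f} {g} {h} r s = eventually-cong
    (solveₛ 3 (λ f g h → (f ⊹ ⊟ g) ⊹ (g ⊹ ⊟ h) ⊜ f ⊹ ⊟ h) (λ _ → refl) f g h)
    (subst (Eventually _) (+-identityˡ 0#) (eventually-⊕ r s))

  hasValueAt1-u^ : ∀ k → HasValueAt1 (u ^ k) 1#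
  hasValueAt1-u^ zero    = hasValueAt1-const 1#
  hasValueAt1-u^ (suc k) = subst (HasValueAt1 _) (*-identityˡ 1#) (hasValueAt1-⊛ {u} {u ^ k} hasValueAt1-u (hasValueAt1-u^ k))

  -- The induction step of `recurrence`, with d = u - 1 and p = uᵏ there. The two hypotheses chain
  -- to q d t ∼ u q t′ ∼ u p s, and c u p t is added on both sides.
  ∼-step : ∀ (c d p t t′ s q : Series) {v} → HasValueAt1 q v → d ⊛ t ∼ u ⊛ t′ → q ⊛ t′ ∼ p ⊛ s →
    (c ⊛ (u ⊛ p) ⊕ q ⊛ d) ⊛ t ∼ (u ⊛ p) ⊛ (c ⊛ t ⊕ s)
  ∼-step c d p t t′ s q {v} val dt∼ q∼ =
    ∼-respˡ {c ⊛ ((u ⊛ p) ⊛ t) ⊕ q ⊛ (d ⊛ t)} {h = (u ⊛ p) ⊛ (c ⊛ t ⊕ s)}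
      (solveₛ 5 (λ c p q d t → c ⊠ (p ⊠ t) ⊹ q ⊠ (d ⊠ t) ⊜ (c ⊠ p ⊹ q ⊠ d) ⊠ t) (λ _ → refl) c (u ⊛ p) q d t)
    (∼-respʳ {c ⊛ ((u ⊛ p) ⊛ t) ⊕ q ⊛ (d ⊛ t)} {c ⊛ ((u ⊛ p) ⊛ t) ⊕ u ⊛ (p ⊛ s)}
      (solveₛ 5 (λ c u p t s → c ⊠ ((u ⊠ p) ⊠ t) ⊹ u ⊠ (p ⊠ s) ⊜ (u ⊠ p) ⊠ (c ⊠ t ⊹ s)) (λ _ → refl) c u p t s)
    (∼-⊕ {c ⊛ ((u ⊛ p) ⊛ t)} {c ⊛ ((u ⊛ p) ⊛ t)} {q ⊛ (d ⊛ t)} {u ⊛ (p ⊛ s)}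
      (0 , λ _ → -‿inverseʳ _)
      (∼-trans {q ⊛ (d ⊛ t)} {q ⊛ (u ⊛ t′)} {u ⊛ (p ⊛ s)}
        (∼-⊛ {q} {v} {d ⊛ t} {u ⊛ t′} val dt∼)
        (∼-respˡ {u ⊛ (q ⊛ t′)} {h = u ⊛ (p ⊛ s)} (solveₛ 3 (λ u q t → u ⊠ (q ⊠ t) ⊜ q ⊠ (u ⊠ t)) (λ _ → refl) u q t′)
          (∼-⊛ {u} {1#} {q ⊛ t′} {p ⊛ s} hasValueAt1-u q∼)))))

  u∸1-⊛ : ∀ t n → (u∸1 ⊛ t) (suc n) ≡ t n - t (suc n)
  u∸1-⊛ t n = trans (solveₛ 3 (λ u i t → (u ⊹ ⊟ i) ⊠ t ⊜ u ⊠ t ⊹ ⊟ (i ⊠ t)) (λ _ → refl) u 𝟙 t (suc n))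
    (cong₂ _-_ (u-⊛ t n) (⊛-identityˡ t (suc n)))

  -- Row vectors under `D`, that is ℓ ↦ ℓ (1 - M). Then `poly c ℓ` is ℓ times the sum of cᵢ (1 -
  -- M)ⁱ, and `orbit j ℓ` is the j-th coordinate of ℓ Mⁿ. Expanding in 1 - M rather than in M makes
  -- c₀ the value of the polynomial at the eigenvalue 1.
  module Krylov (M : Mat m m) where

    D : Vect m → Vect m
    D ℓ j = ℓ j - dot ℓ (λ i → M i j)

    iterate : ℕ → Vect m → Vect m
    iterate zero    ℓ = ℓ
    iterate (suc n) ℓ = iterate n (D ℓ)

    poly : (Fin k → K) → Vect m → Vect m
    poly c ℓ j = sum (λ i → c i * iterate (toℕ i) ℓ j)

    orbit : Fin m → Vect m → Series
    orbit j ℓ n = dot ℓ (λ i → (M ^ᴹ n) i j)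

    iterate-D : ∀ n ℓ → iterate n (D ℓ) ≗ D (iterate n ℓ)
    iterate-D zero    ℓ j = refl
    iterate-D (suc n) ℓ j = iterate-D n (D ℓ) j

    D-poly : ∀ (c : Fin k → K) ℓ → D (poly c ℓ) ≗ poly c (D ℓ)
    D-poly c ℓ j = begin
      D (poly c ℓ) j
        ≡⟨ cong (λ x → poly c ℓ j - x) (∙-assoc (λ (_ : Fin 1) → c) (λ i → iterate (toℕ i) ℓ) M zero j) ⟩
      poly c ℓ j - sum (λ i → c i * dot (iterate (toℕ i) ℓ) (λ a → M a j))
        ≡⟨ sum-- (λ i → c i * iterate (toℕ i) ℓ j) (λ i → c i * dot (iterate (toℕ i) ℓ) (λ a → M a j)) ⟨
      sum (λ i → c i * iterate (toℕ i) ℓ j - c i * dot (iterate (toℕ i) ℓ) (λ a → M a j))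
        ≡⟨ sum-cong-≗ (λ i → trans (solve 3 (λ c x y → c :* x :- c :* y := c :* (x :- y)) refl (c i) (iterate (toℕ i) ℓ j) (dot (iterate (toℕ i) ℓ) (λ a → M a j)))
             (*-congˡ (sym (iterate-D (toℕ i) ℓ j)))) ⟩
      poly c (D ℓ) j                                                ∎
      where open ≡-Reasoning

    orbit-D : ∀ j ℓ n → orbit j (D ℓ) n ≡ orbit j ℓ n - orbit j ℓ (suc n)
    orbit-D j ℓ n = begin
      sum (λ a → (ℓ a - dot ℓ (λ i → M i a)) * (M ^ᴹ n) a j)
        ≡⟨ ∙-distribʳ-⊝ (λ (_ : Fin 1) → ℓ) ((λ (_ : Fin 1) → ℓ) ∙ M) (M ^ᴹ n) zero j ⟩
      orbit j ℓ n - sum (λ a → dot ℓ (λ i → M i a) * (M ^ᴹ n) a j)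
        ≡⟨ cong (λ x → orbit j ℓ n - x) (trans (∙-assoc (λ (_ : Fin 1) → ℓ) M (M ^ᴹ n) zero j) (∙-congˡ (λ (_ : Fin 1) → ℓ) (λ a b → sym (^ᴹ-suc M n a b)) zero j)) ⟩
      orbit j ℓ n - orbit j ℓ (suc n) ∎
      where open ≡-Reasoning

    orbit-linear : ∀ j ℓ ℓ′ a n → orbit j (λ i → ℓ i * a + ℓ′ i) n ≡ a * orbit j ℓ n + orbit j ℓ′ n
    orbit-linear j ℓ ℓ′ a n = trans (dot-comm (λ i → ℓ i * a + ℓ′ i) (λ i → (M ^ᴹ n) i j)) (trans
      (sum-cong-≗ λ i → *-congˡ (solve 3 (λ l a m → l :* a :+ m := m :+ a :* l) refl (ℓ i) a (ℓ′ i))) (trans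
      (dot-+* (λ i → (M ^ᴹ n) i j) ℓ′ ℓ a) (trans (cong₂ (λ x y → x + a * y) (dot-comm (λ i → (M ^ᴹ n) i j) ℓ′) (dot-comm (λ i → (M ^ᴹ n) i j) ℓ))
      (solve 2 (λ x y → x :+ y := y :+ x) refl _ _))))

    value : (Fin k → K) → K
    value {zero}  c = 0#
    value {suc k} c = c zero

    -- (u - 1) f is u times the difference sequence of f, up to the initial term.
    recurrence : ∀ j (c : Fin k → K) ℓ → ∃ λ q → ∃ λ v →
      HasValueAt1 q v × (v ≡ value c) × (q ⊛ orbit j ℓ ∼ u ^ k ⊛ orbit j (poly c ℓ))
    recurrence {zero}  j c ℓ = 𝟘 , 0# , hasValueAt1-cong (λ { zero → refl ; (suc n) → refl }) (hasValueAt1-const 0#) , refl ,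
      0 , λ {n} _ → trans (cong₂ _-_ (⊛-zeroˡ (orbit j ℓ) n) (trans (⊛-identityˡ (orbit j (poly c ℓ)) n) (sum-0 λ i → zeroˡ ((M ^ᴹ n) i j)))) (x-0≡x 0#)
    recurrence {suc k} j c ℓ with q , v , val , _ , q∼ ← recurrence j (c ∘ suc) (D ℓ) =
      -- Unfolded, the multiplier is the sum of cᵢ (u - 1)ⁱ uʳ⁻ⁱ for i < r, where r is the number of
      -- coefficients; at u = 1 only c₀ survives.
      c₀ ⊛ u ^ suc k ⊕ q ⊛ u∸1 , c zero * 1# + v * (1# + - 1#) ,
      hasValueAt1-⊕ {c₀ ⊛ u ^ suc k} {q ⊛ u∸1}
        (hasValueAt1-⊛ {c₀} {u ^ suc k} (hasValueAt1-const (c zero)) (hasValueAt1-u^ (suc k)))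
        (hasValueAt1-⊛ {q} {u∸1} val (hasValueAt1-⊕ {u} {⊖ 𝟙} hasValueAt1-u
          (hasValueAt1-cong {const (- 1#)} (λ { zero → refl ; (suc n) → sym -0#≈0# }) (hasValueAt1-const (- 1#))))) ,
      trans (cong₂ _+_ (*-identityʳ _) (trans (*-congˡ (-‿inverseʳ 1#)) (zeroʳ v))) (+-identityʳ _) ,
      ∼-respʳ {(c₀ ⊛ u ^ suc k ⊕ q ⊛ u∸1) ⊛ t} {u ^ suc k ⊛ (c₀ ⊛ t ⊕ s)}
        (S.*-congˡ {u ^ suc k} (λ n → trans (+-congʳ (const-⊛ (c zero) t n)) (sym (poly-orbit n))))
        (∼-step c₀ u∸1 (u ^ k) t t′ s q {v} val u∸1⊛t∼ q∼)
      where
      c₀ = const (c zero)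
      t = orbit j ℓ
      t′ = orbit j (D ℓ)
      s = orbit j (poly (c ∘ suc) (D ℓ))
      poly-orbit : ∀ n → orbit j (poly c ℓ) n ≡ c zero * t n + s n
      poly-orbit n =
        trans (sum-cong-≗ λ i → *-congʳ (+-congʳ (*-comm (c zero) (ℓ i)))) (orbit-linear j ℓ (poly (c ∘ suc) (D ℓ)) (c zero) n)
      u∸1⊛t∼ : u∸1 ⊛ t ∼ u ⊛ t′
      u∸1⊛t∼ = 1 , λ { {suc n} _ →
        trans (cong₂ _-_ (u∸1-⊛ t n) (trans (u-⊛ t′ n) (orbit-D j ℓ n))) (-‿inverseʳ _) }

    module _ (D-injective : ∀ ℓ → (∀ j → D ℓ j ≡ 0#) → ∀ j → ℓ j ≡ 0#) where

      -- If c₀ = 0, the vanishing vector is `D` of the combination with shifted coefficients, which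
      -- vanishes too by injectivity. A nonzero c reaches a nonzero constant coefficient after
      -- finitely many shifts.
      annihilator : ∀ k (c : Fin k → K) → (∃ λ i → c i ≢ 0#) → ∀ ℓ → (∀ j → poly c ℓ j ≡ 0#) →
        ∃ λ k → ∃ λ (c : Fin (suc k) → K) → c zero ≢ 0# × (∀ j → poly c ℓ j ≡ 0#)
      annihilator (suc k) c (i , cᵢ≢0) ℓ cℓ≡0 with c zero ≟ 0#
      ... | no c₀≢0  = k , c , c₀≢0 , cℓ≡0
      ... | yes c₀≡0 = annihilator k (c ∘ suc) (nonzero i cᵢ≢0) ℓ (D-injective (poly (c ∘ suc) ℓ) λ j →
          trans (D-poly (c ∘ suc) ℓ j) (trans (sym (trans (+-congʳ (trans (*-congʳ c₀≡0) (zeroˡ _))) (+-identityˡ _))) (cℓ≡0 j)))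
        where
        nonzero : ∀ i → c i ≢ 0# → ∃ λ i → c (suc i) ≢ 0#
        nonzero zero    c₀≢0 = contradiction c₀≡0 c₀≢0
        nonzero (suc i) cᵢ≢0 = i , cᵢ≢0

      annihilated⇒hasMultiplicity : ∀ j ℓ (c : Fin (suc k) → K) → c zero ≢ 0# → (∀ j → poly c ℓ j ≡ 0#) →
        HasMultiplicity (orbit j ℓ) 0#
      annihilated⇒hasMultiplicity {k} j ℓ c c₀≢0 cℓ≡0 =
        let q , v , val , v≡c₀ , q∼ = recurrence j c ℓ in
        q , v , (λ v≡0 → c₀≢0 (trans (sym v≡c₀) v≡0)) , val , ∼0⇒eventually (∼-respʳ {q ⊛ orbit j ℓ} tail≡0 q∼) (zeroʳ v)
        where
        ∼0⇒eventually : ∀ {f a} → f ∼ 𝟘 → a ≡ 0# → Eventually f a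
        ∼0⇒eventually (N , p) a≡0 = N , λ N≤n → trans (sym (x-0≡x _)) (trans (p N≤n) (sym a≡0))
        orbit≡0 : ∀ n → orbit j (poly c ℓ) n ≡ 0#
        orbit≡0 n = sum-0 λ a → trans (*-congʳ (cℓ≡0 a)) (zeroˡ ((M ^ᴹ n) a j))
        tail≡0 : u ^ suc k ⊛ orbit j (poly c ℓ) ≗ 𝟘
        tail≡0 n = trans (S.*-congˡ {u ^ suc k} {y = 𝟘} orbit≡0 n) (S.zeroʳ (u ^ suc k) n)

      orbit-multiplicity : ∀ j ℓ → HasMultiplicity (orbit j ℓ) 0#
      orbit-multiplicity j ℓ =
        -- The m + 1 vectors ℓ (1 - M)ⁱ live in dimension m.
        let c , c≢0 , cℓ≡0 = dependence m (suc m) ℕ.≤-refl (λ a i → iterate (toℕ i) ℓ a)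
            k , c′ , c′₀≢0 , c′ℓ≡0 =
              annihilator (suc m) c c≢0 ℓ (λ j → trans (sum-cong-≗ λ i → *-comm (c i) (iterate (toℕ i) ℓ j)) (cℓ≡0 j))
        in annihilated⇒hasMultiplicity j ℓ c′ c′₀≢0 c′ℓ≡0

      traces-multiplicity : HasMultiplicity (traces M) 0#
      traces-multiplicity = hasMultiplicity-cong (0 , λ {n} _ → sum-cong-≗ λ i → sum-δˡ i (λ a → (M ^ᴹ n) a i))
        (hasMultiplicity-sum (λ i → orbit i (δ i)) (λ i → orbit-multiplicity i (δ i)))

  -- The algebraic multiplicity of the eigenvalue 1 is at least the geometric one: as long as
  -- 1 - M is not surjective, a row vector fixed by M splits off a quotient of dimension one.
  multiplicity : ∀ N (L : List (Fin m)) → length L ≤ N → (M : Mat m m) → (∀ j → j ∈ L ⊎ (∀ i → M i j ≡ 0#)) →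
    ∃ λ a → HasMultiplicity (traces M) (ι (ℤ.+ a)) × IsGenerated M a
  multiplicity {m} N L L≤N M L-columns
    with choose {P = λ j → Solvable (δ ⊝ M) (λ i → δ i j)} {Q = λ j → Obstructed (δ ⊝ M) (λ i → δ i j)} (λ j → alternative m (δ ⊝ M) (λ i → δ i j))
  -- The solutions form a right inverse R of 1 - M. So the cokernel is 0, and ℓ = ℓ (1 - M) R shows
  -- that `D` is injective.
  ... | inj₁ solutions = 0 , subst (HasMultiplicity _) (sym ι-0) (Krylov.traces-multiplicity M D-injective) ,
      (λ _ ()) , λ v → (λ ()) , R ▸ v , λ i → begin
        v i                              ≡⟨ ▸-identityˡ v i ⟨
        (δ ▸ v) i                        ≡⟨ sum-cong-≗ (λ j → *-congʳ (proj₂ (solutions j) i)) ⟩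
        (((δ ⊝ M) ∙ R) ▸ v) i            ≡⟨ ∙-▸ (δ ⊝ M) R v i ⟩
        ((δ ⊝ M) ▸ (R ▸ v)) i            ≡⟨ ⊝-▸ δ M (R ▸ v) i ⟩
        (δ ▸ (R ▸ v)) i - (M ▸ (R ▸ v)) i ≡⟨ cong (_- (M ▸ (R ▸ v)) i) (▸-identityˡ (R ▸ v) i) ⟩
        (R ▸ v) i - (M ▸ (R ▸ v)) i      ≡⟨ +-identityˡ _ ⟨
        0# + ((R ▸ v) i - (M ▸ (R ▸ v)) i) ∎
    where
    open ≡-Reasoning
    R : Mat m m
    R i j = proj₁ (solutions j) i
    D-injective : ∀ ℓ → (∀ j → Krylov.D M ℓ j ≡ 0#) → ∀ j → ℓ j ≡ 0#
    D-injective ℓ Dℓ≡0 j = begin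
      ℓ j                                       ≡⟨ sum-δʳ j ℓ ⟨
      dot ℓ (λ i → δ i j)                       ≡⟨ sum-cong-≗ (λ i → *-congˡ (proj₂ (solutions j) i)) ⟩
      ((λ (_ : Fin 1) → ℓ) ∙ ((δ ⊝ M) ∙ R)) zero j  ≡⟨ ∙-assoc (λ (_ : Fin 1) → ℓ) (δ ⊝ M) R zero j ⟨
      (((λ (_ : Fin 1) → ℓ) ∙ (δ ⊝ M)) ∙ R) zero j
        ≡⟨ sum-0 (λ a → trans (*-congʳ (trans (∙-distribˡ-⊝ (λ (_ : Fin 1) → ℓ) δ M zero a)
                                                       (trans (+-congʳ (sum-δʳ a ℓ)) (Dℓ≡0 a)))) (zeroˡ _)) ⟩
      0#                                        ∎
  -- The obstruction satisfies ℓ M = ℓ and ℓ j = 1: M induces the identity on the one-dimensional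
  -- image of ℓ, and the j-th standard vector gives the section.
  ... | inj₂ (j , ℓ , ℓN , ℓj) = split N L L≤N L-columns
    where
    ℓⱼ≡1 : ℓ j ≡ 1#
    ℓⱼ≡1 = trans (sym (sum-δʳ j ℓ)) ℓj
    ℓM≡ℓ : ∀ a → dot ℓ (λ i → M i a) ≡ ℓ a
    ℓM≡ℓ a = trans (solve 2 (λ x y → y := x :- (x :- y)) refl (ℓ a) (dot ℓ (λ i → M i a)))
      (trans (cong (λ x → ℓ a - x) (trans (+-congʳ (sym (sum-δʳ a ℓ))) (trans (sym (∙-distribˡ-⊝ (λ (_ : Fin 1) → ℓ) δ M zero a)) (ℓN a)))) (x-0≡x _))
    eⱼ : Mat m 1
    eⱼ i _ = δ i j
    ℓᵀ : Mat 1 m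
    ℓᵀ _ = ℓ
    ℓᵀeⱼ≈δ : ℓᵀ ∙ eⱼ ≈ δ
    ℓᵀeⱼ≈δ zero zero = ℓj
    ℓᵀM≈ℓᵀ : ℓᵀ ∙ M ≈ δ ∙ ℓᵀ
    ℓᵀM≈ℓᵀ zero a = trans (ℓM≡ℓ a) (sym (∙-identityˡ ℓᵀ zero a))
    module Q = Quotient M δ ℓᵀ eⱼ ℓᵀeⱼ≈δ ℓᵀM≈ℓᵀ
    B≡ : ∀ i a → Q.B i a ≡ M i a - M i j * ℓ a
    B≡ i a = trans (∙-distribˡ-⊝ M δ (eⱼ ∙ ℓᵀ) i a) (cong₂ _-_ (∙-identityʳ M i a)
      (trans (sum-cong-≗ λ b → trans (*-congˡ (+-identityʳ _)) (sym (*-assoc (M i b) (δ b j) (ℓ a))))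
        (trans (sym (*-distribʳ-sum (ℓ a) (λ b → M i b * δ b j))) (*-congʳ (sum-δʳ j (M i))))))
    zeroColumn : ∀ a → (∀ i → M i a ≡ 0#) → ℓ a ≡ 0#
    zeroColumn a Ma≡0 = trans (sym (ℓM≡ℓ a)) (sum-0 λ i → trans (*-congˡ (Ma≡0 i)) (zeroʳ _))
    δ-traces : ∀ n → traces {1} δ n ≡ 1#
    δ-traces n = trans (+-identityʳ _) (go n zero zero)
      where
      go : ∀ n → δ {1} ^ᴹ n ≈ δ
      go zero    i j = refl
      go (suc n) i j = trans (∙-identityʳ (δ ^ᴹ n) i j) (go n i j)
    removePivot : List (Fin m) → List (Fin m)
    removePivot = List.filter (λ a → ¬? (a Fin.≟ j))
    -- The recursion shrinks not the matrix but the list of columns that may be nonzero. B = M - (M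
    -- eⱼ) ℓ has column j zero because ℓ j = 1, and zero columns of M stay zero because ℓ = ℓ M
    -- vanishes there.
    B-columns : ∀ L → (∀ j → j ∈ L ⊎ (∀ i → M i j ≡ 0#)) → ∀ a → a ∈ removePivot L ⊎ (∀ i → Q.B i a ≡ 0#)
    B-columns L L-columns a with a Fin.≟ j | L-columns a
    ... | yes refl | _         = inj₂ λ i → trans (B≡ i j) (trans (cong (λ x → M i j - x) (trans (*-congˡ ℓⱼ≡1) (*-identityʳ _))) (-‿inverseʳ _))
    ... | no a≢j   | inj₁ a∈L  = inj₁ (∈-filter⁺ (λ a → ¬? (a Fin.≟ j)) a∈L a≢j)
    ... | no a≢j   | inj₂ Ma≡0 = inj₂ λ i → trans (B≡ i a) (trans (cong₂ (λ x y → x - M i j * y) (Ma≡0 i) (zeroColumn a Ma≡0))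
          (trans (cong (λ x → 0# - x) (zeroʳ _)) (x-0≡x 0#)))
    split : ∀ N L → length L ≤ N → (∀ j → j ∈ L ⊎ (∀ i → M i j ≡ 0#)) → ∃ λ a → HasMultiplicity (traces M) (ι (ℤ.+ a)) × IsGenerated M a
    split N L L≤N L-columns with L-columns j
    ... | inj₂ Mj≡0 = contradiction (trans (sym ℓⱼ≡1) (zeroColumn j Mj≡0)) 1≢0
    split zero    [] L≤N L-columns | inj₁ ()
    split (suc N) L L≤N L-columns | inj₁ j∈L
      with a , mult , gen ← multiplicity N (removePivot L) (ℕ.≤-pred (ℕ.≤-trans (List.filter-notAll (λ a → ¬? (a Fin.≟ j)) L (lose j∈L (λ ¬refl → ¬refl refl))) L≤N))
        Q.B (B-columns L L-columns) =
      -- All traces of the 1 × 1 identity are 1, so the quotient adds 1 to the multiplicity; it also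
      -- adds one generator.
      suc a , subst (HasMultiplicity _) (sym (ι-nat-suc a)) (Q.hasMultiplicity-+ (eventually⇒hasMultiplicity (0 , λ {n} _ → δ-traces n)) mult) ,
      Q.isGenerated-+ {1} {a} (δ , λ v → v , (λ _ → 0#) , λ { zero → sym (trans
        (cong₂ _+_ (▸-identityˡ v zero) (trans (cong (λ x → 0# - x) (▸-0 (δ {1}) {λ _ → 0#} (λ _ → refl) zero)) (x-0≡x 0#))) (+-identityʳ _)) }) gen

  hasMultiplicity×isGenerated : (M : Mat m m) → ∃ λ a → HasMultiplicity (traces M) (ι (ℤ.+ a)) × IsGenerated M a
  hasMultiplicity×isGenerated M = multiplicity _ (List.allFin _) ℕ.≤-refl M (λ j → inj₁ (∈-allFin j))

  -- Traces of the adjacency matrix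

  𝟏 : Bool → K
  𝟏 b = if b then 1# else 0#

  𝟏-∧ : ∀ a b → 𝟏 (a ∧ b) ≡ 𝟏 a * 𝟏 b
  𝟏-∧ true  b = sym (*-identityˡ _)
  𝟏-∧ false b = sym (zeroˡ _)

  count-tabulate : ∀ {P : S → Set} (P? : Decidable P) {n} (f : Fin n → S) →
    ι (ℤ.+ Vec.count P? (Vec.tabulate f)) ≡ sum (λ i → 𝟏 (does (P? (f i))))
  count-tabulate P? {zero}  f = ι-0
  count-tabulate P? {suc n} f with does (P? (f zero))
  ... | true  = trans (ι-nat-suc _) (+-congˡ (count-tabulate P? (f ∘ suc)))
  ... | false = trans (count-tabulate P? (f ∘ suc)) (sym (+-identityˡ _))

  listSum : (S → K) → List S → K
  listSum f []       = 0#
  listSum f (x ∷ xs) = f x + listSum f xs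

  listSum-cong : ∀ {f g : S → K} → f ≗ g → listSum f ≗ listSum g
  listSum-cong p []       = refl
  listSum-cong p (x ∷ xs) = cong₂ _+_ (p x) (listSum-cong p xs)

  listSum-* : ∀ a (f : S → K) xs → listSum (λ x → a * f x) xs ≡ a * listSum f xs
  listSum-* a f []       = sym (zeroʳ a)
  listSum-* a f (x ∷ xs) = trans (+-congˡ (listSum-* a f xs)) (sym (distribˡ _ _ _))

  listSum-++ : ∀ (f : S → K) xs ys → listSum f (xs ++ ys) ≡ listSum f xs + listSum f ys
  listSum-++ f []       ys = sym (+-identityˡ _)
  listSum-++ f (x ∷ xs) ys = trans (+-congˡ (listSum-++ f xs ys)) (solve 3 (λ a b c → a :+ (b :+ c) := (a :+ b) :+ c) refl _ _ _)

  listSum-map : ∀ (f : T → K) (g : S → T) xs → listSum f (List.map g xs) ≡ listSum (f ∘ g) xs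
  listSum-map f g []       = refl
  listSum-map f g (x ∷ xs) = +-congˡ (listSum-map f g xs)

  listSum-product : ∀ {C : Set} (f : C → K) (g : S → T → C) xs ys →
    listSum f (List.cartesianProductWith g xs ys) ≡ listSum (λ x → listSum (λ y → f (g x y)) ys) xs
  listSum-product f g []       ys = refl
  listSum-product f g (x ∷ xs) ys = trans (listSum-++ f (List.map (g x) ys) _)
    (cong₂ _+_ (listSum-map f (g x) ys) (listSum-product f g xs ys))

  listSum-tabulate : ∀ (f : S → K) {n} (g : Fin n → S) → listSum f (List.tabulate g) ≡ sum (f ∘ g)
  listSum-tabulate f {zero}  g = refl
  listSum-tabulate f {suc n} g = +-congˡ (listSum-tabulate f (g ∘ suc))

  length-filter : ∀ {P : S → Set} (P? : Decidable P) xs →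
    ι (ℤ.+ length (List.filter P? xs)) ≡ listSum (λ x → 𝟏 (does (P? x))) xs
  length-filter P? []       = ι-0
  length-filter P? (x ∷ xs) with does (P? x)
  ... | true  = trans (ι-nat-suc _) (+-congˡ (length-filter P? xs))
  ... | false = trans (length-filter P? xs) (sym (+-identityˡ _))

  adjacencyₖ : (X : Digraph) → Mat (Digraph.#V X) (Digraph.#V X)
  adjacencyₖ X i j = ι (adjacency X i j)

  module _ (X : Digraph) where
    open Digraph X using (#V; #E; o; t)

    adjacency-sum : ∀ i j → adjacencyₖ X i j ≡ sum (λ e → δ (o e) j * δ (t e) i)
    adjacency-sum i j =
      trans (count-tabulate (λ e → (o e Fin.≟ j) ×-dec (t e Fin.≟ i)) id) (sum-cong-≗ λ e → 𝟏-∧ (does (o e Fin.≟ j)) (does (t e Fin.≟ i)))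

    sum-adjacency : ∀ (f : Vect #V) j → sum (λ i → f i * adjacencyₖ X i j) ≡ sum (λ e → δ (o e) j * f (t e))
    sum-adjacency f j = begin
      sum (λ i → f i * adjacencyₖ X i j)                          ≡⟨ sum-cong-≗ (λ i → *-congˡ (adjacency-sum i j)) ⟩
      sum (λ i → f i * sum (λ e → δ (o e) j * δ (t e) i))
        ≡⟨ sum-cong-≗ (λ i → *-distribˡ-sum (f i) (λ e → δ (o e) j * δ (t e) i)) ⟩
      sum (λ i → sum (λ e → f i * (δ (o e) j * δ (t e) i)))       ≡⟨ ∑-comm (λ i e → f i * (δ (o e) j * δ (t e) i)) ⟩
      sum (λ e → sum (λ i → f i * (δ (o e) j * δ (t e) i)))
        ≡⟨ sum-cong-≗ (λ e → sum-cong-≗ λ i → solve 3 (λ f a b → f :* (a :* b) := a :* (b :* f)) refl (f i) (δ (o e) j) (δ (t e) i)) ⟩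
      sum (λ e → sum (λ i → δ (o e) j * (δ (t e) i * f i)))
        ≡⟨ sum-cong-≗ (λ e → *-distribˡ-sum (δ (o e) j) (λ i → δ (t e) i * f i)) ⟨
      sum (λ e → δ (o e) j * sum (λ i → δ (t e) i * f i))         ≡⟨ sum-cong-≗ (λ e → *-congˡ (sum-δˡ (t e) f)) ⟩
      sum (λ e → δ (o e) j * f (t e))                             ∎
      where open ≡-Reasoning

    private
      linked : List (E X) → K
      linked w = 𝟏 (does (linked? (λ e e′ → t e Fin.≟ o e′) w))

    -- Rows of the adjacency matrix are indexed by targets, so walks from t e to o e′ belong to the
    -- entry (o e′, t e). The edge after e is the rightmost factor of the power.
    pathCount : ∀ n e e′ → listSum (λ w → linked (e ∷ w ++ [ e′ ])) (edgeWords X n) ≡ (adjacencyₖ X ^ᴹ n) (o e′) (t e)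
    pathCount zero    e e′ =
      trans (+-identityʳ _) (trans (𝟏-∧ (does (t e Fin.≟ o e′)) true) (trans (*-identityʳ _) (δ-sym (t e) (o e′))))
    pathCount (suc n) e e′ = begin
      listSum (λ w → linked (e ∷ w ++ [ e′ ])) (edgeWords X (suc n))
        ≡⟨ listSum-product (λ w → linked (e ∷ w ++ [ e′ ])) _∷_ (List.allFin #E) (edgeWords X n) ⟩
      listSum (λ e₁ → listSum (λ w → linked (e ∷ e₁ ∷ w ++ [ e′ ])) (edgeWords X n)) (List.allFin #E)
        ≡⟨ listSum-tabulate (λ e₁ → listSum (λ w → linked (e ∷ e₁ ∷ w ++ [ e′ ])) (edgeWords X n)) id ⟩
      sum (λ e₁ → listSum (λ w → linked (e ∷ e₁ ∷ w ++ [ e′ ])) (edgeWords X n))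
        ≡⟨ sum-cong-≗ (λ e₁ → trans (listSum-cong (λ w → 𝟏-∧ (does (t e Fin.≟ o e₁)) _) (edgeWords X n))
             (listSum-* (δ (t e) (o e₁)) (λ w → linked (e₁ ∷ w ++ [ e′ ])) (edgeWords X n))) ⟩
      sum (λ e₁ → δ (t e) (o e₁) * listSum (λ w → linked (e₁ ∷ w ++ [ e′ ])) (edgeWords X n))
        ≡⟨ sum-cong-≗ (λ e₁ → cong₂ _*_ (δ-sym (t e) (o e₁)) (pathCount n e₁ e′)) ⟩
      sum (λ e₁ → δ (o e₁) (t e) * (adjacencyₖ X ^ᴹ n) (o e′) (t e₁))
        ≡⟨ sum-adjacency (λ v → (adjacencyₖ X ^ᴹ n) (o e′) v) (t e) ⟨
      (adjacencyₖ X ^ᴹ suc n) (o e′) (t e) ∎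
      where open ≡-Reasoning

    -- A cycle consists of its first edge e and a walk of n edges from t e back to o e; summing over
    -- e supplies the remaining factor of the power.
    cycleCounts≡traces : ∀ n → cycleCounts X (suc n) ≡ traces (adjacencyₖ X) (suc n)
    cycleCounts≡traces n = begin
      ι (ℤ.+ length (cycles X (suc n)))
        ≡⟨ length-filter (isCycle? X) (edgeWords X (suc n)) ⟩
      listSum (λ w → 𝟏 (does (isCycle? X w))) (edgeWords X (suc n))
        ≡⟨ listSum-product (λ w → 𝟏 (does (isCycle? X w))) _∷_ (List.allFin #E) (edgeWords X n) ⟩
      listSum (λ e → listSum (λ w → linked (e ∷ w ++ [ e ])) (edgeWords X n)) (List.allFin #E)
        ≡⟨ listSum-tabulate (λ e → listSum (λ w → linked (e ∷ w ++ [ e ])) (edgeWords X n)) id ⟩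
      sum (λ e → listSum (λ w → linked (e ∷ w ++ [ e ])) (edgeWords X n))
        ≡⟨ sum-cong-≗ (λ e → trans (pathCount n e e) (sym (sum-δˡ (o e) (λ v → (adjacencyₖ X ^ᴹ n) v (t e))))) ⟩
      sum (λ e → sum (λ v → δ (o e) v * (adjacencyₖ X ^ᴹ n) v (t e)))
        ≡⟨ ∑-comm (λ e v → δ (o e) v * (adjacencyₖ X ^ᴹ n) v (t e)) ⟩
      sum (λ v → sum (λ e → δ (o e) v * (adjacencyₖ X ^ᴹ n) v (t e)))
        ≡⟨ sum-cong-≗ (λ v → sum-adjacency (λ w → (adjacencyₖ X ^ᴹ n) v w) v) ⟨
      traces (adjacencyₖ X) (suc n) ∎
      where open ≡-Reasoning

  -- Adjacency matrices and coverings

  module Pushforward {X Y : Digraph} (f : Morphism Y X) (isCovering : IsCovering f) where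
    private
      module X = Digraph X
      module Y = Digraph Y
    open Morphism f
    open IsCovering isCovering

    push : Mat X.#V Y.#V
    push x y = δ (onV y) x

    section : Mat Y.#V X.#V
    section y x = δ y (proj₁ (surjective-V x))

    push-section : push ∙ section ≈ δ
    push-section x x′ = trans (sum-δʳ (proj₁ (surjective-V x′)) (λ y → δ (onV y) x))
      (trans (cong (λ z → δ z x) (proj₂ (surjective-V x′))) (δ-sym x′ x))

    -- The bijection on outgoing edges in terms of indicators: one edge leaving y lies over e′ if e′
    -- leaves the image of y, and none otherwise.
    uniqueLift : ∀ y e′ → δ (X.o e′) (onV y) ≡ sum (λ e → δ (Y.o e) y * δ (onE e) e′)
    uniqueLift y e′ with X.o e′ Fin.≟ onV y
    ... | no o≢ = sym (sum-0 λ e → zero-term e (Y.o e Fin.≟ y) (onE e Fin.≟ e′))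
      where
      zero-term : ∀ e (p : Dec (Y.o e ≡ y)) (q : Dec (onE e ≡ e′)) → 𝟏 (does p) * 𝟏 (does q) ≡ 0#
      zero-term e (yes p) (yes q) = contradiction (trans (cong X.o (sym q)) (trans (o-commute e) (cong onV p))) o≢
      zero-term e (yes p) (no _)  = zeroʳ _
      zero-term e (no _)  _       = zeroˡ _
    ... | yes o≡ = sym (trans (sum-cong-≗ λ e → trans (term e (Y.o e Fin.≟ y) (onE e Fin.≟ e′) (e₀ Fin.≟ e)) (sym (*-identityʳ _)))
                     (sum-δˡ e₀ (λ _ → 1#)))
      where
      lift = proj₂ (outgoing y) (e′ , o≡)
      e₀ = proj₁ (proj₁ lift)
      o≡y : Y.o e₀ ≡ y
      o≡y = proj₂ (proj₁ lift)
      lifts : onE e₀ ≡ e′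
      lifts = proj₂ lift {proj₁ lift} refl
      term : ∀ e (p : Dec (Y.o e ≡ y)) (q : Dec (onE e ≡ e′)) (r : Dec (e₀ ≡ e)) → 𝟏 (does p) * 𝟏 (does q) ≡ 𝟏 (does r)
      term e (yes p) (yes q) (yes r) = *-identityˡ _
      term e (yes p) (yes q) (no ¬r) = contradiction
        (proj₁ (outgoing y) {e₀ , o≡y} {e , p} (trans lifts (sym q))) ¬r
      term e (yes p) (no ¬q) (yes r) = contradiction (trans (cong onE (sym r)) lifts) ¬q
      term e (no ¬p) q       (yes r) = contradiction (trans (cong Y.o (sym r)) o≡y) ¬p
      term e (yes p) (no ¬q) (no _)  = zeroʳ _
      term e (no ¬p) q       (no _)  = zeroˡ _

    -- Both entries count the edges of X from the image of y to x, on the left through their lifts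
    -- starting at y.
    push-adjacency : push ∙ adjacencyₖ Y ≈ adjacencyₖ X ∙ push
    push-adjacency x y = begin
      sum (λ y′ → δ (onV y′) x * adjacencyₖ Y y′ y)                               ≡⟨ sum-adjacency Y (λ y′ → δ (onV y′) x) y ⟩
      sum (λ e → δ (Y.o e) y * δ (onV (Y.t e)) x)
        ≡⟨ sum-cong-≗ (λ e → *-congˡ (cong (λ z → δ z x) (t-commute e))) ⟨
      sum (λ e → δ (Y.o e) y * δ (X.t (onE e)) x)
        ≡⟨ sum-cong-≗ (λ e → *-congˡ (sum-δˡ (onE e) (λ e′ → δ (X.t e′) x))) ⟨
      sum (λ e → δ (Y.o e) y * sum (λ e′ → δ (onE e) e′ * δ (X.t e′) x))
        ≡⟨ ∙-assoc (λ (_ : Fin 1) e → δ (Y.o e) y) (λ e e′ → δ (onE e) e′) (λ e′ (_ : Fin 1) → δ (X.t e′) x) zero zero ⟨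
      sum (λ e′ → sum (λ e → δ (Y.o e) y * δ (onE e) e′) * δ (X.t e′) x)
        ≡⟨ sum-cong-≗ (λ e′ → *-congʳ (uniqueLift y e′)) ⟨
      sum (λ e′ → δ (X.o e′) (onV y) * δ (X.t e′) x)                              ≡⟨ adjacency-sum X x (onV y) ⟨
      adjacencyₖ X x (onV y)                                                      ≡⟨ sum-δʳ (onV y) (adjacencyₖ X x) ⟨
      sum (λ x′ → adjacencyₖ X x x′ * δ x′ (onV y))
        ≡⟨ sum-cong-≗ (λ x′ → *-congˡ (δ-sym x′ (onV y))) ⟩
      sum (λ x′ → adjacencyₖ X x x′ * δ (onV y) x′)                               ∎
      where open ≡-Reasoning

  -- The defect

  ι-sum : ∀ (f : Fin n → ℤ) → ι (sumᶻ f) ≡ sum (ι ∘ f)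
  ι-sum {zero}  f = ι-0
  ι-sum {suc n} f = trans (ι-+ (f zero) _) (+-congˡ (ι-sum (f ∘ suc)))

  commonDenominator : ∀ (f : Vect n) → ∃₂ λ d (g : Fin n → ℤ) → d ≢ ℤ.0ℤ × (∀ i → ι d * f i ≡ ι (g i))
  commonDenominator {zero}  f = ℤ.1ℤ , (λ ()) , (λ ()) , λ ()
  commonDenominator {suc n} f
    with d , g , d≢0 , f≡ ← commonDenominator (f ∘ suc) | d₀ , n₀ , d₀≢0 , f₀≡ ← fraction (f zero) =
    d₀ ℤ.* d , (λ { zero → n₀ ℤ.* d ; (suc i) → d₀ ℤ.* g i }) , nonzero , λ
      { zero    → trans (*-congʳ (ι-* d₀ d)) (trans (solve 3 (λ a b c → a :* b :* c := a :* c :* b) refl (ι d₀) (ι d) (f zero))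
                    (trans (*-congʳ f₀≡) (sym (ι-* n₀ d))))
      ; (suc i) → trans (*-congʳ (ι-* d₀ d)) (trans (*-assoc _ _ _) (trans (*-congˡ (f≡ i)) (sym (ι-* d₀ (g i))))) }
    where
    nonzero : d₀ ℤ.* d ≢ ℤ.0ℤ
    nonzero eq with ℤ.i*j≡0⇒i≡0∨j≡0 d₀ eq
    ... | inj₁ d₀≡0 = d₀≢0 d₀≡0
    ... | inj₂ d≡0  = d≢0 d≡0

  module BowenFranksGroup (X : Digraph) where
    open Digraph X using (#V)
    open AbelianGroup (BowenFranks X) using (commutativeMonoid)
    open CommutativeMonoidSum commutativeMonoid using () renaming (sum to sumᴮ)

    N : Matrix #V
    N i j = Id i j ℤ.- adjacency X i j

    sumᴮ-pointwise : ∀ (f : Fin k → Fin #V → ℤ) i → sumᴮ f i ≡ sumᶻ (λ j → f j i)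
    sumᴮ-pointwise {zero}  f i = refl
    sumᴮ-pointwise {suc k} f i = cong (λ s → f zero i ℤ.+ s) (sumᴮ-pointwise (f ∘ suc) i)

    scalar-pointwise : ∀ c (x : Fin #V → ℤ) i → _·_ (BowenFranks X) c x i ≡ c ℤ.* x i
    scalar-pointwise (ℤ.+ n)    x i = go n
      where
      go : ∀ n → _·_ (BowenFranks X) (ℤ.+ n) x i ≡ ℤ.+ n ℤ.* x i
      go zero    = refl
      go (suc n) =
        trans (cong (λ s → x i ℤ.+ s) (go n)) (sym (trans (ℤ.*-distribʳ-+ (x i) (ℤ.+ 1) (ℤ.+ n)) (cong (ℤ._+ (ℤ.+ n ℤ.* x i)) (ℤ.*-identityˡ (x i)))))
    scalar-pointwise ℤ.-[1+ n ] x i = trans (cong ℤ.-_ (scalar-pointwise (ℤ.+ suc n) x i)) (ℤ.neg-distribˡ-* (ℤ.+ suc n) (x i))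

    ι-combination : ∀ (c : Fin k → ℤ) (x : Fin k → Fin #V → ℤ) i →
      ι (sumᴮ (λ j → _·_ (BowenFranks X) (c j) (x j)) i) ≡ ((λ i j → ι (x j i)) ▸ (ι ∘ c)) i
    ι-combination c x i = trans (cong ι (sumᴮ-pointwise (λ j → _·_ (BowenFranks X) (c j) (x j)) i))
      (trans (ι-sum (λ j → _·_ (BowenFranks X) (c j) (x j) i))
        (sum-cong-≗ λ j → trans (cong ι (trans (scalar-pointwise (c j) (x j) i) (ℤ.*-comm (c j) (x j i)))) (ι-* (x j i) (c j))))

    ι-Id : ∀ {n} (i j : Fin n) → ι (Id i j) ≡ δ i j
    ι-Id i j with i Fin.≟ j
    ... | yes _ = ι-1
    ... | no _  = ι-0

    ι-N : ∀ a i → ι ((N *ᵥ a) i) ≡ ι (a i) - (adjacencyₖ X ▸ (ι ∘ a)) i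
    ι-N a i = trans (ι-sum (λ j → N i j ℤ.* a j)) (trans
      (sum-cong-≗ λ j → trans (ι-* (N i j) (a j)) (*-congʳ (trans (ι-+ (Id i j) (ℤ.- adjacency X i j)) (cong₂ _+_ (ι-Id i j) (ι-neg (adjacency X i j))))))
      (trans (⊝-▸ δ (adjacencyₖ X) (ι ∘ a) i) (+-congʳ (▸-identityˡ (ι ∘ a) i))))

    -- A vanishing sum in the cokernel comes with an integral preimage a, so under `ι` it becomes a
    -- relation modulo the image of 1 - A over the field.
    isIndependent⇒linearlyIndependent : (js : Fin k → Fin #V) → IsIndependentModulo (adjacencyₖ X) (standard js) →
      LinearlyIndependent (BowenFranks X) (λ j i → Id i (js j))
    isIndependent⇒linearlyIndependent js independent c (a , eq) j = ι-injective (trans (independent (ι ∘ c) (ι ∘ a) (λ i → begin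
        (standard js ▸ (ι ∘ c)) i                                            ≡⟨ sum-cong-≗ (λ j → *-congʳ (ι-Id i (js j))) ⟨
        ((λ i j → ι (Id i (js j))) ▸ (ι ∘ c)) i                              ≡⟨ ι-combination c (λ j i → Id i (js j)) i ⟨
        ι (sumᴮ (λ j → _·_ (BowenFranks X) (c j) (λ i → Id i (js j))) i)     ≡⟨ cong ι (trans (eq i) (ℤ.+-identityˡ _)) ⟩
        ι ((N *ᵥ a) i)                                                       ≡⟨ ι-N a i ⟩
        ι (a i) - (adjacencyₖ X ▸ (ι ∘ a)) i                                 ∎) j) (sym ι-0))
      where open ≡-Reasoning

    rank⇒isGenerated : ∀ {b} → HasAlgebraicRank X b → ∃ λ g → g ≤ b × IsGenerated (adjacencyₖ X) g
    rank⇒isGenerated {b} (_ , dependent) = isGenerated-bound (adjacencyₖ X) b λ js independent →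
      dependent (λ j i → Id i (js j)) (isIndependent⇒linearlyIndependent js independent)

    -- More than g vectors are dependent over the field modulo the image of 1 - A, and clearing
    -- denominators makes the relation integral while keeping it nontrivial.
    isGenerated⇒rank≤ : ∀ {b g} → HasAlgebraicRank X b → IsGenerated (adjacencyₖ X) g → b ≤ g
    isGenerated⇒rank≤ {b} {g} ((x , independent) , _) gen with ℕ.≤-<-connex b g
    ... | inj₁ b≤g = b≤g
    ... | inj₂ g<b
      with c , w , (j , cⱼ≢0) , eq ← isGenerated⇒dependent gen g<b (λ i j → ι (x j i))
      with d , a , d≢0 , a≡ ← commonDenominator c | d′ , a′ , d′≢0 , a′≡ ← commonDenominator w =
      contradiction (trans (sym (rescale j)) (trans (cong ι (independent c′ (w′ , relation) j)) ι-0))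
        (*-≢0 (*-≢0 (ι≢0 d′≢0) (ι≢0 d≢0)) cⱼ≢0)
      where
      open ≡-Reasoning
      ι≢0 : ∀ {n} → n ≢ ℤ.0ℤ → ι n ≢ 0#
      ι≢0 n≢0 eq = n≢0 (ι-injective (trans eq (sym ι-0)))
      -- One factor for c and w together, since the relation involves both.
      D = ι d′ * ι d
      c′ : Fin b → ℤ
      c′ j = d′ ℤ.* a j
      w′ : Fin #V → ℤ
      w′ i = d ℤ.* a′ i
      rescale : ∀ j → ι (c′ j) ≡ D * c j
      rescale j = trans (ι-* d′ (a j)) (trans (*-congˡ (sym (a≡ j))) (sym (*-assoc _ _ _)))
      rescale′ : ∀ i → ι (w′ i) ≡ D * w i
      rescale′ i =
        trans (ι-* d (a′ i)) (trans (*-congˡ (sym (a′≡ i))) (solve 3 (λ a b c → a :* (b :* c) := b :* a :* c) refl _ _ _))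
      scale : ∀ {n} (A : Mat #V n) (v : Vect n) (v′ : Fin n → ℤ) → (∀ j → ι (v′ j) ≡ D * v j) → ∀ i → (A ▸ (ι ∘ v′)) i ≡ D * (A ▸ v) i
      scale A v v′ p i =
        trans (sum-cong-≗ λ j → trans (*-congˡ (p j)) (solve 3 (λ a d v → a :* (d :* v) := d :* (a :* v)) refl (A i j) D (v j)))
        (sym (*-distribˡ-sum D (λ j → A i j * v j)))
      relation : ∀ i → sumᴮ (λ j → _·_ (BowenFranks X) (c′ j) (x j)) i ≡ ℤ.0ℤ ℤ.+ (N *ᵥ w′) i
      relation i = ι-injective (begin
        ι (sumᴮ (λ j → _·_ (BowenFranks X) (c′ j) (x j)) i)     ≡⟨ ι-combination c′ x i ⟩
        ((λ i j → ι (x j i)) ▸ (ι ∘ c′)) i                      ≡⟨ scale (λ i j → ι (x j i)) c c′ rescale i ⟩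
        D * ((λ i j → ι (x j i)) ▸ c) i                         ≡⟨ *-congˡ (eq i) ⟩
        D * (w i - (adjacencyₖ X ▸ w) i)
          ≡⟨ solve 3 (λ d a b → d :* (a :- b) := d :* a :- d :* b) refl D (w i) ((adjacencyₖ X ▸ w) i) ⟩
        D * w i - D * (adjacencyₖ X ▸ w) i                      ≡⟨ cong₂ _-_ (rescale′ i) (scale (adjacencyₖ X) w w′ rescale′ i) ⟨
        ι (w′ i) - (adjacencyₖ X ▸ (ι ∘ w′)) i                  ≡⟨ ι-N w′ i ⟨
        ι ((N *ᵥ w′) i)                                         ≡⟨ cong ι (ℤ.+-identityˡ _) ⟨
        ι (ℤ.0ℤ ℤ.+ (N *ᵥ w′) i)                                ∎)

  -- Two signs cancel: Z has order -a at u = 1, and order k corresponds to multiplicity -k.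
  analyticRank⇒hasMultiplicity : ∀ {X a} → HasAnalyticRank X a → HasMultiplicity (traces (adjacencyₖ X)) (ι a)
  analyticRank⇒hasMultiplicity {X} {a} rank = hasMultiplicity-cong (1 , λ { {suc n} _ → cycleCounts≡traces X n })
    (subst (λ k → HasMultiplicity (cycleCounts X) (ι k)) (ℤ.neg-involutive a)
      (hasOrderAt1⇒hasMultiplicity (logDerivative-zeta X) rank))

  module _ {X Y : Digraph} (π : Covering Y X) where
    open Covering π
    open Pushforward morphism isCovering
    private
      module Q = Quotient (adjacencyₖ Y) (adjacencyₖ X) push section push-section push-adjacency

    analyticRank-covering : ∀ {aY aX q} → HasAnalyticRank Y aY → HasAnalyticRank X aX →
      HasMultiplicity (traces Q.B) (ι (ℤ.+ q)) → aY ≡ aX ℤ.+ ℤ.+ q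
    analyticRank-covering {aX = aX} {q} analyticY analyticX multQ = ι-injective (trans
      (hasMultiplicity-unique (analyticRank⇒hasMultiplicity {Y} analyticY)
        (Q.hasMultiplicity-+ (analyticRank⇒hasMultiplicity {X} analyticX) multQ)) (sym (ι-+ aX (ℤ.+ q))))

    algebraicRank-covering : ∀ {bY bX q} → HasAlgebraicRank Y bY → HasAlgebraicRank X bX →
      IsGenerated Q.B q → bY ≤ bX ℕ.+ q
    algebraicRank-covering {q = q} algebraicY algebraicX genQ =
      let g , g≤bX , genX = BowenFranksGroup.rank⇒isGenerated X algebraicX in
      ℕ.≤-trans (BowenFranksGroup.isGenerated⇒rank≤ Y algebraicY (Q.isGenerated-+ genX genQ)) (ℕ.+-monoˡ-≤ q g≤bX)

    defect-monotone : ∀ {δY δX} → HasDefect Y δY → HasDefect X δX → δX ℤ.≤ δY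
    defect-monotone (aY , bY , analyticY , algebraicY , refl) (aX , bX , analyticX , algebraicX , refl) =
      -- The same q is what a gains and the most that b can gain.
      let q , multQ , genQ = hasMultiplicity×isGenerated Q.B in begin
      aX ℤ.- ℤ.+ bX                              ≡⟨ cancel aX (ℤ.+ bX) (ℤ.+ q) ⟩
      (aX ℤ.+ ℤ.+ q) ℤ.- (ℤ.+ bX ℤ.+ ℤ.+ q)
        ≡⟨ cong (ℤ._- (ℤ.+ bX ℤ.+ ℤ.+ q)) (analyticRank-covering analyticY analyticX multQ) ⟨
      aY ℤ.- (ℤ.+ bX ℤ.+ ℤ.+ q)
        ≤⟨ ℤ.+-monoʳ-≤ aY (ℤ.neg-mono-≤ (ℤ.+≤+ (algebraicRank-covering algebraicY algebraicX genQ))) ⟩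
      aY ℤ.- ℤ.+ bY                              ∎
      where
      open ℤ.≤-Reasoning
      cancel : ∀ a b q → a ℤ.- b ≡ (a ℤ.+ q) ℤ.- (b ℤ.+ q)
      cancel = ℤ.solve-∀

theoremC : (p : ℕ) → Prime p → (d : ℕ) → d ≥ 1 →
    (T : Tower p d) → (∀ n → StronglyConnected (Tower.X T n)) →
    (n : ℕ) → n ≥ 1 →
    (δₙ δₙ₋₁ : ℤ) →
    HasDefect (Tower.X T n) δₙ →
    HasDefect (Tower.X T (n ∸ 1)) δₙ₋₁ →
    δₙ ≥ᶻ δₙ₋₁
theoremC p _ d _ T _ (suc n) _ δₙ δₙ₋₁ = defect-monotone (Tower.π T n)
  where open OverFractionField ℚ-fractionField
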